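{- For every integer $n\ge0$: $$\dim(\mathbf{WQSym}_n)=\#\{\text{blue-packed forests of size } n\},\qquad \dim(\mathrm{Prim}_n)=\#\{\text{blue-packed trees of size } n\},$$ $$\dim(\mathrm{TPrim}_n)=\#\{\text{blue-packed trees of size } n \text{ whose root has empty left forest}\}.$$
   Context: Words are finite words over the positive integers; $|w|$ is the length, $\max(w)$ the largest letter ($\max(\varepsilon)=0$). A word $w$ is packed if every integer $1,\dots,\max(w)$ occurs in it; $\mathrm{PW}_n$ is the set of packed words of length $n$. $\mathrm{pack}(w)$ replaces the $j$-th smallest distinct letter of $w$ by $j$; $u|_{\le i}$ (resp. $u|_{>i}$) is the subword of letters $\le i$ (resp. $>i$). $\mathbf{WQSym}_n$ is the vector space with basis $(\mathbb{Q}_w)_{w\in\mathrm{PW}_n}$. For $u=u_1\cdots u_n\in\mathrm{PW}_n$, $n\ge1$, define $\Delta_\prec(\mathbb{Q}_u)=\sum_{i=u_n}^{\max(u)-1}\mathbb{Q}_{u|_{\le i}}\otimes\mathbb{Q}_{\mathrm{pack}(u|_{>i})}$ and $\Delta_\succ(\mathbb{Q}_u)=\sum_{i=1}^{u_n-1}\mathbb{Q}_{u|_{\le i}}\otimes\mathbb{Q}_{\mathrm{pack}(u|_{>i})}$, extended linearly. For $n\ge1$, $\mathrm{Prim}_n=\mathbf{WQSym}_n\cap\ker(\Delta_\prec+\Delta_\succ)$ and $\mathrm{TPrim}_n=\mathbf{WQSym}_n\cap\ker\Delta_\prec\cap\ker\Delta_\succ$ (both $0$ for $n=0$). A biplane tree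 with labels in $L$ is recursively $\mathrm{Node}(x,f_\ell,f_r)$ with root label $x\in L$ and $f_\ell,f_r$ (left and right forests) finite ordered, possibly empty, lists of such trees; a forest is a finite ordered list of trees. Blue-packed trees have labels $i^\alpha$ with $i$ a positive integer and $\alpha\in\{\circ,\bullet\}$. The weight $\omega$ of a tree (or forest) is its number of nodes whose label has $\alpha=\circ$; its size is its total number of nodes. A tree $t=\mathrm{Node}(i^\alpha,[\ell_1,\dots,\ell_g],[r_1,\dots,r_d])$ is blue-packed if all $\ell_j,r_j$ are blue-packed and either ($d=0$ and $i^\alpha=1^\circ$) or ($d=1$, $i^\alpha\ne1^\circ$ and $1\le i\le\omega(r_1)$). A blue-packed forest is a list of blue-packed trees. -}

module Defs where

open import Data.Bool using (Bool; true; false; _∧_; _∨_; not; if_then_else_; T)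
open import Data.Nat using (ℕ; zero; suc; _∸_; _≡ᵇ_; _≤ᵇ_; _<ᵇ_)
import Data.Nat as N
open import Data.List using (List; []; _∷_; map; filter; length; upTo; foldr; concatMap; sum)
import Data.List as L
open import Data.Vec using (Vec; []; _∷_; lookup)
open import Data.Fin using (Fin)
open import Data.Product using (Σ; _×_; _,_; ∃-syntax)
open import Data.Integer using (+_)
open import Data.Rational using (ℚ; 0ℚ; _+_; _*_; _/_)
open import Relation.Binary.PropositionalEquality using (_≡_)
open import Relation.Nullary using (¬_)

-- Words over the positive integers (letters are naturals; packed words
-- only contain letters ≥ 1).

Word : Set
Word = List ℕ

maxW : Word → ℕ
maxW = foldr N._⊔_ 0

_∈ᵇ_ : ℕ → Word → Bool
x ∈ᵇ []       = false
x ∈ᵇ (y ∷ ys) = (x ≡ᵇ y) ∨ (x ∈ᵇ ys)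

allᵇ : {A : Set} → (A → Bool) → List A → Bool
allᵇ p []       = true
allᵇ p (x ∷ xs) = p x ∧ allᵇ p xs

range : ℕ → ℕ → List ℕ
range a b = map (a N.+_) (upTo (b ∸ a))

isPacked : Word → Bool
isPacked w = allᵇ (λ x → 1 ≤ᵇ x) w ∧ allᵇ (λ j → j ∈ᵇ w) (range 1 (suc (maxW w)))

isPW : ℕ → Word → Bool
isPW n w = (length w ≡ᵇ n) ∧ isPacked w

wordsOf : ℕ → ℕ → List Word
wordsOf zero    m = [] ∷ []
wordsOf (suc n) m = concatMap (λ x → map (x ∷_) (wordsOf n m)) (range 1 (suc m))

packedWords : ℕ → List Word
packedWords n = filter (λ w → T? (isPacked w)) (wordsOf n n)
  where
  open import Relation.Nullary.Decidable using () renaming (T? to T?)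

-- pack(w): the j-th smallest distinct letter of w is replaced by j
-- (the rank of x is the number of distinct letters y of w with 1 ≤ y ≤ x)
pack : Word → Word
pack w = map (λ x → length (filter (λ y → T? (y ∈ᵇ w)) (range 1 (suc x)))) w
  where
  open import Relation.Nullary.Decidable using () renaming (T? to T?)

restrictLe : ℕ → Word → Word
restrictLe i = filter (λ x → x N.≤? i)

restrictGt : ℕ → Word → Word
restrictGt i = filter (λ x → i N.<? x)

lastLetter : Word → ℕ
lastLetter []           = 0
lastLetter (x ∷ [])     = x
lastLetter (x ∷ y ∷ ys) = lastLetter (y ∷ ys)

cuts : Word → List ℕ → List (Word × Word)
cuts u is = map (λ i → restrictLe i u , pack (restrictGt i u)) is

-- Δ≺(Q_u) : i from u_n to max(u) - 1 ;  Δ≻(Q_u) : i from 1 to u_n - 1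
-- (for the empty word both are empty sums; they are only used for n ≥ 1)
termsPrec : Word → List (Word × Word)
termsPrec [] = []
termsPrec u  = cuts u (range (lastLetter u) (maxW u))

termsSucc : Word → List (Word × Word)
termsSucc [] = []
termsSucc u  = cuts u (range 1 (lastLetter u))

eqW : Word → Word → Bool
eqW []       []       = true
eqW (x ∷ xs) (y ∷ ys) = (x ≡ᵇ y) ∧ eqW xs ys
eqW _        _        = false

countPair : Word → Word → List (Word × Word) → ℕ
countPair a b []             = 0
countPair a b ((a' , b') ∷ ps) =
  (if eqW a a' ∧ eqW b b' then 1 else 0) N.+ countPair a b ps

fromℕ : ℕ → ℚ
fromℕ k = + k / 1

sumℚ : List ℚ → ℚ
sumℚ = foldr _+_ 0ℚ

-- WQSym_n: an element is a coefficient function c : Word → ℚ supported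
-- on PW_n, i.e. c = Σ_{u ∈ PW_n} c(u) Q_u.

Vect : Set
Vect = Word → ℚ

InWQSym : ℕ → Vect → Set
InWQSym n c = ∀ w → T (not (isPW n w)) → c w ≡ 0ℚ

-- coefficient of Q_a ⊗ Q_b in Δ(c) for c ∈ WQSym_n, Δ given on basis by
-- a list of tensors, extended linearly
applyΔ : (Word → List (Word × Word)) → ℕ → Vect → Word → Word → ℚ
applyΔ terms n c a b =
  sumℚ (map (λ u → c u * fromℕ (countPair a b (terms u))) (packedWords n))

Δprec Δsucc : ℕ → Vect → Word → Word → ℚ
Δprec = applyΔ termsPrec
Δsucc = applyΔ termsSucc

IsZero : Vect → Set
IsZero c = ∀ w → c w ≡ 0ℚ

Prim : ℕ → Vect → Set
Prim zero    c = IsZero c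
Prim (suc m) c = InWQSym (suc m) c
  × (∀ a b → Δprec (suc m) c a b + Δsucc (suc m) c a b ≡ 0ℚ)

TPrim : ℕ → Vect → Set
TPrim zero    c = IsZero c
TPrim (suc m) c = InWQSym (suc m) c
  × (∀ a b → Δprec (suc m) c a b ≡ 0ℚ)
  × (∀ a b → Δsucc (suc m) c a b ≡ 0ℚ)

linComb : ∀ {k} → Vec ℚ k → Vec Vect k → Vect
linComb []       []       w = 0ℚ
linComb (x ∷ xs) (b ∷ bs) w = x * b w + linComb xs bs w

HasDim : (Vect → Set) → ℕ → Set
HasDim S k = Σ (Vec Vect k) λ bs →
    (∀ i → S (lookup bs i))
  × (∀ (λs : Vec ℚ k) → IsZero (linComb λs bs) → ∀ i → lookup λs i ≡ 0ℚ)
  × (∀ c → S c → Σ (Vec ℚ k) λ λs → ∀ w → c w ≡ linComb λs bs w)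

data Color : Set where
  white black : Color

data Tree : Set where
  node : ℕ → Color → List Tree → List Tree → Tree

Forest : Set
Forest = List Tree

mutual
  size : Tree → ℕ
  size (node _ _ l r) = suc (sizeF l N.+ sizeF r)

  sizeF : Forest → ℕ
  sizeF []       = 0
  sizeF (t ∷ ts) = size t N.+ sizeF ts

isWhite : Color → Bool
isWhite white = true
isWhite black = false

mutual
  weight : Tree → ℕ
  weight (node _ α l r) = (if isWhite α then 1 else 0) N.+ (weightF l N.+ weightF r)

  weightF : Forest → ℕ
  weightF []       = 0
  weightF (t ∷ ts) = weight t N.+ weightF ts

isOneWhite : ℕ → Color → Bool
isOneWhite i α = (i ≡ᵇ 1) ∧ isWhite α

mutual
  isBP : Tree → Bool
  isBP (node i α l [])      = isBPF l ∧ isOneWhite i α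
  isBP (node i α l (r ∷ [])) =
    isBPF l ∧ isBP r ∧ not (isOneWhite i α) ∧ (1 ≤ᵇ i) ∧ (i ≤ᵇ weight r)
  isBP (node i α l (_ ∷ _ ∷ _)) = false

  isBPF : Forest → Bool
  isBPF []       = true
  isBPF (t ∷ ts) = isBP t ∧ isBPF ts

leftEmpty : Tree → Bool
leftEmpty (node _ _ [] _)      = true
leftEmpty (node _ _ (_ ∷ _) _) = false

BPForestOfSize : ℕ → Set
BPForestOfSize n = Σ Forest λ f → T (isBPF f) × sizeF f ≡ n

BPTreeOfSize : ℕ → Set
BPTreeOfSize n = Σ Tree λ t → T (isBP t) × size t ≡ n

BPTreeLeftEmptyOfSize : ℕ → Set
BPTreeLeftEmptyOfSize n = Σ Tree λ t → T (isBP t) × T (leftEmpty t) × size t ≡ n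

{-# OPTIONS --safe #-}
-- Dually, Δ≺ and Δ≻ are the two halves (last letter taken from the left, resp. right, factor) of the
-- shifted shuffle product of packed words, and Prim, TPrim are the annihilators of all products,
-- resp. of all half-products. The lexicographically least words of a ≻ d and of (s x) ≺ f are
-- a · d[k] and s · f[k] · x, where [k] shifts the letters by the maximum k of the left factor.
-- A word is irreducible if it has no form a · d[k], and blue-irreducible if moreover it has no form
-- s · f[k] · x. Equations with irreducible a, resp. blue-irreducible s x, have pairwise
-- distinct leading words, and by the dendriform axioms they imply all the others; so the dimension of
-- Prim, resp. TPrim, is the number of irreducible, resp. blue-irreducible, words.
-- Finally, packed words are sequences of irreducible words, irreducible words are pairs of a
-- blue-irreducible and a packed word, and a blue-irreducible word other than 1 is an irreducible word r
-- followed by a letter lying weakly between letters of r (black: repeated, white: new): this is the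
-- recursive structure of blue-packed forests, with weight equal to the maximum.
module Submission where

open import Defs
open import Algebra.Bundles using (CommutativeMonoid)
open import Data.Bool using (Bool; true; false; _∧_; not; if_then_else_; T)
open import Data.Bool.Properties using (T-∧; T-∨; T-≡; T-irrelevant)
open import Data.Empty using (⊥; ⊥-elim)
open import Data.Fin as Fin using (Fin)
import Data.Fin.Properties as Finₚ
open import Data.List using (List; []; _∷_; _++_; _∷ʳ_; [_]; map; filter; length; upTo; concatMap; drop; lookup; initLast; _∷ʳ′_)
open import Data.List.Membership.Propositional using (_∈_; _∉_; find)
open import Data.List.Membership.Propositional.Properties
open import Data.List.Membership.Propositional.Properties.WithK using (unique∧set⇒bag)
open import Data.List.Properties using (length-map; length-++; filter-++; filter-all; filter-none; filter-accept; filter-reject; map-++; map-∘; map-cong; map-cong-local; map-injective; upTo-∷ʳ; ∷-injective; ++-assoc; ++-cancelˡ; ++-identityʳ; ∷ʳ-injective; ≡-dec)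
open import Data.List.Relation.Binary.BagAndSetEquality using (∼bag⇒↭)
open import Data.List.Relation.Binary.Permutation.Propositional using (_↭_; prep; swap) renaming (refl to ↭-refl; trans to ↭-trans)
open import Data.List.Relation.Unary.All as All using (All; []; _∷_)
import Data.List.Relation.Unary.All.Properties as Allₚ
open import Data.List.Relation.Unary.AllPairs as AllPairs using (AllPairs; []; _∷_)
import Data.List.Relation.Unary.AllPairs.Properties as AllPairsₚ
open import Data.List.Relation.Unary.Any as Any using (here; there)
import Data.List.Relation.Unary.Any.Properties as Anyₚ
open import Data.List.Relation.Unary.Unique.Propositional using (Unique)
import Data.List.Relation.Unary.Unique.Propositional.Properties as Uniqueₚ
open import Data.Nat using (ℕ; zero; suc; _+_; _∸_; _≤_; _<_; _≤?_; _<?_; _≡ᵇ_; _≤ᵇ_; z≤n; s≤s; _≟_)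
open import Data.List.Membership.DecPropositional _≟_ using (_∈?_)
open import Data.Nat.Induction using (<-wellFounded)
open import Data.Nat.Properties
open import Data.Product using (Σ; ∃; ∃₂; ∃-syntax; _×_; _,_; proj₁; proj₂)
open import Data.Rational using (ℚ; 0ℚ; 1ℚ) renaming (_+_ to _⊕_; _*_ to _⊛_; -_ to ⊖_)
import Data.Rational.Properties as ℚₚ
open import Data.Sum using (_⊎_; inj₁; inj₂)
open import Data.Unit using (⊤; tt)
open import Data.Vec using (Vec; []; _∷_)
import Data.Vec as Vec
import Data.Vec.Properties as Vecₚ
open import Function using (_∘_; id; Equivalence; mk⇔)
open import Function.Bundles using (_↔_; mk↔ₛ′)
open import Induction.WellFounded using (Acc; acc)
open import Relation.Binary.Definitions using (tri<; tri≈; tri>)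
open import Relation.Binary.PropositionalEquality hiding ([_])
open import Relation.Nullary using (¬_; Dec; yes; no)
open import Relation.Nullary.Decidable using (T?; map′; _×-dec_; ¬?)
import Algebra.Properties.AbelianGroup ℚₚ.+-0-abelianGroup as ℚ+
import Algebra.Properties.CommutativeSemigroup (CommutativeMonoid.commutativeSemigroup ℚₚ.+-0-commutativeMonoid) as ℚ+ₛ

-- packed words

-- The two halves are not treated symmetrically. Right-half equations close up among themselves,
-- since (a₁ ⧢ a₂) ≻ b = a₁ ≻ (a₂ ≻ b). Reducing the left factor of a left-half product leads back
-- to the right half, through (a₁ ≻ a₂) ≺ b = a₁ ≻ (a₂ ≺ b). So the right half is annihilated
-- completely before the left half is considered; there only irreducible left factors remain, and (s
-- x ≺ f) ≺ b = s x ≺ (f ⧢ b) cuts them down to blue-irreducible ones. Each reduction is an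
-- induction from the largest word downwards, in which the leading word is the only term of a
-- product not yet treated. Taking the least word as leading word gives it a shape from which the
-- factors can be read off. Unique factorisation then works twice: it makes the leading words of the
-- chosen equations distinct, and it makes the passage from trees to words injective. The linear
-- algebra and the enumeration of trees thus rest on the same lemmas about `_⊘_` and
-- `insertBeforeLast`.

record Packed (m : ℕ) (w : Word) : Set where
  field
    positive   : ∀ {x} → x ∈ w → 1 ≤ x
    bounded    : ∀ {x} → x ∈ w → x ≤ m
    surjective : ∀ {x} → 1 ≤ x → x ≤ m → x ∈ w

open Packed public

-- `Packed` keeps the maximum as a parameter because cuts produce packed words whose maximum is
-- known in advance; `packed-max` identifies it with `maxW` afterwards.
IsPacked : Word → Set
IsPacked w = Packed (maxW w) w

∈⇒≤maxW : ∀ {x} w → x ∈ w → x ≤ maxW w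
∈⇒≤maxW (y ∷ w) (here refl) = m≤m⊔n y (maxW w)
∈⇒≤maxW (y ∷ w) (there x∈w) = ≤-trans (∈⇒≤maxW w x∈w) (m≤n⊔m y (maxW w))

maxW-lub : ∀ {m} w → (∀ {x} → x ∈ w → x ≤ m) → maxW w ≤ m
maxW-lub []      h = z≤n
maxW-lub (x ∷ w) h = ⊔-lub (h (here refl)) (maxW-lub w (h ∘ there))

packed-max : ∀ {m w} → Packed m w → maxW w ≡ m
packed-max {zero}  {w} p = n≤0⇒n≡0 (maxW-lub w (bounded p))
packed-max {suc m} {w} p =
  ≤-antisym (maxW-lub w (bounded p)) (∈⇒≤maxW w (surjective p (s≤s z≤n) ≤-refl))

packed⇒isPacked : ∀ {m w} → Packed m w → IsPacked w
packed⇒isPacked {w = w} p = subst (λ k → Packed k w) (sym (packed-max p)) p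

packed-[] : Packed 0 []
packed-[] = record { positive = λ () ; bounded = λ () ; surjective = λ { (s≤s z≤n) () } }

∉[]-empty : {A : Set} (w : List A) → (∀ {x} → x ∉ w) → w ≡ []
∉[]-empty []      h = refl
∉[]-empty (x ∷ w) h = ⊥-elim (h (here refl))

packed-0 : ∀ {w} → Packed 0 w → w ≡ []
packed-0 {w} p = ∉[]-empty w (λ x∈w → <⇒≱ (positive p x∈w) (bounded p x∈w))

1≤packed-max : ∀ {m w} → Packed m w → w ≢ [] → 1 ≤ m
1≤packed-max {zero}  p ne = ⊥-elim (ne (packed-0 p))
1≤packed-max {suc m} p ne = s≤s z≤n

packed-nonempty : ∀ {m w} → Packed m w → 1 ≤ m → w ≢ []
packed-nonempty p 1≤m refl with surjective p ≤-refl 1≤m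
... | ()

-- Distinct letters occupy distinct positions.
packed-max≤length : ∀ {m w} → Packed m w → m ≤ length w
packed-max≤length {m} {w} p = Finₚ.injective⇒≤ {f = position} position-injective
  where
  letter∈ : (j : Fin m) → suc (Fin.toℕ j) ∈ w
  letter∈ j = surjective p (s≤s z≤n) (Finₚ.toℕ<n j)
  position : Fin m → Fin (length w)
  position j = Any.index (letter∈ j)
  position-injective : ∀ {i j} → position i ≡ position j → i ≡ j
  position-injective {i} {j} eq = Finₚ.toℕ-injective (suc-injective (begin
    suc (Fin.toℕ i)        ≡⟨ Anyₚ.lookup-index (letter∈ i) ⟩
    lookup w (position i)  ≡⟨ cong (lookup w) eq ⟩
    lookup w (position j)  ≡⟨ sym (Anyₚ.lookup-index (letter∈ j)) ⟩
    suc (Fin.toℕ j)        ∎))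
    where open ≡-Reasoning

-- membership and enumeration

∈ᵇ⇒∈ : ∀ x w → T (x ∈ᵇ w) → x ∈ w
∈ᵇ⇒∈ x (y ∷ w) t with Equivalence.to T-∨ t
... | inj₁ x≡y = here (≡ᵇ⇒≡ x y x≡y)
... | inj₂ x∈w = there (∈ᵇ⇒∈ x w x∈w)

∈⇒∈ᵇ : ∀ x w → x ∈ w → T (x ∈ᵇ w)
∈⇒∈ᵇ x (y ∷ w) (here x≡y)  = Equivalence.from T-∨ (inj₁ (≡⇒≡ᵇ x y x≡y))
∈⇒∈ᵇ x (y ∷ w) (there x∈w) = Equivalence.from (T-∨ {x ≡ᵇ y}) (inj₂ (∈⇒∈ᵇ x w x∈w))

allᵇ⇒ : ∀ {A : Set} (p : A → Bool) xs → T (allᵇ p xs) → ∀ {x} → x ∈ xs → T (p x)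
allᵇ⇒ p (x ∷ xs) t (here refl) = proj₁ (Equivalence.to T-∧ t)
allᵇ⇒ p (x ∷ xs) t (there x∈)  = allᵇ⇒ p xs (proj₂ (Equivalence.to (T-∧ {p x}) t)) x∈

⇒allᵇ : ∀ {A : Set} (p : A → Bool) xs → (∀ {x} → x ∈ xs → T (p x)) → T (allᵇ p xs)
⇒allᵇ p []       h = _
⇒allᵇ p (x ∷ xs) h = Equivalence.from T-∧ (h (here refl) , ⇒allᵇ p xs (h ∘ there))

∈-range⁺ : ∀ {a b i} → a ≤ i → i < b → i ∈ range a b
∈-range⁺ {a} {b} {i} a≤i i<b =
  subst (_∈ range a b) (m+[n∸m]≡n a≤i) (∈-map⁺ (a +_) (∈-upTo⁺ (∸-monoˡ-< i<b a≤i)))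

∈-range⁻ : ∀ a b {i} → i ∈ range a b → a ≤ i × i < b
∈-range⁻ a b i∈ with ∈-map⁻ (a +_) i∈
... | j , j∈ , refl = m≤m+n a j , subst (a + j <_) (m+[n∸m]≡n (<⇒≤ a<b)) (+-monoʳ-< a j<)
  where
  j< = ∈-upTo⁻ j∈
  a<b : a < b
  a<b = 0<n∸m⇒m<n (≤-trans (s≤s z≤n) j<)
    where
    0<n∸m⇒m<n : ∀ {m n} → 0 < n ∸ m → m < n
    0<n∸m⇒m<n {m} {n} h = ≰⇒> (λ n≤m → <⇒≢ h (sym (m≤n⇒m∸n≡0 n≤m)))

isPacked⇒IsPacked : ∀ w → T (isPacked w) → IsPacked w
isPacked⇒IsPacked w t = record
  { positive   = λ x∈w → ≤ᵇ⇒≤ _ _ (allᵇ⇒ _ w (proj₁ t′) x∈w)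
  ; bounded    = ∈⇒≤maxW w
  ; surjective = λ 1≤x x≤m → ∈ᵇ⇒∈ _ w (allᵇ⇒ _ (range 1 (suc (maxW w))) (proj₂ t′) (∈-range⁺ 1≤x (s≤s x≤m)))
  }
  where t′ = Equivalence.to (T-∧ {allᵇ (1 ≤ᵇ_) w}) t

IsPacked⇒isPacked : ∀ w → IsPacked w → T (isPacked w)
IsPacked⇒isPacked w p = Equivalence.from T-∧
  ( ⇒allᵇ _ w (λ x∈w → ≤⇒≤ᵇ (positive p x∈w))
  , ⇒allᵇ _ (range 1 (suc (maxW w))) (λ {j} j∈ → let 1≤j , j< = ∈-range⁻ 1 (suc (maxW w)) j∈ in
      ∈⇒∈ᵇ j w (surjective p 1≤j (≤-pred j<))))

∈-wordsOf⁺ : ∀ {m} w → (∀ {x} → x ∈ w → 1 ≤ x × x ≤ m) → w ∈ wordsOf (length w) m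
∈-wordsOf⁺ []      h = here refl
∈-wordsOf⁺ {m} (x ∷ w) h = ∈-concatMap⁺ (λ y → map (y ∷_) (wordsOf (length w) m))
  (Any.map (λ { refl → ∈-map⁺ (x ∷_) (∈-wordsOf⁺ w (h ∘ there)) })
    (let 1≤x , x≤m = h (here refl) in ∈-range⁺ 1≤x (s≤s x≤m)))

∈-wordsOf⁻ : ∀ n m {w} → w ∈ wordsOf n m → length w ≡ n
∈-wordsOf⁻ zero    m (here refl) = refl
∈-wordsOf⁻ (suc n) m w∈
  with Any.satisfied (∈-concatMap⁻ (λ y → map (y ∷_) (wordsOf n m)) {xs = range 1 (suc m)} w∈)
... | x , w∈x with ∈-map⁻ (x ∷_) w∈x
... | v , v∈ , refl = cong suc (∈-wordsOf⁻ n m v∈)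

-- The enumeration uses as many letters as the word has positions; `packed-max≤length` is why this
-- alphabet is large enough.
∈-packedWords⁺ : ∀ {m w} → Packed m w → w ∈ packedWords (length w)
∈-packedWords⁺ {m} {w} p = ∈-filter⁺ (λ w → T? (isPacked w))
  (∈-wordsOf⁺ w (λ x∈w → positive p x∈w , ≤-trans (bounded p x∈w) (packed-max≤length p)))
  (IsPacked⇒isPacked w (packed⇒isPacked p))

∈-packedWords⁻ : ∀ n {w} → w ∈ packedWords n → length w ≡ n × IsPacked w
∈-packedWords⁻ n {w} w∈ =
  let w∈words , t = ∈-filter⁻ (λ w → T? (isPacked w)) {xs = wordsOf n n} w∈
  in ∈-wordsOf⁻ n n w∈words , isPacked⇒IsPacked w t

-- Lexicographic order

data _<ₗ_ : Word → Word → Set where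
  head< : ∀ {x y v w} → x < y → (x ∷ v) <ₗ (y ∷ w)
  tail< : ∀ {x v w} → v <ₗ w → (x ∷ v) <ₗ (x ∷ w)

infix 4 _<ₗ_

<ₗ-irrefl : ∀ {v} → ¬ (v <ₗ v)
<ₗ-irrefl (head< x<x) = <-irrefl refl x<x
<ₗ-irrefl (tail< v<v) = <ₗ-irrefl v<v

<ₗ-asym : ∀ {v w} → v <ₗ w → ¬ (w <ₗ v)
<ₗ-asym (head< x<y) (head< y<x) = <-asym x<y y<x
<ₗ-asym (head< x<x) (tail< _)   = <-irrefl refl x<x
<ₗ-asym (tail< _)   (head< x<x) = <-irrefl refl x<x
<ₗ-asym (tail< v<w) (tail< w<v) = <ₗ-asym v<w w<v

-- This holds because `_<ₗ_` does not place a proper prefix before its extensions, a comparison that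
-- never arises between words of equal length.
<ₗ-++ʳ : ∀ {v w} z → v <ₗ w → (v ++ z) <ₗ (w ++ z)
<ₗ-++ʳ z (head< x<y) = head< x<y
<ₗ-++ʳ z (tail< v<w) = tail< (<ₗ-++ʳ z v<w)

-- The recursion chooses the first letter in increasing order, so the enumeration is already in the
-- order along which the linear system is triangular.
wordsOf-sorted : ∀ n m → AllPairs _<ₗ_ (wordsOf n m)
wordsOf-sorted zero    m = [] ∷ []
wordsOf-sorted (suc n) m = AllPairsₚ.concat⁺
  (Allₚ.map⁺ (All.tabulate (λ _ → AllPairsₚ.map⁺ (AllPairs.map tail< (wordsOf-sorted n m)))))
  (AllPairsₚ.map⁺ (AllPairs.map between
    (AllPairsₚ.map⁺ {f = 1 +_} (AllPairsₚ.applyUpTo⁺₁ id (suc m ∸ 1) (λ i<j _ → s≤s i<j)))))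
  where
  between : ∀ {x y} → x < y →
            All (λ v → All (v <ₗ_) (map (y ∷_) (wordsOf n m))) (map (x ∷_) (wordsOf n m))
  between x<y = Allₚ.map⁺ (All.tabulate (λ _ → Allₚ.map⁺ (All.tabulate (λ _ → head< x<y))))

packedWords-sorted : ∀ n → AllPairs _<ₗ_ (packedWords n)
packedWords-sorted n = AllPairsₚ.filter⁺ (λ w → T? (isPacked w)) (wordsOf-sorted n n)

-- cuts of packed words

shift : ℕ → Word → Word
shift k = map (k +_)

shift-injective : ∀ k {v w} → shift k v ≡ shift k w → v ≡ w
shift-injective k = map-injective (λ {x} {y} → +-cancelˡ-≡ k x y)

shift-+ : ∀ k l w → shift (k + l) w ≡ shift k (shift l w)
shift-+ k l w = trans (map-cong (λ x → +-assoc k l x) w) (map-∘ w)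

∈-shift⁻ : ∀ k {x w} → x ∈ shift k w → ∃ λ y → y ∈ w × x ≡ k + y
∈-shift⁻ k = ∈-map⁻ (k +_)

-- The high letters are compared with a shifted word instead of being packed: shifts compose and
-- cancel, so cuts can be nested. `pack-restrictGt` links this form to the coproduct.
record Cut (k : ℕ) (a b u : Word) : Set where
  constructor mkCut
  field
    low  : restrictLe k u ≡ a
    high : restrictGt k u ≡ shift k b

∈-restrictLe⁺ : ∀ {k x u} → x ∈ u → x ≤ k → x ∈ restrictLe k u
∈-restrictLe⁺ {k} = ∈-filter⁺ (_≤? k)

∈-restrictLe⁻ : ∀ k {x} u → x ∈ restrictLe k u → x ∈ u × x ≤ k
∈-restrictLe⁻ k u = ∈-filter⁻ (_≤? k) {xs = u}

∈-restrictGt⁺ : ∀ {k x u} → x ∈ u → k < x → x ∈ restrictGt k u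
∈-restrictGt⁺ {k} = ∈-filter⁺ (k <?_)

∈-restrictGt⁻ : ∀ k {x} u → x ∈ restrictGt k u → x ∈ u × k < x
∈-restrictGt⁻ k u = ∈-filter⁻ (k <?_) {xs = u}

restrictLe-accept : ∀ {k x} u → x ≤ k → restrictLe k (x ∷ u) ≡ x ∷ restrictLe k u
restrictLe-accept {k} u = filter-accept (_≤? k)

restrictLe-reject : ∀ {k x} u → k < x → restrictLe k (x ∷ u) ≡ restrictLe k u
restrictLe-reject {k} u k<x = filter-reject (_≤? k) (<⇒≱ k<x)

restrictGt-accept : ∀ {k x} u → k < x → restrictGt k (x ∷ u) ≡ x ∷ restrictGt k u
restrictGt-accept {k} u = filter-accept (k <?_)

restrictGt-reject : ∀ {k x} u → x ≤ k → restrictGt k (x ∷ u) ≡ restrictGt k u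
restrictGt-reject {k} u x≤k = filter-reject (k <?_) (≤⇒≯ x≤k)

restrict-length : ∀ k u → length u ≡ length (restrictLe k u) + length (restrictGt k u)
restrict-length k []      = refl
restrict-length k (x ∷ u) with x ≤? k
... | yes x≤k rewrite restrictLe-accept u x≤k | restrictGt-reject u x≤k = cong suc (restrict-length k u)
... | no x≰k rewrite restrictLe-reject u (≰⇒> x≰k) | restrictGt-accept u (≰⇒> x≰k) =
  trans (cong suc (restrict-length k u)) (sym (+-suc _ _))

cut-length : ∀ {k a b u} → Cut k a b u → length u ≡ length a + length b
cut-length {k} {a} {b} {u} (mkCut ≤k >k) = trans (restrict-length k u)
  (cong₂ _+_ (cong length ≤k) (trans (cong length >k) (length-map (k +_) b)))

cut-packed : ∀ {k l a b u} → Packed k a → Packed l b → Cut k a b u → Packed (k + l) u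
cut-packed {k} {l} {a} {b} {u} pa pb (mkCut ≤k >k) = record
  { positive = λ {x} x∈u → proj₁ (bounds x x∈u) ; bounded = λ {x} x∈u → proj₂ (bounds x x∈u) ; surjective = surj }
  where
  bounds : ∀ x → x ∈ u → 1 ≤ x × x ≤ k + l
  bounds x x∈u with x ≤? k
  ... | yes x≤k = positive pa (subst (x ∈_) ≤k (∈-restrictLe⁺ x∈u x≤k)) , ≤-trans x≤k (m≤m+n k l)
  ... | no x≰k with ∈-shift⁻ k (subst (x ∈_) >k (∈-restrictGt⁺ x∈u (≰⇒> x≰k)))
  ...   | y , y∈b , refl = ≤-trans (s≤s z≤n) (≰⇒> x≰k) , +-monoʳ-≤ k (bounded pb y∈b)
  surj : ∀ {x} → 1 ≤ x → x ≤ k + l → x ∈ u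
  surj {x} 1≤x x≤ with x ≤? k
  ... | yes x≤k = proj₁ (∈-restrictLe⁻ k u (subst (x ∈_) (sym ≤k) (surjective pa 1≤x x≤k)))
  ... | no x≰k = proj₁ (∈-restrictGt⁻ k u (subst₂ _∈_ (m+[n∸m]≡n (<⇒≤ k<x)) (sym >k)
          (∈-map⁺ (k +_) (surjective pb (m<n⇒0<n∸m k<x) (m≤n+o⇒m∸n≤o x k x≤)))))
    where k<x = ≰⇒> x≰k

packed-restrictLe : ∀ {m u} k → Packed m u → k ≤ m → Packed k (restrictLe k u)
packed-restrictLe {m} {u} k p k≤m = record
  { positive   = positive p ∘ proj₁ ∘ ∈-restrictLe⁻ k u
  ; bounded    = proj₂ ∘ ∈-restrictLe⁻ k u
  ; surjective = λ 1≤x x≤k → ∈-restrictLe⁺ (surjective p 1≤x (≤-trans x≤k k≤m)) x≤k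
  }

unshift : ℕ → Word → Word
unshift k = map (_∸ k)

shift-unshift : ∀ k w → (∀ {x} → x ∈ w → k ≤ x) → shift k (unshift k w) ≡ w
shift-unshift k []      h = refl
shift-unshift k (x ∷ w) h = cong₂ _∷_ (m+[n∸m]≡n (h (here refl))) (shift-unshift k w (h ∘ there))

shift-unshift-Gt : ∀ k u → restrictGt k u ≡ shift k (unshift k (restrictGt k u))
shift-unshift-Gt k u = sym (shift-unshift k _ (<⇒≤ ∘ proj₂ ∘ ∈-restrictGt⁻ k u))

packed-unshift : ∀ {m u} k → Packed m u → Packed (m ∸ k) (unshift k (restrictGt k u))
packed-unshift {m} {u} k p = record { positive = pos ; bounded = bnd ; surjective = surj }
  where
  preimage : ∀ {x} → x ∈ unshift k (restrictGt k u) → ∃ λ y → y ∈ u × k < y × x ≡ y ∸ k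
  preimage x∈ with ∈-map⁻ (_∸ k) x∈
  ... | y , y∈ , eq = let y∈u , k<y = ∈-restrictGt⁻ k u y∈ in y , y∈u , k<y , eq
  pos : ∀ {x} → x ∈ unshift k (restrictGt k u) → 1 ≤ x
  pos x∈ with preimage x∈
  ... | y , y∈u , k<y , refl = m<n⇒0<n∸m k<y
  bnd : ∀ {x} → x ∈ unshift k (restrictGt k u) → x ≤ m ∸ k
  bnd x∈ with preimage x∈
  ... | y , y∈u , k<y , refl = ∸-monoˡ-≤ k (bounded p y∈u)
  surj : ∀ {x} → 1 ≤ x → x ≤ m ∸ k → x ∈ unshift k (restrictGt k u)
  surj {x} 1≤x x≤ = subst (_∈ unshift k (restrictGt k u)) (m+n∸m≡n k x)
    (∈-map⁺ (_∸ k) (∈-restrictGt⁺ (surjective p (≤-trans 1≤x (m≤n+m x k)) k+x≤m) k<k+x))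
    where
    k<k+x : k < k + x
    k<k+x = subst (_≤ k + x) (+-comm k 1) (+-monoʳ-≤ k 1≤x)
    k≤m : k ≤ m
    k≤m = ≮⇒≥ (λ m<k → <⇒≱ 1≤x (subst (x ≤_) (m≤n⇒m∸n≡0 (<⇒≤ m<k)) x≤))
    k+x≤m : k + x ≤ m
    k+x≤m = subst (k + x ≤_) (m+[n∸m]≡n k≤m) (+-monoʳ-≤ k x≤)

cut-at : ∀ k u → Cut k (restrictLe k u) (unshift k (restrictGt k u)) u
cut-at k u = mkCut refl (shift-unshift-Gt k u)

-- Every value from `k + 1` to `m` occurs in `u`, so the number of letters of `restrictGt k u` up to
-- `x` grows by one at each step beyond `k` and equals `x ∸ k`.
pack-restrictGt : ∀ {m u} k → Packed m u → pack (restrictGt k u) ≡ unshift k (restrictGt k u)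
pack-restrictGt {m} {u} k p =
  map-cong-local (All.tabulate (λ {x} x∈ → rank-∸ x (bounded p (proj₁ (∈-restrictGt⁻ k u x∈)))))
  where
  w = restrictGt k u
  occurs? = λ y → T? (y ∈ᵇ w)
  rank : ℕ → ℕ
  rank x = length (filter occurs? (range 1 (suc x)))
  rank-suc : ∀ x → rank (suc x) ≡ rank x + length (filter occurs? [ suc x ])
  rank-suc x = begin
    length (filter occurs? (map suc (upTo (suc x))))
      ≡⟨ cong (λ l → length (filter occurs? (map suc l))) (sym (upTo-∷ʳ x)) ⟩
    length (filter occurs? (map suc (upTo x ∷ʳ x)))
      ≡⟨ cong (length ∘ filter occurs?) (map-++ suc (upTo x) [ x ]) ⟩
    length (filter occurs? (map suc (upTo x) ++ [ suc x ]))
      ≡⟨ cong length (filter-++ occurs? (map suc (upTo x)) [ suc x ]) ⟩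
    length (filter occurs? (map suc (upTo x)) ++ filter occurs? [ suc x ])
      ≡⟨ length-++ (filter occurs? (map suc (upTo x))) ⟩
    rank x + length (filter occurs? [ suc x ]) ∎
    where open ≡-Reasoning
  rank-∸ : ∀ x → x ≤ m → rank x ≡ x ∸ k
  rank-∸ zero    x≤m = sym (0∸n≡0 k)
  rank-∸ (suc x) x<m with k ≤? x
  ... | yes k≤x = begin
    rank (suc x)                                ≡⟨ rank-suc x ⟩
    rank x + length (filter occurs? [ suc x ])
      ≡⟨ cong₂ (λ i l → i + length l) (rank-∸ x (<⇒≤ x<m)) (filter-accept occurs? (∈⇒∈ᵇ (suc x) w (∈-restrictGt⁺ (surjective p (s≤s z≤n) x<m) (s≤s k≤x)))) ⟩
    (x ∸ k) + 1                                 ≡⟨ +-comm (x ∸ k) 1 ⟩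
    suc (x ∸ k)                                 ≡⟨ sym (+-∸-assoc 1 k≤x) ⟩
    suc x ∸ k                                   ∎
    where open ≡-Reasoning
  ... | no k≰x = begin
    rank (suc x)                                ≡⟨ rank-suc x ⟩
    rank x + length (filter occurs? [ suc x ])
      ≡⟨ cong₂ (λ i l → i + length l) (rank-∸ x (<⇒≤ x<m)) (filter-reject occurs? (λ t → k≰x (≤-pred (proj₂ (∈-restrictGt⁻ k u (∈ᵇ⇒∈ (suc x) w t)))))) ⟩
    (x ∸ k) + 0                                 ≡⟨ +-identityʳ (x ∸ k) ⟩
    x ∸ k                                       ≡⟨ m≤n⇒m∸n≡0 (<⇒≤ (≰⇒> k≰x)) ⟩
    0                                           ≡⟨ sym (m≤n⇒m∸n≡0 (≰⇒> k≰x)) ⟩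
    suc x ∸ k                                   ∎
    where open ≡-Reasoning

-- irreducible words

_≪_ : Word → Word → Set
p ≪ e = ∀ {x y} → x ∈ p → y ∈ e → x < y

infix 4 _≪_ _≪?_

_≪?_ : ∀ p e → Dec (p ≪ e)
p ≪? e = map′ (λ h x∈p y∈e → All.lookup (All.lookup h x∈p) y∈e)
              (λ h → All.tabulate (λ x∈p → All.tabulate (h x∈p)))
              (All.all? (λ x → All.all? (x <?_) e) p)

-- Only the relative order of letters is mentioned, no shift: in a packed word it already forces `e`
-- to be a shifted packed word (`++-factor`).
Reducible : Word → Set
Reducible w = ∃₂ λ p e → w ≡ p ++ e × p ≢ [] × e ≢ [] × p ≪ e

-- Here `p` may be empty, since the left factor `p ∷ʳ x` is nonempty in any case. The last letter is
-- kept apart because it decides the half of the product.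
BlueReducible : Word → ℕ → Set
BlueReducible s x = ∃₂ λ p e → s ≡ p ++ e × e ≢ [] × p ∷ʳ x ≪ e

record Irreducible (w : Word) : Set where
  field
    packed       : IsPacked w
    nonempty     : w ≢ []
    ¬reducible   : ¬ Reducible w

record BlueIrreducible (s : Word) (x : ℕ) : Set where
  field
    packed         : IsPacked (s ∷ʳ x)
    ¬reducible     : ¬ Reducible (s ∷ʳ x)
    ¬blueReducible : ¬ BlueReducible s x

_≟[] : (w : Word) → Dec (w ≡ [])
[]      ≟[] = yes refl
(x ∷ w) ≟[] = no λ ()

∷ʳ≢[] : ∀ {s : Word} {x} → s ∷ʳ x ≢ []
∷ʳ≢[] {[]}    ()
∷ʳ≢[] {_ ∷ _} ()

FirstSplit : (Word → Word → Set) → Word → Set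
FirstSplit Q w = ∃₂ λ p e → w ≡ p ++ e × Q p e × (∀ p′ e′ → w ≡ p′ ++ e′ → Q p′ e′ → length p ≤ length p′)

-- One search serves two purposes: minimality of the split makes the left factor irreducible or
-- blue-irreducible, and its failure decides `Reducible` and `BlueReducible`.
first-split : ∀ {Q : Word → Word → Set} → (∀ p e → Dec (Q p e)) → ∀ w →
              FirstSplit Q w ⊎ (∀ p e → w ≡ p ++ e → ¬ Q p e)
first-split Q? w with Q? [] w
first-split Q? w       | yes q = inj₁ ([] , w , refl , q , λ _ _ _ _ → z≤n)
first-split Q? []      | no ¬q = inj₂ λ { [] [] refl → ¬q }
first-split {Q} Q? (x ∷ w) | no ¬q with first-split (λ p e → Q? (x ∷ p) e) w
... | inj₁ (p , e , refl , q , least) = inj₁ (x ∷ p , e , refl , q , least′)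
  where
  least′ : ∀ p′ e′ → x ∷ p ++ e ≡ p′ ++ e′ → Q p′ e′ → suc (length p) ≤ length p′
  least′ []       e′ refl q′ = ⊥-elim (¬q q′)
  least′ (_ ∷ p′) e′ eq   q′ with ∷-injective eq
  ... | refl , eq′ = s≤s (least p′ e′ eq′ q′)
... | inj₂ none = inj₂ λ { [] e refl → ¬q ; (_ ∷ p) e refl → none p e refl }

-- Levi's lemma for two factorisations of one word.
++-overlap : ∀ (p : Word) {e} p′ {e′} → p ++ e ≡ p′ ++ e′ → length p ≤ length p′ →
             ∃ λ z → p′ ≡ p ++ z × e ≡ z ++ e′
++-overlap []      p′       eq   _        = p′ , refl , eq
++-overlap (x ∷ p) (y ∷ p′) eq (s≤s le) with ∷-injective eq
... | refl , eq′ with ++-overlap p p′ eq′ le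
... | z , refl , refl = z , refl , refl

length-<-++ : ∀ (p : Word) {z} → z ≢ [] → length p < length (p ++ z)
length-<-++ []      {[]}    ne = ⊥-elim (ne refl)
length-<-++ []      {_ ∷ _} ne = s≤s z≤n
length-<-++ (x ∷ p)         ne = s≤s (length-<-++ p ne)

++-≢[] : ∀ (p : Word) {z} → z ≢ [] → p ++ z ≢ []
++-≢[] []      ne = ne
++-≢[] (x ∷ p) ne ()

reducible? : ∀ w → Dec (Reducible w)
reducible? w with first-split (λ p e → ¬? (p ≟[]) ×-dec ¬? (e ≟[]) ×-dec (p ≪? e)) w
... | inj₁ (p , e , eq , q , _) = yes (p , e , eq , q)
... | inj₂ none = no λ { (p , e , eq , q) → none p e eq q }

blueReducible? : ∀ s x → Dec (BlueReducible s x)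
blueReducible? s x with first-split (λ p e → ¬? (e ≟[]) ×-dec (p ∷ʳ x ≪? e)) s
... | inj₁ (p , e , eq , q , _) = yes (p , e , eq , q)
... | inj₂ none = no λ { (p , e , eq , q) → none p e eq q }

_⊘_ : Word → Word → Word
a ⊘ d = a ++ shift (maxW a) d

insertBeforeLast : Word → ℕ → Word → Word
insertBeforeLast s x f = s ++ shift (maxW (s ∷ʳ x)) f ++ [ x ]

restrictLe-all : ∀ {k} w → (∀ {x} → x ∈ w → x ≤ k) → restrictLe k w ≡ w
restrictLe-all {k} w h = filter-all (_≤? k) (All.tabulate h)

restrictLe-none : ∀ {k} w → (∀ {x} → x ∈ w → k < x) → restrictLe k w ≡ []
restrictLe-none {k} w h = filter-none (_≤? k) (All.tabulate (<⇒≱ ∘ h))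

restrictGt-all : ∀ {k} w → (∀ {x} → x ∈ w → k < x) → restrictGt k w ≡ w
restrictGt-all {k} w h = filter-all (k <?_) (All.tabulate h)

restrictGt-none : ∀ {k} w → (∀ {x} → x ∈ w → x ≤ k) → restrictGt k w ≡ []
restrictGt-none {k} w h = filter-none (k <?_) (All.tabulate (≤⇒≯ ∘ h))

-- The case `q = [ x ]` serves `insertBeforeLast` and the case `q = []` serves `_⊘_`.
restrictLe-sandwich : ∀ {k} p e q → (∀ {x} → x ∈ p ++ q → x ≤ k) → (∀ {x} → x ∈ e → k < x) →
                      restrictLe k (p ++ e ++ q) ≡ p ++ q
restrictLe-sandwich {k} p e q p≤k k<e = begin
  restrictLe k (p ++ e ++ q)                              ≡⟨ filter-++ (_≤? k) p (e ++ q) ⟩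
  restrictLe k p ++ restrictLe k (e ++ q)                 ≡⟨ cong (restrictLe k p ++_) (filter-++ (_≤? k) e q) ⟩
  restrictLe k p ++ restrictLe k e ++ restrictLe k q
    ≡⟨ cong₂ _++_ (restrictLe-all p (p≤k ∘ ∈-++⁺ˡ)) (cong₂ _++_ (restrictLe-none e k<e) (restrictLe-all q (p≤k ∘ ∈-++⁺ʳ p))) ⟩
  p ++ q                                                  ∎
  where open ≡-Reasoning

restrictGt-sandwich : ∀ {k} p e q → (∀ {x} → x ∈ p ++ q → x ≤ k) → (∀ {x} → x ∈ e → k < x) →
                      restrictGt k (p ++ e ++ q) ≡ e
restrictGt-sandwich {k} p e q p≤k k<e = begin
  restrictGt k (p ++ e ++ q)                              ≡⟨ filter-++ (k <?_) p (e ++ q) ⟩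
  restrictGt k p ++ restrictGt k (e ++ q)                 ≡⟨ cong (restrictGt k p ++_) (filter-++ (k <?_) e q) ⟩
  restrictGt k p ++ restrictGt k e ++ restrictGt k q
    ≡⟨ cong₂ _++_ (restrictGt-none p (p≤k ∘ ∈-++⁺ˡ)) (cong₂ _++_ (restrictGt-all e k<e) (restrictGt-none q (p≤k ∘ ∈-++⁺ʳ p))) ⟩
  e ++ []                                                 ≡⟨ ++-identityʳ e ⟩
  e                                                       ∎
  where open ≡-Reasoning

shift-> : ∀ k {m d} → Packed m d → ∀ {x} → x ∈ shift k d → k < x
shift-> k pd x∈ with ∈-shift⁻ k x∈
... | y , y∈d , refl = subst (_≤ k + y) (+-comm k 1) (+-monoʳ-≤ k (positive pd y∈d))

≪-shift : ∀ a {m d} → Packed m d → a ≪ shift (maxW a) d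
≪-shift a pd x∈ y∈ = ≤-trans (s≤s (∈⇒≤maxW a x∈)) (shift-> (maxW a) pd y∈)

cut-insert : ∀ s x {m f} → Packed m f → Cut (maxW (s ∷ʳ x)) (s ∷ʳ x) f (insertBeforeLast s x f)
cut-insert s x pf = mkCut (restrictLe-sandwich s _ [ x ] (∈⇒≤maxW (s ∷ʳ x)) (shift-> _ pf))
                          (restrictGt-sandwich s _ [ x ] (∈⇒≤maxW (s ∷ʳ x)) (shift-> _ pf))

cut-⊘ : ∀ a {m d} → Packed m d → Cut (maxW a) a d (a ⊘ d)
cut-⊘ a {d = d} pd = subst (λ e → Cut (maxW a) a d (a ++ e)) (++-identityʳ _) (mkCut
  (trans (restrictLe-sandwich a _ [] a≤ (shift-> _ pd)) (++-identityʳ a))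
  (restrictGt-sandwich a _ [] a≤ (shift-> _ pd)))
  where
  a≤ : ∀ {x} → x ∈ a ++ [] → x ≤ maxW a
  a≤ = ∈⇒≤maxW a ∘ subst (_ ∈_) (++-identityʳ a)

-- Positivity of `y` covers the empty `p`, whose `maxW` is `0`.
maxW-< : ∀ p {y} → 1 ≤ y → (∀ {x} → x ∈ p → x < y) → maxW p < y
maxW-< p (s≤s z≤n) h = s≤s (maxW-lub p (≤-pred ∘ h))

cut-restrictLe : ∀ {m w} a → Packed m w → restrictLe (maxW a) w ≡ a →
                 ∃ λ d → IsPacked a × IsPacked d × restrictGt (maxW a) w ≡ shift (maxW a) d
cut-restrictLe {m} {w} a pw eq =
    unshift (maxW a) (restrictGt (maxW a) w)
  , subst (Packed (maxW a)) eq (packed-restrictLe (maxW a) pw a≤m)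
  , packed⇒isPacked (packed-unshift (maxW a) pw)
  , shift-unshift-Gt (maxW a) w
  where
  a≤m : maxW a ≤ m
  a≤m = maxW-lub a (λ x∈a → bounded pw (proj₁ (∈-restrictLe⁻ (maxW a) w (subst (_ ∈_) (sym eq) x∈a))))

-- Cutting the whole word at `maxW (p ++ q)` returns `p ++ q` and `e`, and the two parts of a cut of
-- a packed word are packed up to a shift.
sandwich-factor : ∀ {m} p e q → Packed m (p ++ e ++ q) → p ++ q ≪ e →
                  ∃ λ d → IsPacked (p ++ q) × IsPacked d × e ≡ shift (maxW (p ++ q)) d
sandwich-factor p e q pw pq≪e =
  let d , ppq , pd , eq = cut-restrictLe (p ++ q) pw (restrictLe-sandwich p e q (∈⇒≤maxW (p ++ q)) e>)
  in d , ppq , pd , trans (sym (restrictGt-sandwich p e q (∈⇒≤maxW (p ++ q)) e>)) eq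
  where
  e> : ∀ {y} → y ∈ e → maxW (p ++ q) < y
  e> y∈e = maxW-< (p ++ q) (positive pw (∈-++⁺ʳ p (∈-++⁺ˡ y∈e))) (λ x∈ → pq≪e x∈ y∈e)

++-factor : ∀ {m} p e → Packed m (p ++ e) → p ≪ e →
            ∃ λ d → IsPacked p × IsPacked d × e ≡ shift (maxW p) d
++-factor {m} p e pw p≪e =
  subst (λ q → ∃ λ d → IsPacked q × IsPacked d × e ≡ shift (maxW q) d) (++-identityʳ p)
    (sandwich-factor p e [] (subst (λ e → Packed m (p ++ e)) (sym (++-identityʳ e)) pw)
      (p≪e ∘ subst (_ ∈_) (++-identityʳ p)))

++-≢[]ˡ : ∀ {u v : Word} → u ≢ [] → u ++ v ≢ []
++-≢[]ˡ {[]}    ne = ⊥-elim (ne refl)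
++-≢[]ˡ {_ ∷ _} ne ()

≪-++ : ∀ {p e e′} → p ≪ e → p ≪ e′ → p ≪ e ++ e′
≪-++ {e = e} h h′ x∈ y∈ with ∈-++⁻ e y∈
... | inj₁ y∈e  = h x∈ y∈e
... | inj₂ y∈e′ = h′ x∈ y∈e′

-- Choosing the shortest possible prefix makes the first factor irreducible.
first-factor : ∀ {w} → IsPacked w → w ≢ [] → ∃₂ λ a d → Irreducible a × IsPacked d × w ≡ a ⊘ d
first-factor {w} pw ne with first-split (λ p e → ¬? (p ≟[]) ×-dec ¬? (e ≟[]) ×-dec (p ≪? e)) w
... | inj₂ none = w , [] , record { packed = pw ; nonempty = ne ; ¬reducible = λ { (p , e , eq , q) → none p e eq q } }
                , packed-[] , sym (++-identityʳ w)
... | inj₁ (p , e , refl , (p≢[] , e≢[] , p≪e) , least) with ++-factor p e pw p≪e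
... | d , pp , pd , eq =
  p , d , record { packed = pp ; nonempty = p≢[] ; ¬reducible = irr } , pd , cong (p ++_) eq
  where
  irr : ¬ Reducible p
  irr (p₁ , p₂ , refl , p₁≢[] , p₂≢[] , p₁≪p₂) =
    <⇒≱ (length-<-++ p₁ p₂≢[]) (least p₁ (p₂ ++ e) (++-assoc p₁ p₂ e)
      (p₁≢[] , ++-≢[]ˡ p₂≢[] , ≪-++ p₁≪p₂ (p≪e ∘ ∈-++⁺ˡ)))

∈-∷ʳ⁻ : ∀ {s x} {y : ℕ} → y ∈ s ∷ʳ x → y ∈ s ⊎ y ≡ x
∈-∷ʳ⁻ {s} y∈ with ∈-++⁻ s y∈
... | inj₁ y∈s        = inj₁ y∈s
... | inj₂ (here eq)  = inj₂ eq

∈-∷ʳ : ∀ {s} {x : ℕ} → x ∈ s ∷ʳ x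
∈-∷ʳ {s} = ∈-++⁺ʳ s (here refl)

-- In a splitting of `p ∷ʳ x` the right part contains the final `x`, so `e` can be put back just
-- before `x`; being above `p`, it is above the left part too.
¬reducible-delete : ∀ p e x → ¬ Reducible ((p ++ e) ∷ʳ x) → p ∷ʳ x ≪ e → ¬ Reducible (p ∷ʳ x)
¬reducible-delete p e x ¬red px≪e (a , c , eq , a≢[] , c≢[] , a≪c) with initLast c
... | [] = c≢[] refl
... | c′ ∷ʳ′ y with ∷ʳ-injective p (a ++ c′) (trans eq (sym (++-assoc a c′ [ y ])))
... | refl , refl = ¬red (a , (c′ ++ e) ∷ʳ x , eq′ , a≢[] , ∷ʳ≢[] , below)
  where
  eq′ : ((a ++ c′) ++ e) ∷ʳ x ≡ a ++ (c′ ++ e) ∷ʳ x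
  eq′ = trans (cong (_∷ʳ x) (++-assoc a c′ e)) (++-assoc a (c′ ++ e) [ x ])
  below : a ≪ (c′ ++ e) ∷ʳ x
  below z∈ y∈ with ∈-∷ʳ⁻ {c′ ++ e} y∈
  ... | inj₂ refl = a≪c z∈ ∈-∷ʳ
  ... | inj₁ y∈′ with ∈-++⁻ c′ y∈′
  ...   | inj₁ y∈c′ = a≪c z∈ (∈-++⁺ˡ y∈c′)
  ...   | inj₂ y∈e  = px≪e (∈-++⁺ˡ (∈-++⁺ˡ z∈)) y∈e

-- The shortest `p` makes `p ∷ʳ x` blue-irreducible: a further block `p₂` of `p` above the rest of
-- `p ∷ʳ x` would merge with `e` into a longer block.
blue-factor : ∀ {w} → Irreducible w →
              ∃ λ s → ∃₂ λ x f → BlueIrreducible s x × IsPacked f × w ≡ insertBeforeLast s x f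
blue-factor {w} iw with initLast w
... | [] = ⊥-elim (Irreducible.nonempty iw refl)
... | s ∷ʳ′ x with first-split (λ p e → ¬? (e ≟[]) ×-dec (p ∷ʳ x ≪? e)) s
... | inj₂ none = s , x , [] , record { packed = Irreducible.packed iw ; ¬reducible = Irreducible.¬reducible iw
                                      ; ¬blueReducible = λ { (p , e , eq , q) → none p e eq q } }
                , packed-[] , refl
... | inj₁ (p , e , refl , (e≢[] , px≪e) , least)
  with sandwich-factor p e [ x ] (subst (Packed _) (++-assoc p e [ x ]) (Irreducible.packed iw)) px≪e
... | f , pp , pf , eq =
    p , x , f
  , record { packed = pp ; ¬reducible = ¬reducible-delete p e x (Irreducible.¬reducible iw) px≪e ; ¬blueReducible = irr }
  , pf , trans (++-assoc p e [ x ]) (cong (λ e → p ++ e ++ [ x ]) eq)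
  where
  irr : ¬ BlueReducible p x
  irr (p₁ , p₂ , refl , p₂≢[] , p₁≪p₂) =
    <⇒≱ (length-<-++ p₁ p₂≢[]) (least p₁ (p₂ ++ e) (++-assoc p₁ p₂ e) (++-≢[]ˡ p₂≢[] , ≪-++ p₁≪p₂ below))
    where
    below : p₁ ∷ʳ x ≪ e
    below z∈ y∈ with ∈-∷ʳ⁻ {p₁} z∈
    ... | inj₁ z∈p₁ = px≪e (∈-++⁺ˡ (∈-++⁺ˡ z∈p₁)) y∈
    ... | inj₂ refl = px≪e (∈-∷ʳ {p₁ ++ p₂}) y∈

-- If `a` were a proper prefix of `a′`, the remainder of `a′` would be a piece of the shifted `d`,
-- hence above `a`, and `a′` would be reducible.
⊘-injective : ∀ {a d a′ d′} → Irreducible a → Irreducible a′ → IsPacked d → IsPacked d′ →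
              a ⊘ d ≡ a′ ⊘ d′ → a ≡ a′ × d ≡ d′
⊘-injective {a} {d} {a′} {d′} ia ia′ pd pd′ eq = a≡a′ , d≡d′ a≡a′ eq
  where
  prefix : ∀ {a d a′ d′} → Irreducible a → Irreducible a′ → IsPacked d → a ⊘ d ≡ a′ ⊘ d′ → length a ≤ length a′ → a ≡ a′
  prefix {a} {d} {a′} ia ia′ pd eq le with ++-overlap a a′ eq le
  ... | z , a′≡ , d≡ with z ≟[]
  ...   | yes refl = sym (trans a′≡ (++-identityʳ a))
  ...   | no z≢[]  = ⊥-elim (Irreducible.¬reducible ia′ (a , z , a′≡ , Irreducible.nonempty ia , z≢[]
                       , λ x∈ y∈ → ≪-shift a pd x∈ (subst (_ ∈_) (sym d≡) (∈-++⁺ˡ y∈))))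
  a≡a′ : a ≡ a′
  a≡a′ with ≤-total (length a) (length a′)
  ... | inj₁ le = prefix ia ia′ pd eq le
  ... | inj₂ ge = sym (prefix ia′ ia pd′ (sym eq) ge)
  d≡d′ : a ≡ a′ → a ⊘ d ≡ a′ ⊘ d′ → d ≡ d′
  d≡d′ refl eq = shift-injective (maxW a) (++-cancelˡ a _ _ eq)

-- The last letters agree at once. If `s` were a proper prefix of `s′`, the remainder would lie
-- above `s ∷ʳ x`, which is a blue reduction of `s′`.
insert-injective : ∀ {s x f s′ x′ f′} → BlueIrreducible s x → BlueIrreducible s′ x′ → IsPacked f → IsPacked f′ →
                   insertBeforeLast s x f ≡ insertBeforeLast s′ x′ f′ → s ≡ s′ × x ≡ x′ × f ≡ f′
insert-injective {s} {x} {f} {s′} {x′} {f′} bs bs′ pf pf′ eq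
  with ∷ʳ-injective (s ++ shift (maxW (s ∷ʳ x)) f) (s′ ++ shift (maxW (s′ ∷ʳ x′)) f′)
         (trans (++-assoc s _ [ x ]) (trans eq (sym (++-assoc s′ _ [ x′ ]))))
... | eq′ , refl = s≡s′ , refl , f≡f′ s≡s′ eq′
  where
  prefix : ∀ {s f s′ f′} → BlueIrreducible s′ x → IsPacked f →
           s ++ shift (maxW (s ∷ʳ x)) f ≡ s′ ++ shift (maxW (s′ ∷ʳ x)) f′ → length s ≤ length s′ → s ≡ s′
  prefix {s} {f} {s′} bs′ pf eq le with ++-overlap s s′ eq le
  ... | z , s′≡ , f≡ with z ≟[]
  ...   | yes refl = sym (trans s′≡ (++-identityʳ s))
  ...   | no z≢[]  = ⊥-elim (BlueIrreducible.¬blueReducible bs′ (s , z , s′≡ , z≢[]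
                       , λ x∈ y∈ → ≪-shift (s ∷ʳ x) pf x∈ (subst (_ ∈_) (sym f≡) (∈-++⁺ˡ y∈))))
  s≡s′ : s ≡ s′
  s≡s′ with ≤-total (length s) (length s′)
  ... | inj₁ le = prefix {f′ = f′} bs′ pf eq′ le
  ... | inj₂ ge = sym (prefix {f′ = f} bs pf′ (sym eq′) ge)
  f≡f′ : s ≡ s′ → s ++ shift (maxW (s ∷ʳ x)) f ≡ s′ ++ shift (maxW (s′ ∷ʳ x)) f′ → f ≡ f′
  f≡f′ refl eq = shift-injective (maxW (s ∷ʳ x)) (++-cancelˡ s _ _ eq)

insert-packed : ∀ {s x f} → IsPacked (s ∷ʳ x) → IsPacked f →
                Packed (maxW (s ∷ʳ x) + maxW f) (insertBeforeLast s x f)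
insert-packed {s} {x} ps pf = cut-packed ps pf (cut-insert s x pf)

⊘-packed : ∀ {a d} → IsPacked a → IsPacked d → Packed (maxW a + maxW d) (a ⊘ d)
⊘-packed {a} pa pd = cut-packed pa pd (cut-⊘ a pd)

-- In a splitting the last letter `x` is on the right. A left part ending within `s` would split
-- `s ∷ʳ x`; a left part reaching into the inserted block would contain a letter of that block below
-- `x`, while the block is above `x`.
insert-irreducible : ∀ {s x f} → BlueIrreducible s x → IsPacked f → Irreducible (insertBeforeLast s x f)
insert-irreducible {s} {x} {f} bs pf = record
  { packed     = packed⇒isPacked (insert-packed (BlueIrreducible.packed bs) pf)
  ; nonempty   = ++-≢[] s (∷ʳ≢[] {shift _ f})
  ; ¬reducible = irr
  }
  where
  F = shift (maxW (s ∷ʳ x)) f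
  irr : ¬ Reducible (s ++ F ++ [ x ])
  irr (p , e , eq , p≢[] , e≢[] , p≪e) with initLast e
  ... | [] = e≢[] refl
  ... | e′ ∷ʳ′ y with ∷ʳ-injective (s ++ F) (p ++ e′) (trans (++-assoc s F [ x ]) (trans eq (sym (++-assoc p e′ [ y ]))))
  ... | eq′ , refl = cases (≤-total (length p) (length s))
    where
    within : ∀ z → s ≡ p ++ z → e′ ≡ z ++ F → ⊥
    within z s≡ e′≡ = BlueIrreducible.¬reducible bs
      (p , z ∷ʳ x , trans (cong (_∷ʳ x) s≡) (++-assoc p z [ x ]) , p≢[] , ∷ʳ≢[] , below)
      where
      below : p ≪ z ∷ʳ x
      below u∈ v∈ with ∈-∷ʳ⁻ {z} v∈
      ... | inj₁ v∈z  = p≪e u∈ (∈-++⁺ˡ (subst (_ ∈_) (sym e′≡) (∈-++⁺ˡ v∈z)))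
      ... | inj₂ refl = p≪e u∈ (∈-∷ʳ {e′})
    cases : length p ≤ length s ⊎ length s ≤ length p → ⊥
    cases (inj₁ le) with ++-overlap p s (sym eq′) le
    ... | z , s≡ , e′≡ = within z s≡ e′≡
    cases (inj₂ ge) with ++-overlap s p eq′ ge
    ... | []    , p≡ , F≡ = within [] (trans (sym (trans p≡ (++-identityʳ s))) (sym (++-identityʳ p))) (sym F≡)
    ... | y ∷ z , p≡ , F≡ = <-asym
      (p≪e (subst (y ∈_) (sym p≡) (∈-++⁺ʳ s (here refl))) (∈-∷ʳ {e′}))
      (≪-shift (s ∷ʳ x) pf (∈-∷ʳ {s}) (subst (y ∈_) (sym F≡) (here refl)))

-- blue-irreducible words

-- A word s x with s nonempty is blue-irreducible exactly when the packing of s is irreducible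
-- and x lies weakly between two letters of s.
¬reducible-∷ʳ : ∀ {s x y} → ¬ Reducible s → y ∈ s → x ≤ y → ¬ Reducible (s ∷ʳ x)
¬reducible-∷ʳ {s} {x} {y} ¬red y∈s x≤y (p , e , eq , p≢[] , e≢[] , p≪e) with initLast e
... | [] = e≢[] refl
... | e′ ∷ʳ′ z with ∷ʳ-injective s (p ++ e′) (trans eq (sym (++-assoc p e′ [ z ])))
... | s≡ , refl with e′ ≟[]
... | yes refl = <⇒≱ (p≪e (subst (y ∈_) (trans s≡ (++-identityʳ p)) y∈s) (here refl)) x≤y
... | no e′≢[] = ¬red (p , e′ , s≡ , p≢[] , e′≢[] , λ u∈ v∈ → p≪e u∈ (∈-++⁺ˡ v∈))

¬blueReducible-∷ʳ : ∀ {s x y} → ¬ Reducible s → y ∈ s → y ≤ x → ¬ BlueReducible s x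
¬blueReducible-∷ʳ ¬red y∈s y≤x ([] , e , refl , e≢[] , x≪e) = <⇒≱ (x≪e (here refl) y∈s) y≤x
¬blueReducible-∷ʳ ¬red y∈s y≤x (z ∷ p , e , eq , e≢[] , px≪e) =
  ¬red (z ∷ p , e , eq , (λ ()) , e≢[] , λ u∈ v∈ → px≪e (∈-++⁺ˡ u∈) v∈)

module _ {s : Word} {x : ℕ} (b : BlueIrreducible s x) (s≢[] : s ≢ []) where
  open BlueIrreducible b

  -- Given `s ≡ p ++ e` with `p ≪ e`, either `x` is at most some letter of `p`, and then
  -- `p ∷ʳ x ≪ e`, or `x` exceeds all of `p`, and then `p ≪ e ∷ʳ x`.
  blue-init-¬reducible : ¬ Reducible s
  blue-init-¬reducible (p , e , refl , p≢[] , e≢[] , p≪e) with Any.any? (x ≤?_) p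
  ... | yes some with find some

  ...   | y , y∈p , x≤y = ¬blueReducible (p , e , refl , e≢[] , below)
    where
    below : p ∷ʳ x ≪ e
    below u∈ v∈ with ∈-∷ʳ⁻ {p} u∈
    ... | inj₁ u∈p  = p≪e u∈p v∈
    ... | inj₂ refl = ≤-<-trans x≤y (p≪e y∈p v∈)
  blue-init-¬reducible (p , e , refl , p≢[] , e≢[] , p≪e)
      | no none = ¬reducible (p , e ∷ʳ x , ++-assoc p e [ x ] , p≢[] , ∷ʳ≢[] , below)
    where
    below : p ≪ e ∷ʳ x
    below u∈ v∈ with ∈-∷ʳ⁻ {e} v∈
    ... | inj₁ v∈e  = p≪e u∈ v∈e
    ... | inj₂ refl = ≰⇒> (λ x≤u → none (Any.map (λ { refl → x≤u }) u∈))

  blue-last-≥ : ∃ λ y → y ∈ s × y ≤ x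
  blue-last-≥ with Any.any? (_≤? x) s
  ... | yes some = find some

  ... | no none = ⊥-elim (¬blueReducible ([] , s , refl , s≢[] ,
          λ { (here refl) v∈ → ≰⇒> (λ v≤x → none (Any.map (λ { refl → v≤x }) v∈)) }))

  blue-last-≤ : ∃ λ y → y ∈ s × x ≤ y
  blue-last-≤ with Any.any? (x ≤?_) s
  ... | yes some = find some

  ... | no none = ⊥-elim (¬reducible (s , [ x ] , refl , s≢[] , (λ ()) ,
          λ { u∈ (here refl) → ≰⇒> (λ x≤u → none (Any.map (λ { refl → x≤u }) u∈)) }))

-- Making room for a new letter

bump : ℕ → ℕ → ℕ
bump i x with x <? i
... | yes _ = x
... | no _  = suc x

-- The inverse of `bump i` away from `i`, the one value that `bump i` skips. It is applied to words
-- without the letter `i`, so its value at `i` is arbitrary.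
unbump : ℕ → ℕ → ℕ
unbump i x with x <? i
... | yes _ = x
... | no _  = x ∸ 1

bump-< : ∀ {i x} → x < i → bump i x ≡ x
bump-< {i} {x} x<i with x <? i
... | yes _   = refl
... | no x≮i = ⊥-elim (x≮i x<i)

bump-≥ : ∀ {i x} → i ≤ x → bump i x ≡ suc x
bump-≥ {i} {x} i≤x with x <? i
... | yes x<i = ⊥-elim (<⇒≱ x<i i≤x)
... | no _    = refl

unbump-< : ∀ {i x} → x < i → unbump i x ≡ x
unbump-< {i} {x} x<i with x <? i
... | yes _   = refl
... | no x≮i = ⊥-elim (x≮i x<i)

unbump-≥ : ∀ {i x} → i ≤ x → unbump i x ≡ x ∸ 1
unbump-≥ {i} {x} i≤x with x <? i
... | yes x<i = ⊥-elim (<⇒≱ x<i i≤x)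
... | no _    = refl

bump-mono : ∀ i {x y} → x < y → bump i x < bump i y
bump-mono i {x} {y} x<y with x <? i | y <? i
... | yes _   | yes _   = x<y
... | yes _   | no _    = m<n⇒m<1+n x<y
... | no x≮i  | yes y<i = ⊥-elim (x≮i (<-trans x<y y<i))
... | no _    | no _    = s≤s x<y

bump-reflects : ∀ i {x y} → bump i x < bump i y → x < y
bump-reflects i {x} {y} lt with <-cmp x y
... | tri< x<y _ _ = x<y

... | tri≈ _ refl _ = ⊥-elim (<-irrefl refl lt)
... | tri> _ _ y<x = ⊥-elim (<-asym lt (bump-mono i y<x))

bump-injective : ∀ i {x y} → bump i x ≡ bump i y → x ≡ y
bump-injective i {x} {y} eq with <-cmp x y
... | tri< x<y _ _ = ⊥-elim (<⇒≢ (bump-mono i x<y) eq)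
... | tri≈ _ x≡y _ = x≡y
... | tri> _ _ y<x = ⊥-elim (<⇒≢ (bump-mono i y<x) (sym eq))

bump≢ : ∀ i x → bump i x ≢ i
bump≢ i x eq with x <? i
... | yes x<i = <⇒≢ x<i eq
... | no x≮i  = x≮i (≤-reflexive eq)

unbump-bump : ∀ i x → unbump i (bump i x) ≡ x
unbump-bump i x with x <? i
... | yes x<i = unbump-< x<i
... | no x≮i  = unbump-≥ (m≤n⇒m≤1+n (≮⇒≥ x≮i))

bump-unbump : ∀ i x → x ≢ i → bump i (unbump i x) ≡ x
bump-unbump i x x≢i with x <? i
... | yes x<i = bump-< x<i
bump-unbump i zero    x≢i | no x≮i = ⊥-elim (x≢i (sym (n≤0⇒n≡0 (≮⇒≥ x≮i))))
bump-unbump i (suc x) x≢i | no x≮i = bump-≥ (≤-pred (≤∧≢⇒< (≮⇒≥ x≮i) (x≢i ∘ sym)))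

bump-≤ : ∀ i x → bump i x ≤ suc x
bump-≤ i x with x <? i
... | yes _ = n≤1+n x
... | no _  = ≤-refl

≤-bump : ∀ i x → x ≤ bump i x
≤-bump i x with x <? i
... | yes _ = ≤-refl
... | no _  = n≤1+n x

map-≡-++ : ∀ (f : ℕ → ℕ) w p e → map f w ≡ p ++ e → ∃₂ λ p′ e′ → w ≡ p′ ++ e′ × p ≡ map f p′ × e ≡ map f e′
map-≡-++ f w       []      e eq = [] , w , refl , refl , sym eq
map-≡-++ f (x ∷ w) (y ∷ p) e eq with ∷-injective eq
... | refl , eq′ with map-≡-++ f w p e eq′
... | p′ , e′ , refl , refl , refl = x ∷ p′ , e′ , refl , refl , refl

map-≢[] : ∀ {f : ℕ → ℕ} {w} → w ≢ [] → map f w ≢ []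
map-≢[] {w = []}    ne = ⊥-elim (ne refl)
map-≢[] {w = _ ∷ _} ne ()

map-≢[]⁻ : ∀ {f : ℕ → ℕ} {w} → map f w ≢ [] → w ≢ []
map-≢[]⁻ ne refl = ne refl

-- Reducibility sees only the order of letters, which `bump i` preserves and reflects.
reducible-bump⁻ : ∀ i {w} → Reducible (map (bump i) w) → Reducible w
reducible-bump⁻ i {w} (p , e , eq , p≢[] , e≢[] , p≪e) with map-≡-++ (bump i) w p e eq
... | p′ , e′ , w≡ , refl , refl = p′ , e′ , w≡ , map-≢[]⁻ p≢[] , map-≢[]⁻ e≢[]
    , λ x∈ y∈ → bump-reflects i (p≪e (∈-map⁺ (bump i) x∈) (∈-map⁺ (bump i) y∈))

reducible-bump⁺ : ∀ i {w} → Reducible w → Reducible (map (bump i) w)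
reducible-bump⁺ i (p , e , refl , p≢[] , e≢[] , p≪e) =
  map (bump i) p , map (bump i) e , map-++ (bump i) p e , map-≢[] p≢[] , map-≢[] e≢[] , below
  where
  below : map (bump i) p ≪ map (bump i) e
  below u∈ v∈ with ∈-map⁻ (bump i) u∈ | ∈-map⁻ (bump i) v∈
  ... | x , x∈ , refl | y , y∈ , refl = bump-mono i (p≪e x∈ y∈)

packed-∷ʳ : ∀ {m s x} → Packed m s → 1 ≤ x → x ≤ m → Packed m (s ∷ʳ x)
packed-∷ʳ {m} {s} {x} p 1≤x x≤m = record
  { positive = λ y∈ → proj₁ (bounds y∈) ; bounded = λ y∈ → proj₂ (bounds y∈)
  ; surjective = λ 1≤y y≤m → ∈-++⁺ˡ (surjective p 1≤y y≤m) }
  where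
  bounds : ∀ {y} → y ∈ s ∷ʳ x → 1 ≤ y × y ≤ m
  bounds y∈ with ∈-∷ʳ⁻ {s} y∈
  ... | inj₁ y∈s  = positive p y∈s , bounded p y∈s
  ... | inj₂ refl = 1≤x , x≤m

packed-init : ∀ {m s x} → Packed m (s ∷ʳ x) → x ∈ s → Packed m s
packed-init {m} {s} {x} p x∈s = record
  { positive = positive p ∘ ∈-++⁺ˡ ; bounded = bounded p ∘ ∈-++⁺ˡ ; surjective = surj }
  where
  surj : ∀ {y} → 1 ≤ y → y ≤ m → y ∈ s
  surj 1≤y y≤m with ∈-∷ʳ⁻ {s} (surjective p 1≤y y≤m)
  ... | inj₁ y∈s  = y∈s
  ... | inj₂ refl = x∈s

packed-bump : ∀ {m r i} → Packed m r → 1 ≤ i → i ≤ suc m → Packed (suc m) (map (bump i) r ∷ʳ i)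
packed-bump {m} {r} {i} p 1≤i i≤ = record
  { positive = λ y∈ → proj₁ (bounds y∈) ; bounded = λ y∈ → proj₂ (bounds y∈) ; surjective = surj }
  where
  bounds : ∀ {y} → y ∈ map (bump i) r ∷ʳ i → 1 ≤ y × y ≤ suc m
  bounds y∈ with ∈-∷ʳ⁻ {map (bump i) r} y∈
  ... | inj₂ refl = 1≤i , i≤
  ... | inj₁ y∈′ with ∈-map⁻ (bump i) y∈′
  ...   | x , x∈ , refl = ≤-trans (positive p x∈) (≤-bump i x) , ≤-trans (bump-≤ i x) (s≤s (bounded p x∈))
  surj : ∀ {y} → 1 ≤ y → y ≤ suc m → y ∈ map (bump i) r ∷ʳ i
  surj {y} 1≤y y≤ with <-cmp y i
  ... | tri≈ _ refl _ = ∈-∷ʳ {map (bump i) r}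
  ... | tri< y<i _ _ = ∈-++⁺ˡ (subst (_∈ map (bump i) r) (bump-< y<i)
          (∈-map⁺ (bump i) (surjective p 1≤y (≤-pred (≤-trans y<i i≤)))))
  surj {suc y} 1≤y y≤ | tri> _ _ (s≤s i≤y) = ∈-++⁺ˡ (subst (_∈ map (bump i) r) (bump-≥ i≤y)
          (∈-map⁺ (bump i) (surjective p (≤-trans 1≤i i≤y) (≤-pred y≤))))

packed-unbump : ∀ {m s x} → Packed (suc m) (s ∷ʳ x) → x ∉ s → Packed m (map (unbump x) s)
packed-unbump {m} {s} {x} p x∉s = record
  { positive = λ y∈ → proj₁ (bounds y∈) ; bounded = λ y∈ → proj₂ (bounds y∈) ; surjective = surj }
  where
  1≤x = positive p (∈-∷ʳ {s})
  x≤ = bounded p (∈-∷ʳ {s})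
  bounds : ∀ {z} → z ∈ map (unbump x) s → 1 ≤ z × z ≤ m
  bounds z∈ with ∈-map⁻ (unbump x) z∈
  ... | y , y∈s , refl with <-cmp y x
  ... | tri< y<x _ _ rewrite unbump-< y<x = positive p (∈-++⁺ˡ y∈s) , ≤-pred (≤-trans y<x x≤)
  ... | tri≈ _ refl _ = ⊥-elim (x∉s y∈s)
  ... | tri> _ _ x<y rewrite unbump-≥ (<⇒≤ x<y) =
    ≤-trans 1≤x (∸-monoˡ-≤ 1 x<y) , ∸-monoˡ-≤ 1 (bounded p (∈-++⁺ˡ y∈s))
  surj : ∀ {z} → 1 ≤ z → z ≤ m → z ∈ map (unbump x) s
  surj {z} 1≤z z≤m with ∈-∷ʳ⁻ {s} (surjective p (≤-trans 1≤z (≤-bump x z)) (≤-trans (bump-≤ x z) (s≤s z≤m)))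
  ... | inj₁ y∈s = subst (_∈ map (unbump x) s) (unbump-bump x z) (∈-map⁺ (unbump x) y∈s)
  ... | inj₂ eq  = ⊥-elim (bump≢ x z eq)

map-bump-unbump : ∀ i w → i ∉ w → map (bump i) (map (unbump i) w) ≡ w
map-bump-unbump i []      i∉ = refl
map-bump-unbump i (x ∷ w) i∉ =
  cong₂ _∷_ (bump-unbump i x (λ { refl → i∉ (here refl) })) (map-bump-unbump i w (i∉ ∘ there))

blue-leaf : BlueIrreducible [] 1
blue-leaf = record
  { packed = record { positive = λ { (here refl) → ≤-refl } ; bounded = λ { (here refl) → ≤-refl }
                    ; surjective = λ 1≤x x≤1 → here (≤-antisym x≤1 1≤x) }
  ; ¬reducible = λ { ([] , _ , _ , p≢[] , _) → p≢[] refl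
                   ; (_ ∷ [] , [] , _ , _ , e≢[] , _) → e≢[] refl
                   ; (_ ∷ _ ∷ _ , _ , () , _)
                   ; (_ ∷ [] , _ ∷ _ , () , _) }
  ; ¬blueReducible = λ { ([] , [] , _ , e≢[] , _) → e≢[] refl }
  }

blue-black : ∀ {r i} → Irreducible r → 1 ≤ i → i ≤ maxW r → BlueIrreducible r i
blue-black {r} {i} ir 1≤i i≤ = record
  { packed         = packed⇒isPacked (packed-∷ʳ packed 1≤i i≤)
  ; ¬reducible     = ¬reducible-∷ʳ ¬reducible (surjective packed 1≤i i≤) ≤-refl
  ; ¬blueReducible = ¬blueReducible-∷ʳ ¬reducible (surjective packed 1≤i i≤) ≤-refl
  }
  where open Irreducible ir

-- The bounds exclude the two extreme new letters: a new `1` would lie below the rest, a blue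
-- reduction with empty `p`, and a new maximum would split off as the right factor. In between,
-- `bump i` leaves `1` below `i` and lifts `maxW r` above it.
blue-white : ∀ {r i} → Irreducible r → 2 ≤ i → i ≤ maxW r → BlueIrreducible (map (bump i) r) i
blue-white {r} {i} ir 2≤i i≤ = record
  { packed         = packed⇒isPacked (packed-bump packed (<⇒≤ 2≤i) (m≤n⇒m≤1+n i≤))
  ; ¬reducible     = ¬reducible-∷ʳ ¬red (∈-map⁺ (bump i) (surjective packed (≤-trans (<⇒≤ 2≤i) i≤) ≤-refl)) (≤-trans i≤ (≤-bump i _))
  ; ¬blueReducible = ¬blueReducible-∷ʳ ¬red
      (subst (_∈ map (bump i) r) (bump-< 2≤i) (∈-map⁺ (bump i) (surjective packed ≤-refl (≤-trans (<⇒≤ 2≤i) i≤)))) (<⇒≤ 2≤i)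
  }
  where
  open Irreducible ir
  ¬red : ¬ Reducible (map (bump i) r)
  ¬red = ¬reducible ∘ reducible-bump⁻ i

data BlueView : Word → ℕ → Set where
  leaf  : BlueView [] 1
  black : ∀ {r i} → Irreducible r → 1 ≤ i → i ≤ maxW r → BlueView r i
  white : ∀ {r i} → Irreducible r → 2 ≤ i → i ≤ maxW r → BlueView (map (bump i) r) i

-- For nonempty `s`, the colour records whether `x` occurs in `s`. A repeated `x` leaves `s` packed;
-- a new one leaves a gap, which `unbump x` closes.
blueView : ∀ {s x} → BlueIrreducible s x → BlueView s x
blueView {[]} {x} b = subst (BlueView []) 1≡x leaf
  where
  open BlueIrreducible b
  1≡x : 1 ≡ x
  1≡x with surjective packed {1} ≤-refl (1≤packed-max packed (λ ()))
  ... | here eq = eq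
blueView {s@(_ ∷ _)} {x} b with x ∈? s
... | yes x∈s = black record { packed = packed⇒isPacked ps ; nonempty = λ () ; ¬reducible = blue-init-¬reducible b (λ ()) }
                  (positive packed (∈-∷ʳ {s})) (∈⇒≤maxW s x∈s)
  where
  open BlueIrreducible b
  ps = packed-init packed x∈s
... | no x∉s = subst (λ s → BlueView s x) (map-bump-unbump x s x∉s)
    (white {r} record { packed = packed⇒isPacked pr ; nonempty = λ () ; ¬reducible = ¬red } (2≤x (blue-last-≥ b (λ ()))) (x≤ (blue-last-≤ b (λ ()))))
  where
  open BlueIrreducible b
  r = map (unbump x) s
  pr : Packed (maxW (s ∷ʳ x) ∸ 1) r
  pr with maxW (s ∷ʳ x) | packed | 1≤packed-max packed (∷ʳ≢[] {s} {x})
  ... | suc m | p | _ = packed-unbump p x∉s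
  ¬red : ¬ Reducible r
  ¬red red = blue-init-¬reducible b (λ ()) (subst Reducible (map-bump-unbump x s x∉s) (reducible-bump⁺ x red))
  2≤x : (∃ λ y → y ∈ s × y ≤ x) → 2 ≤ x
  2≤x (y , y∈s , y≤x) = ≤-trans (s≤s (positive packed (∈-++⁺ˡ y∈s))) (≤∧≢⇒< y≤x (λ { refl → x∉s y∈s }))
  x≤ : (∃ λ y → y ∈ s × x ≤ y) → x ≤ maxW r
  x≤ (y , y∈s , x≤y) = ≤-trans (∸-monoˡ-≤ 1 (≤∧≢⇒< x≤y (λ { refl → x∉s y∈s })))
    (∈⇒≤maxW r (subst (_∈ r) (unbump-≥ x≤y) (∈-map⁺ (unbump x) y∈s)))

-- the words of blue-packed forests

-- The subtrees to the left of a root labelled i are inserted before its last letter i; a black root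
-- repeats a letter of the word of its right child, a white root adds a new one.
mutual
  word : Tree → Word
  word (node i α l r) = insertBeforeLast (rootInit i α r) i (wordF l)

  rootInit : ℕ → Color → Forest → Word
  rootInit i α     []      = []
  rootInit i black (r ∷ _) = word r
  rootInit i white (r ∷ _) = map (bump i) (word r)

  wordF : Forest → Word
  wordF []       = []
  wordF (t ∷ ts) = word t ⊘ wordF ts

-- For a unary root the exclusion of `1°` turns `1 ≤ i` into `2 ≤ i` in the white case and changes
-- nothing in the black one. The constructors then match those of `BlueView`.
data BPRoot : ℕ → Color → Forest → Set where
  leaf  : BPRoot 1 white []
  black : ∀ {i r} → T (isBP r) → 1 ≤ i → i ≤ weight r → BPRoot i black (r ∷ [])
  white : ∀ {i r} → T (isBP r) → 2 ≤ i → i ≤ weight r → BPRoot i white (r ∷ [])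

T-∧⁻ : ∀ {x y} → T (x ∧ y) → T x × T y
T-∧⁻ = Equivalence.to T-∧

isBP⁻ : ∀ i α l r → T (isBP (node i α l r)) → T (isBPF l) × BPRoot i α r
isBP⁻ i α l [] t with T-∧⁻ {isBPF l} t
isBP⁻ i white l [] t | tl , tr with T-∧⁻ {i ≡ᵇ 1} tr
... | i≡1 , _ with ≡ᵇ⇒≡ i 1 i≡1
... | refl = tl , leaf
isBP⁻ i black l [] t | tl , tr = ⊥-elim (proj₂ (T-∧⁻ {i ≡ᵇ 1} tr))
isBP⁻ i α l (r ∷ []) t with T-∧⁻ {isBPF l} t
... | tl , t₁ with T-∧⁻ {isBP r} t₁
... | tr , t₂ with T-∧⁻ {not (isOneWhite i α)} t₂
... | ti , t₃ with T-∧⁻ {1 ≤ᵇ i} t₃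
isBP⁻ i black l (r ∷ []) t | tl , _ | tr , _ | _ , _ | 1≤i , i≤ = tl , black tr (≤ᵇ⇒≤ 1 i 1≤i) (≤ᵇ⇒≤ i _ i≤)
-- The labels 0 and 1 cannot occur: `1 ≤ᵇ 0` and `not (isOneWhite 1 white)` compute to `false`.
isBP⁻ (suc (suc i)) white l (r ∷ []) t | tl , _ | tr , _ | _ , _ | 1≤i , i≤ =
  tl , white tr (s≤s (s≤s z≤n)) (≤ᵇ⇒≤ (suc (suc i)) _ i≤)

isBP⁺ : ∀ {i α r} l → T (isBPF l) → BPRoot i α r → T (isBP (node i α l r))
isBP⁺ l tl leaf = Equivalence.from T-∧ (tl , _)
isBP⁺ {i} l tl (black tr 1≤i i≤) = Equivalence.from T-∧ (tl , Equivalence.from T-∧ (tr ,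
  Equivalence.from (T-∧ {not (isOneWhite i black)}) (notOne i , Equivalence.from T-∧ (≤⇒≤ᵇ 1≤i , ≤⇒≤ᵇ i≤))))
  where
  notOne : ∀ i → T (not (isOneWhite i black))
  notOne zero          = _
  notOne (suc zero)    = _
  notOne (suc (suc i)) = _
isBP⁺ {suc (suc i)} l tl (white tr (s≤s (s≤s z≤n)) i≤) =
  Equivalence.from T-∧ (tl , Equivalence.from T-∧ (tr , ≤⇒≤ᵇ i≤))

maxW-insert : ∀ {s x f} → IsPacked (s ∷ʳ x) → IsPacked f → maxW (insertBeforeLast s x f) ≡ maxW (s ∷ʳ x) + maxW f
maxW-insert ps pf = packed-max (insert-packed ps pf)

length-insert : ∀ s x {f} → IsPacked f → length (insertBeforeLast s x f) ≡ suc (length s) + length f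
length-insert s x {f} pf = trans (cut-length (cut-insert s x pf))
  (cong (_+ length f) (trans (length-++ s) (+-comm (length s) 1)))

-- Weight and maximum have to be identified together with irreducibility: the bound `i ≤ weight r`
-- on a label is used as `i ≤ maxW (word r)`. This is why the next proofs are mutual.
record WordOf (w : Word) (weight size : ℕ) : Set where
  constructor wordOf
  field
    wordPacked : IsPacked w
    wordMax    : maxW w ≡ weight
    wordLength : length w ≡ size

open WordOf

mutual
  word-irreducible : ∀ t → T (isBP t) → Irreducible (word t)
  word-irreducible (node i α l r) bp =
    insert-irreducible (rootInit-blue i α r (proj₂ bp′)) (wordPacked (wordF-spec l (proj₁ bp′)))
    where bp′ = isBP⁻ i α l r bp

  rootInit-blue : ∀ i α r → BPRoot i α r → BlueIrreducible (rootInit i α r) i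
  rootInit-blue _ _ []       leaf = blue-leaf
  rootInit-blue i _ (r ∷ []) (black bp 1≤i i≤) =
    blue-black (word-irreducible r bp) 1≤i (subst (i ≤_) (sym (wordMax (word-spec r bp))) i≤)
  rootInit-blue i _ (r ∷ []) (white bp 2≤i i≤) =
    blue-white (word-irreducible r bp) 2≤i (subst (i ≤_) (sym (wordMax (word-spec r bp))) i≤)

  root-spec : ∀ i α r → BPRoot i α r →
              WordOf (rootInit i α r ∷ʳ i) ((if isWhite α then 1 else 0) + weightF r) (suc (sizeF r))
  root-spec _ _ []       leaf = wordOf (BlueIrreducible.packed blue-leaf) refl refl
  root-spec i _ (r ∷ []) b@(black bp 1≤i i≤) = wordOf
    (BlueIrreducible.packed (rootInit-blue i black (r ∷ []) b))
    (trans (packed-max (packed-∷ʳ (wordPacked spec) 1≤i (subst (i ≤_) (sym (wordMax spec)) i≤)))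
           (trans (wordMax spec) (sym (+-identityʳ _))))
    (trans (length-++ (word r)) (trans (+-comm _ 1) (cong suc (trans (wordLength spec) (sym (+-identityʳ _))))))
    where spec = word-spec r bp
  root-spec i _ (r ∷ []) b@(white bp 2≤i i≤) = wordOf
    (BlueIrreducible.packed (rootInit-blue i white (r ∷ []) b))
    (trans (packed-max (packed-bump (wordPacked spec) (<⇒≤ 2≤i) (m≤n⇒m≤1+n (subst (i ≤_) (sym (wordMax spec)) i≤))))
           (cong suc (trans (wordMax spec) (sym (+-identityʳ _)))))
    (trans (length-++ (map (bump i) (word r)))
      (trans (+-comm _ 1) (cong suc (trans (length-map (bump i) (word r)) (trans (wordLength spec) (sym (+-identityʳ _)))))))
    where spec = word-spec r bp

  word-spec : ∀ t → T (isBP t) → WordOf (word t) (weight t) (size t)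
  word-spec (node i α l r) bp = wordOf
    (packed⇒isPacked (insert-packed (wordPacked rspec) (wordPacked lspec)))
    (begin
      maxW (insertBeforeLast (rootInit i α r) i (wordF l))  ≡⟨ maxW-insert (wordPacked rspec) (wordPacked lspec) ⟩
      maxW (rootInit i α r ∷ʳ i) + maxW (wordF l)           ≡⟨ cong₂ _+_ (wordMax rspec) (wordMax lspec) ⟩
      (c + weightF r) + weightF l                           ≡⟨ +-assoc c _ _ ⟩
      c + (weightF r + weightF l)                           ≡⟨ cong (c +_) (+-comm (weightF r) _) ⟩
      c + (weightF l + weightF r)                           ∎)
    (begin
      length (insertBeforeLast (rootInit i α r) i (wordF l))  ≡⟨ cut-length (cut-insert (rootInit i α r) i (wordPacked lspec)) ⟩
      length (rootInit i α r ∷ʳ i) + length (wordF l)         ≡⟨ cong₂ _+_ (wordLength rspec) (wordLength lspec) ⟩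
      suc (sizeF r + sizeF l)                                 ≡⟨ cong suc (+-comm (sizeF r) _) ⟩
      suc (sizeF l + sizeF r)                                 ∎)
    where
    open ≡-Reasoning
    bp′ = isBP⁻ i α l r bp
    c = if isWhite α then 1 else 0
    lspec = wordF-spec l (proj₁ bp′)
    rspec = root-spec i α r (proj₂ bp′)

  wordF-spec : ∀ f → T (isBPF f) → WordOf (wordF f) (weightF f) (sizeF f)
  wordF-spec []       bp = wordOf packed-[] refl refl
  wordF-spec (t ∷ ts) bp = wordOf
    (packed⇒isPacked (⊘-packed (wordPacked tspec) (wordPacked tsspec)))
    (trans (packed-max (⊘-packed (wordPacked tspec) (wordPacked tsspec))) (cong₂ _+_ (wordMax tspec) (wordMax tsspec)))
    (trans (cut-length (cut-⊘ (word t) (wordPacked tsspec))) (cong₂ _+_ (wordLength tspec) (wordLength tsspec)))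
    where
    bp′ = T-∧⁻ {isBP t} bp
    tspec = word-spec t (proj₁ bp′)
    tsspec = wordF-spec ts (proj₂ bp′)

mutual
  word-injective : ∀ t t′ → T (isBP t) → T (isBP t′) → word t ≡ word t′ → t ≡ t′
  word-injective (node i α l r) (node i′ α′ l′ r′) bp bp′ eq
    with isBP⁻ i α l r bp | isBP⁻ i′ α′ l′ r′ bp′
  ... | bl , br | bl′ , br′
    with insert-injective (rootInit-blue i α r br) (rootInit-blue i′ α′ r′ br′)
           (wordPacked (wordF-spec l bl)) (wordPacked (wordF-spec l′ bl′)) eq
  ... | r≡ , refl , l≡ with wordF-injective l l′ bl bl′ l≡ | root-injective α α′ r r′ br br′ r≡
  ... | refl | refl , refl = refl

  root-injective : ∀ {i} α α′ r r′ → BPRoot i α r → BPRoot i α′ r′ → rootInit i α r ≡ rootInit i α′ r′ → α ≡ α′ × r ≡ r′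
  root-injective _ _ []       []        leaf leaf eq = refl , refl
  root-injective _ _ []       (r′ ∷ []) leaf (black bp′ _ _) eq = ⊥-elim (Irreducible.nonempty (word-irreducible r′ bp′) (sym eq))
  root-injective _ _ []       (r′ ∷ []) leaf (white bp′ (s≤s ()) _) eq
  root-injective _ _ (r ∷ []) []        (black bp _ _) leaf eq = ⊥-elim (Irreducible.nonempty (word-irreducible r bp) eq)
  root-injective _ _ (r ∷ []) []        (white bp (s≤s ()) _) leaf eq
  root-injective _ _ (r ∷ []) (r′ ∷ []) (black bp _ _) (black bp′ _ _) eq =
    refl , cong (_∷ []) (word-injective r r′ bp bp′ eq)
  root-injective {i} _ _ (r ∷ []) (r′ ∷ []) (white bp _ _) (white bp′ _ _) eq =
    refl , cong (_∷ []) (word-injective r r′ bp bp′ (map-injective (bump-injective i) eq))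
  root-injective {i} _ _ (r ∷ []) (r′ ∷ []) (black bp 1≤i i≤) (white bp′ _ _) eq = ⊥-elim (black≢white r r′ bp 1≤i i≤ eq)
  root-injective {i} _ _ (r ∷ []) (r′ ∷ []) (white bp _ _) (black bp′ 1≤i i≤) eq = ⊥-elim (black≢white r′ r bp′ 1≤i i≤ (sym eq))

  -- The letter `i` occurs in `word r`, which is packed with maximum `weight r`, and `bump i` skips
  -- it.
  black≢white : ∀ {i} r r′ → T (isBP r) → 1 ≤ i → i ≤ weight r → word r ≢ map (bump i) (word r′)
  black≢white {i} r r′ bp 1≤i i≤ eq
    with ∈-map⁻ (bump i) (subst (i ∈_) eq (surjective (wordPacked spec) 1≤i (subst (i ≤_) (sym (wordMax spec)) i≤)))
    where spec = word-spec r bp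
  ... | x , _ , i≡ = bump≢ i x (sym i≡)

  wordF-injective : ∀ f f′ → T (isBPF f) → T (isBPF f′) → wordF f ≡ wordF f′ → f ≡ f′
  wordF-injective []       []         bp bp′ eq = refl
  wordF-injective []       (t′ ∷ ts′) bp bp′ eq =
    ⊥-elim (++-≢[]ˡ (Irreducible.nonempty (word-irreducible t′ (proj₁ (T-∧⁻ bp′)))) (sym eq))
  wordF-injective (t ∷ ts) []         bp bp′ eq =
    ⊥-elim (++-≢[]ˡ (Irreducible.nonempty (word-irreducible t (proj₁ (T-∧⁻ bp)))) eq)
  wordF-injective (t ∷ ts) (t′ ∷ ts′) bp bp′ eq
    with T-∧⁻ {isBP t} bp | T-∧⁻ {isBP t′} bp′
  ... | bt , bts | bt′ , bts′
    with ⊘-injective (word-irreducible t bt) (word-irreducible t′ bt′)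
           (wordPacked (wordF-spec ts bts)) (wordPacked (wordF-spec ts′ bts′)) eq
  ... | t≡ , ts≡ = cong₂ _∷_ (word-injective t t′ bt bt′ t≡) (wordF-injective ts ts′ bts bts′ ts≡)

-- From packed words back to forests

TreeOf : Word → Set
TreeOf w = ∃ λ t → T (isBP t) × word t ≡ w

ForestOf : Word → Set
ForestOf w = ∃ λ f → T (isBPF f) × wordF f ≡ w

⊘-[] : ∀ w → w ⊘ [] ≡ w
⊘-[] = ++-identityʳ

-- Since `w` is also `w ⊘ []`, uniqueness of the first factor makes the word of the first tree all
-- of `w`.
forest-of-irreducible : ∀ {w} → Irreducible w → ForestOf w → TreeOf w
forest-of-irreducible iw ([] , _ , refl) = ⊥-elim (Irreducible.nonempty iw refl)
forest-of-irreducible {w} iw (t ∷ ts , bp , eq) with T-∧⁻ {isBP t} bp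
... | bt , bts = t , bt , proj₁ (⊘-injective (word-irreducible t bt) iw (wordPacked (wordF-spec ts bts)) packed-[] (trans eq (sym (⊘-[] w))))

-- Both recursive calls, for the left forest and for the right child, are on words that have lost at
-- least the last letter of `w`.
tree-of : ∀ {w} → Irreducible w → (∀ {v} → length v < length w → IsPacked v → ForestOf v) → TreeOf w
tree-of {w} iw rec with blue-factor iw
... | s , x , f , bs , pf , refl with rec (subst (length f <_) (sym (length-insert s x pf)) (s≤s (m≤n+m _ (length s)))) pf
... | l , bl , refl = build (blueView bs) (λ r r≤ → rec (<-≤-trans (s≤s r≤) (subst (suc (length s) ≤_) (sym (length-insert s x pf)) (m≤m+n _ _))))
  where
  build : ∀ {s x} → BlueView s x → (∀ r → length r ≤ length s → IsPacked r → ForestOf r) → TreeOf (insertBeforeLast s x (wordF l))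
  build leaf rec = node 1 white l [] , isBP⁺ l bl leaf , refl
  build {s} {x} (black ir 1≤i i≤) rec with forest-of-irreducible ir (rec s ≤-refl (Irreducible.packed ir))
  ... | t , bt , refl = node x black l (t ∷ []) , isBP⁺ l bl (black {r = t} bt 1≤i (subst (x ≤_) (wordMax (word-spec t bt)) i≤)) , refl
  build {_} {x} (white {r} ir 2≤i i≤) rec
    with forest-of-irreducible ir (rec r (≤-reflexive (sym (length-map (bump x) r))) (Irreducible.packed ir))
  ... | t , bt , refl = node x white l (t ∷ []) , isBP⁺ l bl (white {r = t} bt 2≤i (subst (x ≤_) (wordMax (word-spec t bt)) i≤)) , refl

-- The first factor `a` may be all of `w`, so no recursive call is made on `a` itself; `tree-of`
-- receives the recursion for words shorter than `a`.
forest-of-acc : ∀ w → Acc _<_ (length w) → IsPacked w → ForestOf w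
forest-of-acc w (acc rs) pw with w ≟[]
... | yes refl = [] , _ , refl
... | no w≢[] with first-factor pw w≢[]
... | a , d , ia , pd , refl
  with tree-of ia (λ {v} lt → forest-of-acc v (rs (<-≤-trans lt a≤)))
     | forest-of-acc d (rs d<) pd
  where
  len : length (a ⊘ d) ≡ length a + length d
  len = cut-length (cut-⊘ a pd)
  a≤ : length a ≤ length (a ⊘ d)
  a≤ = subst (length a ≤_) (sym len) (m≤m+n _ _)
  d< : length d < length (a ⊘ d)
  d< = subst (length d <_) (sym len) (+-monoˡ-≤ (length d) (length-<-++ [] (Irreducible.nonempty ia)))
... | t , bt , refl | ts , bts , refl = t ∷ ts , Equivalence.from T-∧ (bt , bts) , refl

forest-of : ∀ {w} → IsPacked w → ForestOf w
forest-of {w} = forest-of-acc w (<-wellFounded _)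

Blue : Word → Set
Blue w = ∃₂ λ s x → w ≡ s ∷ʳ x × BlueIrreducible s x

leftEmpty-blue : ∀ t → T (isBP t) → T (leftEmpty t) → Blue (word t)
leftEmpty-blue (node i α [] r) bp _ = rootInit i α r , i , refl , rootInit-blue i α r (proj₂ (isBP⁻ i α [] r bp))

-- A blue-irreducible word is an insertion of the empty word, so uniqueness of insertions makes the
-- word of the left forest empty, while every tree has a nonempty word.
blue-leftEmpty : ∀ t → T (isBP t) → Blue (word t) → T (leftEmpty t)
blue-leftEmpty (node i α [] r)      bp _ = _
blue-leftEmpty (node i α (t ∷ ts) r) bp (s , x , eq , bs) with isBP⁻ i α (t ∷ ts) r bp
... | bl , br with insert-injective (rootInit-blue i α r br) bs (wordPacked (wordF-spec (t ∷ ts) bl)) packed-[] eq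
... | _ , _ , l≡[] = ++-≢[]ˡ (Irreducible.nonempty (word-irreducible t (proj₁ (T-∧⁻ bl)))) l≡[]

blue-irreducible : ∀ {w} → Blue w → Irreducible w
blue-irreducible (s , x , refl , bs) = insert-irreducible bs packed-[]

-- Counting forests and trees by their words

Unique-lookup-injective : ∀ {A : Set} {xs : List A} → Unique xs → ∀ i j → lookup xs i ≡ lookup xs j → i ≡ j
Unique-lookup-injective (_ ∷ u)  Fin.zero    Fin.zero    eq = refl
Unique-lookup-injective (x∉ ∷ u) Fin.zero    (Fin.suc j) eq = ⊥-elim (All.lookup x∉ (∈-lookup j) eq)
Unique-lookup-injective (x∉ ∷ u) (Fin.suc i) Fin.zero    eq = ⊥-elim (All.lookup x∉ (∈-lookup i) (sym eq))
Unique-lookup-injective (_ ∷ u)  (Fin.suc i) (Fin.suc j) eq = cong Fin.suc (Unique-lookup-injective u i j eq)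

↔-Fin-length : ∀ {A B : Set} {xs : List B} → Unique xs → (f : A → B) → (∀ a → f a ∈ xs) →
               (∀ {a a′} → f a ≡ f a′ → a ≡ a′) → (∀ {b} → b ∈ xs → ∃ λ a → f a ≡ b) →
               A ↔ Fin (length xs)
↔-Fin-length {A} {B} {xs} u f f∈ inj surj = mk↔ₛ′ to from to∘from from∘to
  where
  to : A → Fin (length xs)
  to a = Any.index (f∈ a)
  from : Fin (length xs) → A
  from i = proj₁ (surj (∈-lookup i))
  to∘from : ∀ i → to (from i) ≡ i
  to∘from i = Unique-lookup-injective u _ _ (trans (sym (Anyₚ.lookup-index (f∈ (from i)))) (proj₂ (surj (∈-lookup i))))
  from∘to : ∀ a → from (to a) ≡ a
  from∘to a = inj (trans (proj₂ (surj (∈-lookup (to a)))) (sym (Anyₚ.lookup-index (f∈ a))))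

module _ {n : ℕ} {xs : List Word} (u : Unique xs) where

  forests↔ : (∀ {w} → length w ≡ n → IsPacked w → w ∈ xs) → (∀ {w} → w ∈ xs → length w ≡ n × IsPacked w) →
             BPForestOfSize n ↔ Fin (length xs)
  forests↔ ∈xs ∈xs⁻ = ↔-Fin-length u (wordF ∘ proj₁)
    (λ (f , bp , sz) → ∈xs (trans (wordLength (wordF-spec f bp)) sz) (wordPacked (wordF-spec f bp)))
    inj surj
    where
    inj : {a a′ : BPForestOfSize n} → wordF (proj₁ a) ≡ wordF (proj₁ a′) → a ≡ a′
    inj {f , bp , sz} {f′ , bp′ , sz′} eq with wordF-injective f f′ bp bp′ eq
    ... | refl = cong (f ,_) (cong₂ _,_ (T-irrelevant bp bp′) (≡-irrelevant sz sz′))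
    surj : ∀ {w} → w ∈ xs → ∃ λ (a : BPForestOfSize n) → wordF (proj₁ a) ≡ w
    surj w∈ with ∈xs⁻ w∈
    ... | len , pw with forest-of pw
    ... | f , bp , refl = (f , bp , trans (sym (wordLength (wordF-spec f bp))) len) , refl

  trees↔ : (∀ {w} → length w ≡ n → Irreducible w → w ∈ xs) → (∀ {w} → w ∈ xs → length w ≡ n × Irreducible w) →
           BPTreeOfSize n ↔ Fin (length xs)
  trees↔ ∈xs ∈xs⁻ = ↔-Fin-length u (word ∘ proj₁)
    (λ (t , bp , sz) → ∈xs (trans (wordLength (word-spec t bp)) sz) (word-irreducible t bp))
    inj surj
    where
    inj : {a a′ : BPTreeOfSize n} → word (proj₁ a) ≡ word (proj₁ a′) → a ≡ a′
    inj {t , bp , sz} {t′ , bp′ , sz′} eq with word-injective t t′ bp bp′ eq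
    ... | refl = cong (t ,_) (cong₂ _,_ (T-irrelevant bp bp′) (≡-irrelevant sz sz′))
    surj : ∀ {w} → w ∈ xs → ∃ λ (a : BPTreeOfSize n) → word (proj₁ a) ≡ w
    surj w∈ with ∈xs⁻ w∈
    ... | len , iw with forest-of-irreducible iw (forest-of (Irreducible.packed iw))
    ... | t , bp , refl = (t , bp , trans (sym (wordLength (word-spec t bp))) len) , refl

  leftEmptyTrees↔ : (∀ {w} → length w ≡ n → Blue w → w ∈ xs) → (∀ {w} → w ∈ xs → length w ≡ n × Blue w) →
                    BPTreeLeftEmptyOfSize n ↔ Fin (length xs)
  leftEmptyTrees↔ ∈xs ∈xs⁻ = ↔-Fin-length u (word ∘ proj₁)
    (λ (t , bp , le , sz) → ∈xs (trans (wordLength (word-spec t bp)) sz) (leftEmpty-blue t bp le))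
    inj surj
    where
    inj : {a a′ : BPTreeLeftEmptyOfSize n} → word (proj₁ a) ≡ word (proj₁ a′) → a ≡ a′
    inj {t , bp , le , sz} {t′ , bp′ , le′ , sz′} eq with word-injective t t′ bp bp′ eq
    ... | refl = cong (t ,_) (cong₂ _,_ (T-irrelevant bp bp′) (cong₂ _,_ (T-irrelevant le le′) (≡-irrelevant sz sz′)))
    surj : ∀ {w} → w ∈ xs → ∃ λ (a : BPTreeLeftEmptyOfSize n) → word (proj₁ a) ≡ w
    surj w∈ with ∈xs⁻ w∈
    ... | len , bw with forest-of-irreducible (blue-irreducible bw) (forest-of (Irreducible.packed (blue-irreducible bw)))
    ... | t , bp , refl = (t , bp , blue-leftEmpty t bp bw , trans (sym (wordLength (word-spec t bp))) len) , refl

-- triangular linear systems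

total : Vect → List Word → ℚ
total c ws = sumℚ (map c ws)

total-cong : ∀ {c d : Vect} ws → (∀ {w} → w ∈ ws → c w ≡ d w) → total c ws ≡ total d ws
total-cong []       h = refl
total-cong (w ∷ ws) h = cong₂ _⊕_ (h (here refl)) (total-cong ws (h ∘ there))

total-zero : ∀ {c : Vect} ws → (∀ {w} → w ∈ ws → c w ≡ 0ℚ) → total c ws ≡ 0ℚ
total-zero []       h = refl
total-zero (w ∷ ws) h = trans (cong₂ _⊕_ (h (here refl)) (total-zero ws (h ∘ there))) (ℚₚ.+-identityˡ 0ℚ)

total-++ : ∀ c vs ws → total c (vs ++ ws) ≡ total c vs ⊕ total c ws
total-++ c []       ws = sym (ℚₚ.+-identityˡ _)
total-++ c (v ∷ vs) ws = trans (cong (c v ⊕_) (total-++ c vs ws)) (sym (ℚₚ.+-assoc (c v) _ _))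

total-concatMap : ∀ c (f : Word → List Word) vs → total c (concatMap f vs) ≡ total (λ v → total c (f v)) vs
total-concatMap c f []       = refl
total-concatMap c f (v ∷ vs) = trans (total-++ c (f v) (concatMap f vs)) (cong (total c (f v) ⊕_) (total-concatMap c f vs))

total-↭ : ∀ c {vs ws} → vs ↭ ws → total c vs ≡ total c ws
total-↭ c ↭-refl         = refl
total-↭ c (prep w p)      = cong (c w ⊕_) (total-↭ c p)
total-↭ c (swap v w p)    = trans (ℚ+ₛ.x∙yz≈y∙xz (c v) (c w) _) (cong (λ t → c w ⊕ (c v ⊕ t)) (total-↭ c p))
total-↭ c (↭-trans p q)  = trans (total-↭ c p) (total-↭ c q)

total-set : ∀ c {vs ws} → Unique vs → Unique ws → (∀ {w} → w ∈ vs → w ∈ ws) → (∀ {w} → w ∈ ws → w ∈ vs) →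
            total c vs ≡ total c ws
total-set c u u′ to from = total-↭ c (∼bag⇒↭ (unique∧set⇒bag u u′ (mk⇔ to from)))

total-linear : ∀ q (b d : Vect) ws → total (λ w → q ⊛ b w ⊕ d w) ws ≡ q ⊛ total b ws ⊕ total d ws
total-linear q b d []       = sym (trans (ℚₚ.+-identityʳ _) (ℚₚ.*-zeroʳ q))
total-linear q b d (w ∷ ws) = begin
  (q ⊛ b w ⊕ d w) ⊕ total (λ w → q ⊛ b w ⊕ d w) ws      ≡⟨ cong ((q ⊛ b w ⊕ d w) ⊕_) (total-linear q b d ws) ⟩
  (q ⊛ b w ⊕ d w) ⊕ (q ⊛ total b ws ⊕ total d ws)       ≡⟨ ℚ+ₛ.interchange (q ⊛ b w) (d w) _ _ ⟩
  (q ⊛ b w ⊕ q ⊛ total b ws) ⊕ (d w ⊕ total d ws)       ≡⟨ cong (_⊕ (d w ⊕ total d ws)) (sym (ℚₚ.*-distribˡ-+ q (b w) _)) ⟩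
  q ⊛ (b w ⊕ total b ws) ⊕ (d w ⊕ total d ws)           ∎
  where open ≡-Reasoning

linComb-zero : ∀ {k} (qs : Vec ℚ k) (bs : Vec Vect k) w → (∀ i → Vec.lookup bs i w ≡ 0ℚ) → linComb qs bs w ≡ 0ℚ
linComb-zero []       []       w h = refl
linComb-zero (q ∷ qs) (b ∷ bs) w h =
  trans (cong₂ _⊕_ (trans (cong (q ⊛_) (h Fin.zero)) (ℚₚ.*-zeroʳ q)) (linComb-zero qs bs w (h ∘ Fin.suc))) (ℚₚ.+-identityˡ 0ℚ)

_≟ᵂ_ : (v w : Word) → Dec (v ≡ w)
_≟ᵂ_ = ≡-dec _≟_

_[_]≔_ : Vect → Word → ℚ → Vect
(c [ x ]≔ q) w with w ≟ᵂ x
... | yes _ = q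
... | no _  = c w

[]≔-at : ∀ c x q → (c [ x ]≔ q) x ≡ q
[]≔-at c x q with x ≟ᵂ x
... | yes _   = refl
... | no x≢x = ⊥-elim (x≢x refl)

[]≔-off : ∀ c x q {w} → w ≢ x → (c [ x ]≔ q) w ≡ c w
[]≔-off c x q {w} w≢x with w ≟ᵂ x
... | yes w≡x = ⊥-elim (w≢x w≡x)
... | no _    = refl

HasDim-⇔ : ∀ {S S′ : Vect → Set} {k} → (∀ c → S c → S′ c) → (∀ c → S′ c → S c) → HasDim S k → HasDim S′ k
HasDim-⇔ to from (bs , bs∈ , indep , span) =
  bs , (λ i → to _ (bs∈ i)) , indep , (λ c c∈ → span c (from c c∈))

module TriangularSystem (Free : Word → Set) (free? : ∀ w → Dec (Free w)) (R : Word → List Word) where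

  -- Every word outside Free comes with one equation, expressing its coefficient by later ones.
  Solution : List Word → Vect → Set
  Solution ws c = (∀ w → w ∉ ws → c w ≡ 0ℚ)
                × (∀ {u} → u ∈ ws → ¬ Free u → c u ⊕ total c (R u) ≡ 0ℚ)

  -- The list grows at its front, so each new equation involves one new coefficient besides those
  -- already present.
  data Triangular : List Word → Set where
    []   : Triangular []
    cons : ∀ {w ws} → w ∉ ws → (¬ Free w → ∀ {v} → v ∈ R w → v ∈ ws) → Triangular ws → Triangular (w ∷ ws)

  sorted⇒triangular : ∀ ws → AllPairs _<ₗ_ ws →
                      (∀ {u} → u ∈ ws → ¬ Free u → ∀ {v} → v ∈ R u → v ∈ ws × u <ₗ v) → Triangular ws
  sorted⇒triangular []       _              h = []
  sorted⇒triangular (w ∷ ws) (w<ws ∷ sorted) h = cons (λ w∈ → <ₗ-irrefl (All.lookup w<ws w∈)) later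
    (sorted⇒triangular ws sorted rest)
    where
    later : ¬ Free w → ∀ {v} → v ∈ R w → v ∈ ws
    later ¬f v∈ with h (here refl) ¬f v∈
    ... | here refl , w<w = ⊥-elim (<ₗ-irrefl w<w)
    ... | there v∈ws , _  = v∈ws
    rest : ∀ {u} → u ∈ ws → ¬ Free u → ∀ {v} → v ∈ R u → v ∈ ws × u <ₗ v
    rest u∈ ¬f v∈ with h (there u∈) ¬f v∈
    ... | here refl , u<w  = ⊥-elim (<ₗ-asym u<w (All.lookup w<ws u∈))
    ... | there v∈ws , u<v = v∈ws , u<v

  R⊆ : ∀ {ws} → Triangular ws → ∀ {u} → u ∈ ws → ¬ Free u → ∀ {v} → v ∈ R u → v ∈ ws
  R⊆ (cons _ later _) (here refl) ¬f v∈ = there (later ¬f v∈)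
  R⊆ (cons _ _ tri)   (there u∈)  ¬f v∈ = there (R⊆ tri u∈ ¬f v∈)

  module _ {x : Word} {ws : List Word} (x∉ws : x ∉ ws) (tri : Triangular ws) where

    ∈⇒≢ : ∀ {w} → w ∈ ws → w ≢ x
    ∈⇒≢ w∈ refl = x∉ws w∈

    total-R-[]≔ : ∀ c q {u} → u ∈ ws → ¬ Free u → total (c [ x ]≔ q) (R u) ≡ total c (R u)
    total-R-[]≔ c q u∈ ¬f = total-cong (R _) (λ v∈ → []≔-off c x q (∈⇒≢ (R⊆ tri u∈ ¬f v∈)))

    equation-[]≔ : ∀ c q {u} → u ∈ ws → ¬ Free u → c u ⊕ total c (R u) ≡ 0ℚ →
                   (c [ x ]≔ q) u ⊕ total (c [ x ]≔ q) (R u) ≡ 0ℚ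
    equation-[]≔ c q u∈ ¬f = trans (cong₂ _⊕_ ([]≔-off c x q (∈⇒≢ u∈)) (total-R-[]≔ c q u∈ ¬f))

    forget : ∀ {c} → Solution (x ∷ ws) c → Solution ws (c [ x ]≔ 0ℚ)
    forget {c} (supp , eqs) = supp′ , λ u∈ ¬f → equation-[]≔ c 0ℚ u∈ ¬f (eqs (there u∈) ¬f)
      where
      supp′ : ∀ w → w ∉ ws → (c [ x ]≔ 0ℚ) w ≡ 0ℚ
      supp′ w w∉ with w ≟ᵂ x
      ... | yes _  = refl
      ... | no w≢x = supp w (λ { (here w≡x) → w≢x w≡x ; (there w∈) → w∉ w∈ })

    extend : ∀ {c} q → Solution ws c → (¬ Free x → q ⊕ total (c [ x ]≔ q) (R x) ≡ 0ℚ) → Solution (x ∷ ws) (c [ x ]≔ q)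
    extend {c} q (supp , eqs) eqx =
        (λ w w∉ → trans ([]≔-off c x q (λ { refl → w∉ (here refl) })) (supp w (w∉ ∘ there)))
      , λ { (here refl) ¬f → trans (cong (_⊕ total (c [ x ]≔ q) (R x)) ([]≔-at c x q)) (eqx ¬f)
          ; (there u∈)  ¬f → equation-[]≔ c q u∈ ¬f (eqs u∈ ¬f) }

    -- No equation mentions `x`: it has none of its own, and those of `ws` stay within `ws`. Its
    -- indicator `δ` is therefore a solution, independent of the others, which vanish at `x`.
    free-step : ∀ {k} → Free x → HasDim (Solution ws) k → HasDim (Solution (x ∷ ws)) (suc k)
    free-step {k} fx (bs , bs∈ , indep , span) = (δ ∷ bs) , members , indep′ , span′
      where
      zeroV : Vect
      zeroV _ = 0ℚ
      δ : Vect
      δ = zeroV [ x ]≔ 1ℚ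
      zero∈ : Solution ws zeroV
      zero∈ = (λ _ _ → refl) , λ {u} _ _ → trans (ℚₚ.+-identityˡ _) (total-zero {zeroV} (R u) (λ _ → refl))
      members : ∀ i → Solution (x ∷ ws) (Vec.lookup (δ ∷ bs) i)
      members Fin.zero    = extend {zeroV} 1ℚ zero∈ (λ ¬f → ⊥-elim (¬f fx))
      members (Fin.suc i) = (λ w w∉ → proj₁ (bs∈ i) w (w∉ ∘ there))
        , λ { (here refl) ¬f → ⊥-elim (¬f fx) ; (there u∈) ¬f → proj₂ (bs∈ i) u∈ ¬f }
      at-x : ∀ qs → linComb qs bs x ≡ 0ℚ
      at-x qs = linComb-zero qs bs x (λ i → proj₁ (bs∈ i) x x∉ws)
      indep′ : ∀ qs → IsZero (linComb qs (δ ∷ bs)) → ∀ i → Vec.lookup qs i ≡ 0ℚ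
      indep′ (q ∷ qs) z = λ { Fin.zero → q≡0 ; (Fin.suc i) → indep qs z′ i }
        where
        open ≡-Reasoning
        q≡0 : q ≡ 0ℚ
        q≡0 = begin
          q                              ≡⟨ sym (ℚₚ.*-identityʳ q) ⟩
          q ⊛ 1ℚ                         ≡⟨ sym (ℚₚ.+-identityʳ _) ⟩
          q ⊛ 1ℚ ⊕ 0ℚ                    ≡⟨ cong₂ (λ s t → q ⊛ s ⊕ t) (sym ([]≔-at zeroV x 1ℚ)) (sym (at-x qs)) ⟩
          q ⊛ δ x ⊕ linComb qs bs x      ≡⟨ z x ⟩
          0ℚ                             ∎
        z′ : IsZero (linComb qs bs)
        z′ w = begin
          linComb qs bs w                ≡⟨ sym (ℚₚ.+-identityˡ _) ⟩
          0ℚ ⊕ linComb qs bs w           ≡⟨ cong (_⊕ linComb qs bs w) (sym (ℚₚ.*-zeroˡ (δ w))) ⟩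
          0ℚ ⊛ δ w ⊕ linComb qs bs w     ≡⟨ cong (λ q → q ⊛ δ w ⊕ linComb qs bs w) (sym q≡0) ⟩
          q ⊛ δ w ⊕ linComb qs bs w      ≡⟨ z w ⟩
          0ℚ                             ∎
      span′ : ∀ c → Solution (x ∷ ws) c → Σ (Vec ℚ (suc k)) λ qs → ∀ w → c w ≡ linComb qs (δ ∷ bs) w
      span′ c c∈ with span (c [ x ]≔ 0ℚ) (forget c∈)
      ... | qs , eq = (c x ∷ qs) , agree
        where
        agree : ∀ w → c w ≡ c x ⊛ δ w ⊕ linComb qs bs w
        agree w with w ≟ᵂ x
        ... | yes refl = sym (trans (cong₂ _⊕_ (ℚₚ.*-identityʳ (c x)) (at-x qs)) (ℚₚ.+-identityʳ _))
        ... | no w≢x = sym (trans (cong₂ _⊕_ (ℚₚ.*-zeroʳ (c x)) (trans (sym (eq w)) ([]≔-off c x 0ℚ w≢x))) (ℚₚ.+-identityˡ _))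

    -- The equation of `x` computes the coefficient at `x` from those on `ws`, so each solution on
    -- `ws` extends in one way. `solve` is this extension; it is linear, as `at-x` shows.
    determined-step : ∀ {k} → ¬ Free x → (∀ {v} → v ∈ R x → v ∈ ws) →
                      HasDim (Solution ws) k → HasDim (Solution (x ∷ ws)) k
    determined-step {k} ¬fx later (bs , bs∈ , indep , span) = Vec.map solve bs , members , indep′ , span′
      where
      solve : Vect → Vect
      solve b = b [ x ]≔ (⊖ total b (R x))
      total-Rx : ∀ c q → total (c [ x ]≔ q) (R x) ≡ total c (R x)
      total-Rx c q = total-cong (R x) (λ v∈ → []≔-off c x q (∈⇒≢ (later v∈)))
      members : ∀ i → Solution (x ∷ ws) (Vec.lookup (Vec.map solve bs) i)
      members i rewrite Vecₚ.lookup-map i solve bs = extend _ (bs∈ i) λ _ →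
        trans (cong (⊖ total b (R x) ⊕_) (total-Rx b _)) (ℚₚ.+-inverseˡ (total b (R x)))
        where b = Vec.lookup bs i
      off-x : ∀ {j} (qs : Vec ℚ j) bs {w} → w ≢ x → linComb qs (Vec.map solve bs) w ≡ linComb qs bs w
      off-x []       []       w≢x = refl
      off-x (q ∷ qs) (b ∷ bs) w≢x = cong₂ (λ s t → q ⊛ s ⊕ t) ([]≔-off b x _ w≢x) (off-x qs bs w≢x)
      at-x : ∀ {j} (qs : Vec ℚ j) bs → linComb qs (Vec.map solve bs) x ≡ ⊖ total (linComb qs bs) (R x)
      at-x []       []       = sym (cong ⊖_ (total-zero (R x) (λ _ → refl)))
      at-x (q ∷ qs) (b ∷ bs) = begin
        q ⊛ solve b x ⊕ linComb qs (Vec.map solve bs) x           ≡⟨ cong₂ (λ s t → q ⊛ s ⊕ t) ([]≔-at b x _) (at-x qs bs) ⟩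
        q ⊛ (⊖ total b (R x)) ⊕ (⊖ total (linComb qs bs) (R x))   ≡⟨ cong (_⊕ (⊖ total (linComb qs bs) (R x))) (sym (ℚₚ.neg-distribʳ-* q _)) ⟩
        (⊖ (q ⊛ total b (R x))) ⊕ (⊖ total (linComb qs bs) (R x)) ≡⟨ sym (ℚₚ.neg-distrib-+ (q ⊛ total b (R x)) _) ⟩
        ⊖ (q ⊛ total b (R x) ⊕ total (linComb qs bs) (R x))       ≡⟨ cong ⊖_ (sym (total-linear q b (linComb qs bs) (R x))) ⟩
        ⊖ total (linComb (q ∷ qs) (b ∷ bs)) (R x)                 ∎
        where open ≡-Reasoning
      indep′ : ∀ qs → IsZero (linComb qs (Vec.map solve bs)) → ∀ i → Vec.lookup qs i ≡ 0ℚ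
      indep′ qs z = indep qs z′
        where
        z′ : IsZero (linComb qs bs)
        z′ w with w ≟ᵂ x
        ... | yes refl = linComb-zero qs bs x (λ i → proj₁ (bs∈ i) x x∉ws)
        ... | no w≢x   = trans (sym (off-x qs bs w≢x)) (z w)
      span′ : ∀ c → Solution (x ∷ ws) c → Σ (Vec ℚ k) λ qs → ∀ w → c w ≡ linComb qs (Vec.map solve bs) w
      span′ c c∈ with span (c [ x ]≔ 0ℚ) (forget c∈)
      ... | qs , eq = qs , agree
        where
        agree : ∀ w → c w ≡ linComb qs (Vec.map solve bs) w
        agree w with w ≟ᵂ x
        ... | no w≢x = trans (sym ([]≔-off c x 0ℚ w≢x)) (trans (eq w) (sym (off-x qs bs w≢x)))
        ... | yes refl = begin
          c x                             ≡⟨ ℚ+.inverseˡ-unique (c x) _ (proj₂ c∈ (here refl) ¬fx) ⟩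
          ⊖ total c (R x)                 ≡⟨ cong ⊖_ (sym (total-Rx c 0ℚ)) ⟩
          ⊖ total (c [ x ]≔ 0ℚ) (R x)     ≡⟨ cong ⊖_ (total-cong (R x) (λ _ → eq _)) ⟩
          ⊖ total (linComb qs bs) (R x)   ≡⟨ sym (at-x qs bs) ⟩
          linComb qs (Vec.map solve bs) x ∎
          where open ≡-Reasoning

  solution-dim : ∀ {ws} → Triangular ws → HasDim (Solution ws) (length (filter free? ws))
  solution-dim [] = [] , (λ ()) , (λ _ _ ()) , λ c c∈ → [] , λ w → proj₁ c∈ w (λ ())
  solution-dim {x ∷ ws} (cons x∉ws later tri) with free? x
  ... | yes fx = free-step x∉ws tri fx (solution-dim tri)
  ... | no ¬fx = determined-step x∉ws tri ¬fx (later ¬fx) (solution-dim tri)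

-- half-shuffles

restrictLe-restrictLe : ∀ {k m} u → k ≤ m → restrictLe k (restrictLe m u) ≡ restrictLe k u
restrictLe-restrictLe []      k≤m = refl
restrictLe-restrictLe {k} {m} (x ∷ u) k≤m with x ≤? m | x ≤? k
... | yes x≤m | yes x≤k rewrite restrictLe-accept u x≤m | restrictLe-accept (restrictLe m u) x≤k | restrictLe-accept u x≤k =
  cong (x ∷_) (restrictLe-restrictLe u k≤m)
... | yes x≤m | no x≰k rewrite restrictLe-accept u x≤m | restrictLe-reject (restrictLe m u) (≰⇒> x≰k) | restrictLe-reject u (≰⇒> x≰k) =
  restrictLe-restrictLe u k≤m
... | no x≰m | yes x≤k = ⊥-elim (x≰m (≤-trans x≤k k≤m))
... | no x≰m | no x≰k rewrite restrictLe-reject u (≰⇒> x≰m) | restrictLe-reject u (≰⇒> x≰k) = restrictLe-restrictLe u k≤m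

restrictGt-restrictGt : ∀ {k m} u → k ≤ m → restrictGt m (restrictGt k u) ≡ restrictGt m u
restrictGt-restrictGt []      k≤m = refl
restrictGt-restrictGt {k} {m} (x ∷ u) k≤m with x ≤? m | x ≤? k
... | yes x≤m | yes x≤k rewrite restrictGt-reject u x≤m | restrictGt-reject u x≤k = restrictGt-restrictGt u k≤m
... | yes x≤m | no x≰k rewrite restrictGt-reject u x≤m | restrictGt-accept u (≰⇒> x≰k) | restrictGt-reject (restrictGt k u) x≤m =
  restrictGt-restrictGt u k≤m
... | no x≰m | yes x≤k = ⊥-elim (x≰m (≤-trans x≤k k≤m))
... | no x≰m | no x≰k rewrite restrictGt-accept u (≰⇒> x≰m) | restrictGt-accept u (≰⇒> x≰k) | restrictGt-accept (restrictGt k u) (≰⇒> x≰m) =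
  cong (x ∷_) (restrictGt-restrictGt u k≤m)

restrictGt-restrictLe : ∀ k m u → restrictGt k (restrictLe m u) ≡ restrictLe m (restrictGt k u)
restrictGt-restrictLe k m []      = refl
restrictGt-restrictLe k m (x ∷ u) with x ≤? m | x ≤? k
... | yes x≤m | yes x≤k rewrite restrictLe-accept u x≤m | restrictGt-reject u x≤k | restrictGt-reject (restrictLe m u) x≤k =
  restrictGt-restrictLe k m u
... | yes x≤m | no x≰k rewrite restrictLe-accept u x≤m | restrictGt-accept u (≰⇒> x≰k)
  | restrictGt-accept (restrictLe m u) (≰⇒> x≰k) | restrictLe-accept (restrictGt k u) x≤m = cong (x ∷_) (restrictGt-restrictLe k m u)
... | no x≰m | yes x≤k rewrite restrictLe-reject u (≰⇒> x≰m) | restrictGt-reject u x≤k = restrictGt-restrictLe k m u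
... | no x≰m | no x≰k rewrite restrictLe-reject u (≰⇒> x≰m) | restrictGt-accept u (≰⇒> x≰k)
  | restrictLe-reject (restrictGt k u) (≰⇒> x≰m) = restrictGt-restrictLe k m u

restrictLe-shift : ∀ k l d → restrictLe (k + l) (shift k d) ≡ shift k (restrictLe l d)
restrictLe-shift k l []      = refl
restrictLe-shift k l (x ∷ d) with x ≤? l
... | yes x≤l rewrite restrictLe-accept (shift k d) (+-monoʳ-≤ k x≤l) | restrictLe-accept d x≤l = cong ((k + x) ∷_) (restrictLe-shift k l d)
... | no x≰l rewrite restrictLe-reject (shift k d) (+-monoʳ-< k (≰⇒> x≰l)) | restrictLe-reject d (≰⇒> x≰l) = restrictLe-shift k l d

restrictGt-shift : ∀ k l d → restrictGt (k + l) (shift k d) ≡ shift k (restrictGt l d)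
restrictGt-shift k l []      = refl
restrictGt-shift k l (x ∷ d) with x ≤? l
... | yes x≤l rewrite restrictGt-reject (shift k d) (+-monoʳ-≤ k x≤l) | restrictGt-reject d x≤l = restrictGt-shift k l d
... | no x≰l rewrite restrictGt-accept (shift k d) (+-monoʳ-< k (≰⇒> x≰l)) | restrictGt-accept d (≰⇒> x≰l) = cong ((k + x) ∷_) (restrictGt-shift k l d)

-- Cutting at `k` and at `k + l` divides the letters of `u` into three bands, carrying `a`, `b` and
-- `c`. The two bracketings of a triple product perform the two cuts in opposite orders.
cut-assocʳ : ∀ {k l a b c u v d} → Cut k a b v → Cut (k + l) v c u → restrictGt k u ≡ shift k d →
             Cut k a d u × Cut l b c d
cut-assocʳ {k} {l} {a} {b} {c} {u} {v} {d} (mkCut v≤ v>) (mkCut u≤ u>) eq =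
    mkCut (begin
      restrictLe k u                       ≡⟨ sym (restrictLe-restrictLe u (m≤m+n k l)) ⟩
      restrictLe k (restrictLe (k + l) u)  ≡⟨ cong (restrictLe k) u≤ ⟩
      restrictLe k v                       ≡⟨ v≤ ⟩
      a                                    ∎) eq
  , mkCut (shift-injective k (begin
      shift k (restrictLe l d)             ≡⟨ sym (restrictLe-shift k l d) ⟩
      restrictLe (k + l) (shift k d)       ≡⟨ cong (restrictLe (k + l)) (sym eq) ⟩
      restrictLe (k + l) (restrictGt k u)  ≡⟨ sym (restrictGt-restrictLe k (k + l) u) ⟩
      restrictGt k (restrictLe (k + l) u)  ≡⟨ cong (restrictGt k) u≤ ⟩
      restrictGt k v                       ≡⟨ v> ⟩
      shift k b                            ∎))
    (shift-injective k (begin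
      shift k (restrictGt l d)             ≡⟨ sym (restrictGt-shift k l d) ⟩
      restrictGt (k + l) (shift k d)       ≡⟨ cong (restrictGt (k + l)) (sym eq) ⟩
      restrictGt (k + l) (restrictGt k u)  ≡⟨ restrictGt-restrictGt u (m≤m+n k l) ⟩
      restrictGt (k + l) u                 ≡⟨ u> ⟩
      shift (k + l) c                      ≡⟨ shift-+ k l c ⟩
      shift k (shift l c)                  ∎))
  where open ≡-Reasoning

cut-assocˡ : ∀ {k l a b c u v d} → Cut k a d u → Cut l b c d → restrictLe (k + l) u ≡ v →
             Cut k a b v × Cut (k + l) v c u
cut-assocˡ {k} {l} {a} {b} {c} {u} {v} {d} (mkCut u≤ u>) (mkCut d≤ d>) refl =
    mkCut (trans (restrictLe-restrictLe u (m≤m+n k l)) u≤) (begin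
      restrictGt k (restrictLe (k + l) u)  ≡⟨ restrictGt-restrictLe k (k + l) u ⟩
      restrictLe (k + l) (restrictGt k u)  ≡⟨ cong (restrictLe (k + l)) u> ⟩
      restrictLe (k + l) (shift k d)       ≡⟨ restrictLe-shift k l d ⟩
      shift k (restrictLe l d)             ≡⟨ cong (shift k) d≤ ⟩
      shift k b                            ∎)
  , mkCut refl (begin
      restrictGt (k + l) u                 ≡⟨ sym (restrictGt-restrictGt u (m≤m+n k l)) ⟩
      restrictGt (k + l) (restrictGt k u)  ≡⟨ cong (restrictGt (k + l)) u> ⟩
      restrictGt (k + l) (shift k d)       ≡⟨ restrictGt-shift k l d ⟩
      shift k (restrictGt l d)             ≡⟨ cong (shift k) d> ⟩
      shift k (shift l c)                  ≡⟨ sym (shift-+ k l c) ⟩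
      shift (k + l) c                      ∎)
  where open ≡-Reasoning

lastLetter-∷ʳ : ∀ s x → lastLetter (s ∷ʳ x) ≡ x
lastLetter-∷ʳ []          x = refl
lastLetter-∷ʳ (y ∷ [])    x = refl
lastLetter-∷ʳ (y ∷ z ∷ s) x = lastLetter-∷ʳ (z ∷ s) x

lastLetter∈ : ∀ u → u ≢ [] → lastLetter u ∈ u
lastLetter∈ u ne with initLast u
... | []      = ⊥-elim (ne refl)
... | s ∷ʳ′ x = subst (_∈ s ∷ʳ x) (sym (lastLetter-∷ʳ s x)) (∈-∷ʳ {s})

restrictLe-∷ʳ : ∀ {k} s {x} → x ≤ k → restrictLe k (s ∷ʳ x) ≡ restrictLe k s ∷ʳ x
restrictLe-∷ʳ {k} s {x} x≤k = trans (filter-++ (_≤? k) s [ x ]) (cong (restrictLe k s ++_) (restrictLe-accept [] x≤k))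

restrictGt-∷ʳ : ∀ {k} s {x} → x ≤ k → restrictGt k (s ∷ʳ x) ≡ restrictGt k s
restrictGt-∷ʳ {k} s {x} x≤k = trans (filter-++ (k <?_) s [ x ])
  (trans (cong (restrictGt k s ++_) (restrictGt-reject [] x≤k)) (++-identityʳ _))

lastLetter-restrictLe : ∀ {k} u → lastLetter u ≤ k → lastLetter (restrictLe k u) ≡ lastLetter u
lastLetter-restrictLe {k} u le with initLast u
... | []      = refl
... | s ∷ʳ′ x rewrite lastLetter-∷ʳ s x = trans (cong lastLetter (restrictLe-∷ʳ s le)) (lastLetter-∷ʳ (restrictLe k s) x)

lastLetter-restrictGt : ∀ {k} u {d} → k < lastLetter u → restrictGt k u ≡ shift k d → lastLetter u ≡ k + lastLetter d
lastLetter-restrictGt {k} u {d} lt eq with initLast u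
... | s ∷ʳ′ x rewrite lastLetter-∷ʳ s x with initLast d
...   | [] = ⊥-elim (∷ʳ≢[] {restrictGt k s} (trans (sym last>) eq))
  where last> = trans (filter-++ (k <?_) s [ x ]) (cong (restrictGt k s ++_) (restrictGt-accept [] lt))
...   | d′ ∷ʳ′ y rewrite lastLetter-∷ʳ d′ y = proj₂ (∷ʳ-injective (restrictGt k s) (shift k d′) (trans (sym last>) (trans eq (map-++ (k +_) d′ [ y ]))))
  where last> = trans (filter-++ (k <?_) s [ x ]) (cong (restrictGt k s ++_) (restrictGt-accept [] lt))

-- `both` imposes no condition on the last letter, so the plain product obeys its law by the same
-- proof as the half-products.
data Side : Set where
  both left right : Side

OnSide : Side → ℕ → Word → Set
OnSide both  k u = ⊤
OnSide left  k u = lastLetter u ≤ k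
OnSide right k u = k < lastLetter u

onSide? : ∀ σ k u → Dec (OnSide σ k u)
onSide? both  k u = yes tt
onSide? left  k u = lastLetter u ≤? k
onSide? right k u = k <? lastLetter u

cut? : ∀ k a b u → Dec (Cut k a b u)
cut? k a b u = map′ (λ (p , q) → mkCut p q) (λ (mkCut p q) → p , q)
  ((restrictLe k u ≟ᵂ a) ×-dec (restrictGt k u ≟ᵂ shift k b))

InShuffle : Side → Word → Word → Word → Set
InShuffle σ a b u = Cut (maxW a) a b u × OnSide σ (maxW a) u

inShuffle? : ∀ σ a b u → Dec (InShuffle σ a b u)
inShuffle? σ a b u = cut? (maxW a) a b u ×-dec onSide? σ (maxW a) u

-- The shifted shuffle product (both) of two packed words and its two halves,
-- dual to Δ≺ (left: the last letter comes from a) and Δ≻ (right: it comes from b).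
shuffle : Side → Word → Word → List Word
shuffle σ a b = filter (inShuffle? σ a b) (packedWords (length a + length b))

<ₗ⇒≢ : ∀ {v w} → v <ₗ w → v ≢ w
<ₗ⇒≢ v<w refl = <ₗ-irrefl v<w

packedWords-unique : ∀ n → Unique (packedWords n)
packedWords-unique n = AllPairs.map <ₗ⇒≢ (packedWords-sorted n)

shuffle-sorted : ∀ σ a b → AllPairs _<ₗ_ (shuffle σ a b)
shuffle-sorted σ a b = AllPairsₚ.filter⁺ (inShuffle? σ a b) (packedWords-sorted (length a + length b))

shuffle-unique : ∀ σ a b → Unique (shuffle σ a b)
shuffle-unique σ a b = AllPairs.map <ₗ⇒≢ (shuffle-sorted σ a b)

∈-shuffle⁺ : ∀ {σ a b u} → IsPacked a → IsPacked b → InShuffle σ a b u → u ∈ shuffle σ a b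
∈-shuffle⁺ {σ} {a} {b} {u} pa pb u∈@(cut , _) = ∈-filter⁺ (inShuffle? σ a b)
  (subst (λ n → u ∈ packedWords n) (cut-length cut) (∈-packedWords⁺ (cut-packed pa pb cut))) u∈

∈-shuffle⁻ : ∀ σ a b {u} → u ∈ shuffle σ a b → u ∈ packedWords (length a + length b) × InShuffle σ a b u
∈-shuffle⁻ σ a b = ∈-filter⁻ (inShuffle? σ a b)

record InShuffle⁺ (σ : Side) (a b u : Word) : Set where
  field
    is-packed : IsPacked u
    length≡   : length u ≡ length a + length b
    cut       : Cut (maxW a) a b u
    on-side   : OnSide σ (maxW a) u

∈-shuffle-elim : ∀ σ a b {u} → u ∈ shuffle σ a b → InShuffle⁺ σ a b u
∈-shuffle-elim σ a b u∈ =
  let u∈W , cut , side = ∈-shuffle⁻ σ a b u∈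
      len , pu = ∈-packedWords⁻ _ u∈W
  in record { is-packed = pu ; length≡ = len ; cut = cut ; on-side = side }

∈-shuffle-max : ∀ {σ a b u} → IsPacked a → IsPacked b → u ∈ shuffle σ a b → maxW u ≡ maxW a + maxW b
∈-shuffle-max {σ} {a} {b} pa pb u∈ = packed-max (cut-packed pa pb (InShuffle⁺.cut (∈-shuffle-elim σ a b u∈)))

length-≢[] : ∀ {u v : Word} → v ≢ [] → length v ≤ length u → u ≢ []
length-≢[] {[]} {[]}    ne _ refl = ne refl
length-≢[] {[]} {_ ∷ _} ne () refl

∈-shuffle-≢[] : ∀ σ a b {u} → a ≢ [] → u ∈ shuffle σ a b → u ≢ []
∈-shuffle-≢[] σ a b ne u∈ = length-≢[] ne (subst (length a ≤_) (sym (InShuffle⁺.length≡ (∈-shuffle-elim σ a b u∈))) (m≤m+n _ _))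

-- Law σ₁ σ₂ σ₃ σ₄ stands for (a ⧢₂ b) ⧢₁ c = a ⧢₃ (b ⧢₄ c): associativity and the dendriform axioms.
data Law : Side → Side → Side → Side → Set where
  assoc : Law both both both both
  ≻≻    : Law right both right right
  ≻≺    : Law left right right left
  ≺≺    : Law left left left both

module _ {k l : ℕ} {u v d : Word} (u≤ : restrictLe (k + l) u ≡ v) (u> : restrictGt k u ≡ shift k d) where

  private
    last-v : lastLetter u ≤ k + l → lastLetter v ≡ lastLetter u
    last-v le = trans (cong lastLetter (sym u≤)) (lastLetter-restrictLe u le)

    last-d : k < lastLetter u → lastLetter u ≡ k + lastLetter d
    last-d lt = lastLetter-restrictGt u lt u>

  -- Each dendriform law places the last letter of `u` in one of the three bands, and both of its
  -- sides name the same one: that of `c` for `≻≻`, of `b` for `≻≺`, of `a` for `≺≺`.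
  sideʳ : ∀ {σ₁ σ₂ σ₃ σ₄} → Law σ₁ σ₂ σ₃ σ₄ → OnSide σ₁ (k + l) u → OnSide σ₂ k v → OnSide σ₃ k u × OnSide σ₄ l d
  sideʳ assoc _ _ = tt , tt
  sideʳ ≻≻ u> _ = k<u , +-cancelˡ-< k _ _ (subst (k + l <_) (last-d k<u) u>)
    where k<u = ≤-<-trans (m≤m+n k l) u>
  sideʳ ≻≺ u≤ v> = k<u , +-cancelˡ-≤ k _ _ (subst (_≤ k + l) (last-d k<u) u≤)
    where k<u = subst (k <_) (last-v u≤) v>
  sideʳ ≺≺ u≤ v≤ = subst (_≤ k) (last-v u≤) v≤ , tt

  sideˡ : ∀ {σ₁ σ₂ σ₃ σ₄} → Law σ₁ σ₂ σ₃ σ₄ → OnSide σ₃ k u → OnSide σ₄ l d → OnSide σ₁ (k + l) u × OnSide σ₂ k v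
  sideˡ assoc _ _ = tt , tt
  sideˡ ≻≻ u> d> = subst (k + l <_) (sym (last-d u>)) (+-monoʳ-< k d>) , tt
  sideˡ ≻≺ u> d≤ = u≤k+l , subst (k <_) (sym (last-v u≤k+l)) u>
    where u≤k+l = subst (_≤ k + l) (sym (last-d u>)) (+-monoʳ-≤ k d≤)
  sideˡ ≺≺ u≤ _ = ≤-trans u≤ (m≤m+n k l) , subst (_≤ k) (sym (last-v (≤-trans u≤ (m≤m+n k l)))) u≤

Unique-concatMap : ∀ {A B : Set} (f : A → List B) {xs} → Unique xs → (∀ x → Unique (f x)) →
                   (∀ {x y z} → x ∈ xs → y ∈ xs → z ∈ f x → z ∈ f y → x ≡ y) → Unique (concatMap f xs)
Unique-concatMap f []           uf inj = []
Unique-concatMap f {x ∷ xs} (x∉ ∷ u) uf inj = Uniqueₚ.++⁺ (uf x)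
  (Unique-concatMap f u uf (λ x∈ y∈ → inj (there x∈) (there y∈)))
  (λ (z∈fx , z∈) → let y , y∈ , z∈fy = find (∈-concatMap⁻ f {xs = xs} z∈) in
     All.lookup x∉ y∈ (inj (here refl) (there y∈) z∈fx z∈fy))

∈-concatMap : ∀ {A B : Set} (f : A → List B) {x xs y} → x ∈ xs → y ∈ f x → y ∈ concatMap f xs
∈-concatMap f x∈ y∈ = ∈-concatMap⁺ f (Any.map (λ { refl → y∈ }) x∈)

-- Both sides sum `q` over the same words without repetition: `u` determines `v` as its letters up
-- to `k + l`, and `d` as its letters above `k`, shifted down.
shuffle-law : ∀ {σ₁ σ₂ σ₃ σ₄} → Law σ₁ σ₂ σ₃ σ₄ → ∀ q {a b c} → IsPacked a → IsPacked b → IsPacked c →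
              total (λ v → total q (shuffle σ₁ v c)) (shuffle σ₂ a b)
            ≡ total (λ d → total q (shuffle σ₃ a d)) (shuffle σ₄ b c)
shuffle-law {σ₁} {σ₂} {σ₃} {σ₄} law q {a} {b} {c} pa pb pc = begin
  total (λ v → total q (shuffle σ₁ v c)) (shuffle σ₂ a b)      ≡⟨ sym (total-concatMap q _ (shuffle σ₂ a b)) ⟩
  total q (concatMap (λ v → shuffle σ₁ v c) (shuffle σ₂ a b))  ≡⟨ total-set q uniqueˡ uniqueʳ to from ⟩
  total q (concatMap (λ d → shuffle σ₃ a d) (shuffle σ₄ b c))  ≡⟨ total-concatMap q _ (shuffle σ₄ b c) ⟩
  total (λ d → total q (shuffle σ₃ a d)) (shuffle σ₄ b c)      ∎
  where
  open ≡-Reasoning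
  open InShuffle⁺
  k = maxW a
  l = maxW b
  L = concatMap (λ v → shuffle σ₁ v c) (shuffle σ₂ a b)
  R = concatMap (λ d → shuffle σ₃ a d) (shuffle σ₄ b c)
  max-v : ∀ {v} → v ∈ shuffle σ₂ a b → maxW v ≡ k + l
  max-v = ∈-shuffle-max {σ₂} pa pb
  uniqueˡ : Unique L
  uniqueˡ = Unique-concatMap _ (shuffle-unique σ₂ a b) (λ v → shuffle-unique σ₁ v c) λ {v} {v′} {u} v∈ v′∈ u∈ u∈′ →
    trans (sym (Cut.low (cut (∈-shuffle-elim σ₁ v c u∈))))
      (trans (cong (λ m → restrictLe m u) (trans (max-v v∈) (sym (max-v v′∈)))) (Cut.low (cut (∈-shuffle-elim σ₁ v′ c u∈′))))
  uniqueʳ : Unique R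
  uniqueʳ = Unique-concatMap _ (shuffle-unique σ₄ b c) (λ d → shuffle-unique σ₃ a d) λ {d} {d′} _ _ u∈ u∈′ →
    shift-injective k (trans (sym (Cut.high (cut (∈-shuffle-elim σ₃ a d u∈)))) (Cut.high (cut (∈-shuffle-elim σ₃ a d′ u∈′))))
  to : ∀ {u} → u ∈ L → u ∈ R
  to {u} u∈ with find (∈-concatMap⁻ (λ v → shuffle σ₁ v c) {xs = shuffle σ₂ a b} u∈)
  ... | v , v∈ , u∈v with ∈-shuffle-elim σ₂ a b v∈ | ∈-shuffle-elim σ₁ v c u∈v
  ... | sv | su with subst (λ m → Cut m v c u) (max-v v∈) (cut su) | subst (λ m → OnSide σ₁ m u) (max-v v∈) (on-side su)
  ... | cut-u | side-u =
    let d = unshift k (restrictGt k u)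
        d≡ = shift-unshift-Gt k u
        cut-a , cut-b = cut-assocʳ {l = l} (cut sv) cut-u d≡
        side-a , side-b = sideʳ {l = l} (Cut.low cut-u) d≡ law side-u (on-side sv)
    in ∈-concatMap (λ d → shuffle σ₃ a d) {d}
         (∈-shuffle⁺ {σ₄} pb pc (cut-b , side-b))
         (∈-shuffle⁺ {σ₃} pa (packed⇒isPacked (packed-unshift k (is-packed su))) (cut-a , side-a))
  from : ∀ {u} → u ∈ R → u ∈ L
  from {u} u∈ with find (∈-concatMap⁻ (λ d → shuffle σ₃ a d) {xs = shuffle σ₄ b c} u∈)
  ... | d , d∈ , u∈d with ∈-shuffle-elim σ₄ b c d∈ | ∈-shuffle-elim σ₃ a d u∈d
  ... | sd | su with cut-assocˡ {l = l} (cut su) (cut sd) refl | sideˡ {l = l} refl (Cut.high (cut su)) law (on-side su) (on-side sd)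
  ... | cut-v , cut-u | side-u , side-v =
    ∈-concatMap (λ v → shuffle σ₁ v c) v∈
      (∈-shuffle⁺ {σ₁} (packed⇒isPacked pv) pc
        (subst (λ m → Cut m v c u) (sym (max-v v∈)) cut-u , subst (λ m → OnSide σ₁ m u) (sym (max-v v∈)) side-u))
    where
    v = restrictLe (k + l) u
    v∈ = ∈-shuffle⁺ {σ₂} pa pb (cut-v , side-v)
    pv = cut-packed pa pb cut-v

-- leading terms

-- Moving the low letters to the front keeps their order; at the first place where the word changes,
-- a letter above `k` gives way to one at most `k`.
restrict-least : ∀ k u → restrictLe k u ++ restrictGt k u ≡ u ⊎ restrictLe k u ++ restrictGt k u <ₗ u
restrict-least k []      = inj₁ refl
restrict-least k (x ∷ u) with x ≤? k
... | yes x≤k rewrite restrictLe-accept u x≤k | restrictGt-reject u x≤k with restrict-least k u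
...   | inj₁ eq = inj₁ (cong (x ∷_) eq)
...   | inj₂ lt = inj₂ (tail< lt)
restrict-least k (x ∷ u) | no x≰k rewrite restrictLe-reject u (≰⇒> x≰k) | restrictGt-accept u (≰⇒> x≰k)
  with restrictLe k u | restrict-least k u | (λ {y} → ∈-restrictLe⁻ k {y} u)
... | []    | inj₁ eq | _ = inj₁ (cong (x ∷_) eq)
... | []    | inj₂ lt | _ = inj₂ (tail< lt)
... | y ∷ _ | _       | low = inj₂ (head< (≤-<-trans (proj₂ (low (here refl))) (≰⇒> x≰k)))

⊘-least : ∀ {a b u} → Cut (maxW a) a b u → a ⊘ b ≡ u ⊎ a ⊘ b <ₗ u
⊘-least {a} {b} {u} (mkCut u≤ u>) = subst₂ (λ p e → p ++ e ≡ u ⊎ p ++ e <ₗ u) u≤ u> (restrict-least (maxW a) u)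

-- The last letter comes from the left factor and stays in place, so `restrict-least` is applied to
-- the word without it.
insert-least : ∀ {s x f u} → InShuffle left (s ∷ʳ x) f u → insertBeforeLast s x f ≡ u ⊎ insertBeforeLast s x f <ₗ u
insert-least {s} {x} {f} {u} (mkCut u≤ u> , le) with initLast u
... | [] = ⊥-elim (∷ʳ≢[] {s} (sym u≤))
... | s′ ∷ʳ′ y rewrite lastLetter-∷ʳ s′ y
  with ∷ʳ-injective (restrictLe (maxW (s ∷ʳ x)) s′) s (trans (sym (restrictLe-∷ʳ s′ le)) u≤)
... | s≡ , refl with subst₂ (λ p e → p ++ e ≡ s′ ⊎ p ++ e <ₗ s′) s≡ (trans (sym (restrictGt-∷ʳ s′ le)) u>) (restrict-least _ s′)
... | inj₁ eq = inj₁ (trans (sym (++-assoc s _ [ x ])) (cong (_∷ʳ x) eq))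
... | inj₂ lt = inj₂ (subst (_<ₗ s′ ∷ʳ x) (++-assoc s _ [ x ]) (<ₗ-++ʳ [ x ] lt))

Least : Word → List Word → Set
Least u ws = u ∈ ws × (∀ {v} → v ∈ ws → u ≡ v ⊎ u <ₗ v)

sorted-head : ∀ {u ws} → AllPairs _<ₗ_ ws → Least u ws → ∃ λ vs → ws ≡ u ∷ vs × All (u <ₗ_) vs
sorted-head {ws = w ∷ ws} (w<ws ∷ _) (here refl , _) = ws , refl , w<ws
sorted-head {ws = w ∷ ws} (w<ws ∷ _) (there u∈ , least) with least (here refl)
... | inj₁ refl = ⊥-elim (<ₗ-irrefl (All.lookup w<ws u∈))
... | inj₂ u<w  = ⊥-elim (<ₗ-asym u<w (All.lookup w<ws u∈))

-- For nonempty `b` the word `a ⊘ b` ends in a letter of `b`, so it belongs to the right half and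
-- not to the left one.
⊘-Least : ∀ σ {a b} → σ ≢ left → IsPacked a → IsPacked b → b ≢ [] → Least (a ⊘ b) (shuffle σ a b)
⊘-Least σ {a} {b} σ≢left pa pb b≢[] =
    ∈-shuffle⁺ {σ} pa pb (cut-⊘ a pb , side σ σ≢left)
  , λ v∈ → ⊘-least (InShuffle⁺.cut (∈-shuffle-elim σ a b v∈))
  where
  side : ∀ σ → σ ≢ left → OnSide σ (maxW a) (a ⊘ b)
  side both  _  = tt
  side left  ne = ⊥-elim (ne refl)
  side right _ with initLast b
  ... | [] = ⊥-elim (b≢[] refl)
  ... | b′ ∷ʳ′ y = subst (maxW a <_) (sym last≡) (shift-> (maxW a) pb (∈-map⁺ (maxW a +_) (∈-∷ʳ {b′})))
    where
    last≡ : lastLetter (a ⊘ (b′ ∷ʳ y)) ≡ maxW a + y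
    last≡ = trans (cong lastLetter (trans (cong (a ++_) (map-++ (maxW a +_) b′ [ y ])) (sym (++-assoc a _ [ maxW a + y ]))))
      (lastLetter-∷ʳ (a ++ shift (maxW a) b′) _)

insert-Least : ∀ {s x f} → IsPacked (s ∷ʳ x) → IsPacked f → Least (insertBeforeLast s x f) (shuffle left (s ∷ʳ x) f)
insert-Least {s} {x} {f} ps pf =
    ∈-shuffle⁺ {left} ps pf (cut-insert s x pf , subst (_≤ maxW (s ∷ʳ x)) (sym last≡) (∈⇒≤maxW (s ∷ʳ x) (∈-∷ʳ {s})))
  , λ v∈ → insert-least {s} {x} {f} (let e = ∈-shuffle-elim left (s ∷ʳ x) f v∈ in InShuffle⁺.cut e , InShuffle⁺.on-side e)
  where
  last≡ : lastLetter (insertBeforeLast s x f) ≡ x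
  last≡ = trans (cong lastLetter (sym (++-assoc s _ [ x ]))) (lastLetter-∷ʳ (s ++ shift (maxW (s ∷ʳ x)) f) x)

total-least : ∀ c {u ws} → AllPairs _<ₗ_ ws → Least u ws → (∀ {v} → v ∈ ws → u <ₗ v → c v ≡ 0ℚ) → total c ws ≡ 0ℚ → c u ≡ 0ℚ
total-least c {u} sorted least later eq with sorted-head sorted least
... | vs , refl , u<vs = begin
  c u               ≡⟨ sym (ℚₚ.+-identityʳ (c u)) ⟩
  c u ⊕ 0ℚ          ≡⟨ cong (c u ⊕_) (sym (total-zero vs (λ v∈ → later (there v∈) (All.lookup u<vs v∈)))) ⟩
  c u ⊕ total c vs  ≡⟨ eq ⟩
  0ℚ                ∎
  where open ≡-Reasoning

-- Induction from the largest word downwards; finiteness of the list replaces well-foundedness of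
-- the order.
sorted-induction : ∀ (Q : Word → Set) {ws} → AllPairs _<ₗ_ ws →
                   (∀ {u} → u ∈ ws → (∀ {v} → v ∈ ws → u <ₗ v → Q v) → Q u) → ∀ {u} → u ∈ ws → Q u
sorted-induction Q {w ∷ ws} (w<ws ∷ sorted) step = all
  where
  tail : ∀ {u} → u ∈ ws → Q u
  tail = sorted-induction Q sorted λ u∈ later → step (there u∈) λ where
    (here refl) u<w → ⊥-elim (<ₗ-asym u<w (All.lookup w<ws u∈))
    (there v∈)  u<v → later v∈ u<v
  all : ∀ {u} → u ∈ w ∷ ws → Q u
  all (here refl) = step (here refl) λ where
    (here refl) w<w → ⊥-elim (<ₗ-irrefl w<w)
    (there v∈)  _   → tail v∈
  all (there u∈) = tail u∈

-- the half-coproducts in terms of half-shuffles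

eqW-refl : ∀ w → eqW w w ≡ true
eqW-refl []      = refl
eqW-refl (x ∷ w) rewrite Equivalence.to T-≡ (≡⇒≡ᵇ x x refl) = eqW-refl w

eqW⇒≡ : ∀ v w → T (eqW v w) → v ≡ w
eqW⇒≡ []      []      _ = refl
eqW⇒≡ (x ∷ v) (y ∷ w) t with Equivalence.to (T-∧ {x ≡ᵇ y}) t
... | tx , tv = cong₂ _∷_ (≡ᵇ⇒≡ x y tx) (eqW⇒≡ v w tv)

CutsInto : Word → Word → Word → ℕ → Set
CutsInto a b u i = a ≡ restrictLe i u × b ≡ pack (restrictGt i u)

count-none : ∀ a b u is → (∀ {i} → i ∈ is → ¬ CutsInto a b u i) → countPair a b (cuts u is) ≡ 0
count-none a b u []       h = refl
count-none a b u (i ∷ is) h with eqW a (restrictLe i u) ∧ eqW b (pack (restrictGt i u)) in eq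
... | false = count-none a b u is (h ∘ there)
... | true with Equivalence.to (T-∧ {eqW a (restrictLe i u)}) (Equivalence.from T-≡ eq)
... | ta , tb = ⊥-elim (h (here refl) (eqW⇒≡ _ _ ta , eqW⇒≡ _ _ tb))

count-one : ∀ {a b u is i} → Unique is → i ∈ is → CutsInto a b u i → (∀ {j} → j ∈ is → CutsInto a b u j → j ≡ i) →
            countPair a b (cuts u is) ≡ 1
count-one {u = u} {i ∷ is} (i∉ ∷ _) (here refl) (refl , refl) only
  rewrite eqW-refl (restrictLe i u) | eqW-refl (pack (restrictGt i u)) =
  cong suc (count-none _ _ u is (λ j∈ m → All.lookup i∉ j∈ (sym (only (there j∈) m))))
count-one {a} {b} {u} {j ∷ is} {i} (j∉ ∷ uniq) (there i∈) m only
  with eqW a (restrictLe j u) ∧ eqW b (pack (restrictGt j u)) in eq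
... | false = count-one {a} {b} {u} uniq i∈ m (only ∘ there)
... | true with Equivalence.to (T-∧ {eqW a (restrictLe j u)}) (Equivalence.from T-≡ eq)
... | ta , tb = ⊥-elim (All.lookup j∉ i∈ (only (here refl) (eqW⇒≡ _ _ ta , eqW⇒≡ _ _ tb)))

range-unique : ∀ a b → Unique (range a b)
range-unique a b = Uniqueₚ.map⁺ (λ {x} {y} → +-cancelˡ-≡ a x y) (Uniqueₚ.upTo⁺ (b ∸ a))

-- The pairs that can occur in a coproduct in degree `n`. Cut points run from `1` to `maxW u ∸ 1`,
-- which leaves both factors nonempty.
record Admissible (n : ℕ) (a b : Word) : Set where
  field
    packedˡ   : IsPacked a
    packedʳ   : IsPacked b
    nonemptyˡ : a ≢ []
    nonemptyʳ : b ≢ []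
    length≡   : length a + length b ≡ n

packed? : ∀ w → Dec (IsPacked w)
packed? w = map′ (isPacked⇒IsPacked w) (IsPacked⇒isPacked w) (T? (isPacked w))

admissible? : ∀ n a b → Dec (Admissible n a b)
admissible? n a b = map′
  (λ (pa , pb , na , nb , len) → record { packedˡ = pa ; packedʳ = pb ; nonemptyˡ = na ; nonemptyʳ = nb ; length≡ = len })
  (λ ad → let open Admissible ad in packedˡ , packedʳ , nonemptyˡ , nonemptyʳ , length≡)
  (packed? a ×-dec packed? b ×-dec ¬? (a ≟[]) ×-dec ¬? (b ≟[]) ×-dec (length a + length b ≟ n))

-- As `u` is packed, the maximum of `restrictLe i u` is `i`. A pair thus arises from at most one cut
-- point, and the coefficients counted by `countPair` are 0 or 1.
cutsInto⇒cut : ∀ n {a b u i} → u ∈ packedWords n → 1 ≤ i → i < maxW u → CutsInto a b u i →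
               Admissible n a b × Cut (maxW a) a b u × i ≡ maxW a
cutsInto⇒cut n {a} {b} {u} {i} u∈ 1≤i i<m (refl , refl) with ∈-packedWords⁻ n u∈
... | len , pu rewrite pack-restrictGt i pu | packed-max (packed-restrictLe i pu (<⇒≤ i<m)) =
    record { packedˡ = packed⇒isPacked pa ; packedʳ = packed⇒isPacked pb
           ; nonemptyˡ = packed-nonempty pa 1≤i ; nonemptyʳ = packed-nonempty pb (m<n⇒0<n∸m i<m)
           ; length≡ = trans (sym (cut-length (cut-at i u))) len }
  , cut-at i u , refl
  where
  pa = packed-restrictLe i pu (<⇒≤ i<m)
  pb = packed-unshift i pu

unshift-shift : ∀ k w → unshift k (shift k w) ≡ w
unshift-shift k []      = refl
unshift-shift k (x ∷ w) = cong₂ _∷_ (m+n∸m≡n k x) (unshift-shift k w)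

cut⇒cutsInto : ∀ n {a b u} → u ∈ packedWords n → Cut (maxW a) a b u → CutsInto a b u (maxW a)
cut⇒cutsInto n {a} {b} {u} u∈ (mkCut u≤ u>) = sym u≤ ,
  sym (trans (pack-restrictGt (maxW a) (proj₂ (∈-packedWords⁻ n u∈))) (trans (cong (unshift (maxW a)) u>) (unshift-shift (maxW a) b)))

cut-<max : ∀ {a b u} → IsPacked b → b ≢ [] → Cut (maxW a) a b u → maxW a < maxW u
cut-<max {a} {b} {u} pb b≢[] (mkCut _ u>) = letter b b≢[] refl
  where
  letter : ∀ b′ → b′ ≢ [] → b′ ≡ b → maxW a < maxW u
  letter []       ne _    = ⊥-elim (ne refl)
  letter (y ∷ b′) _  refl =
    let y∈u , <y = ∈-restrictGt⁻ (maxW a) u (subst (maxW a + y ∈_) (sym u>) (here refl))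
    in <-≤-trans <y (∈⇒≤maxW u y∈u)

packedWords-≢[] : ∀ n {u} → u ∈ packedWords (suc n) → u ≢ []
packedWords-≢[] n u∈ refl with proj₁ (∈-packedWords⁻ (suc n) u∈)
... | ()

sum-indicator : ∀ c {P : Word → Set} (P? : ∀ u → Dec (P u)) (count : Word → ℕ) ws →
                (∀ {u} → u ∈ ws → P u → count u ≡ 1) → (∀ {u} → u ∈ ws → ¬ P u → count u ≡ 0) →
                sumℚ (map (λ u → c u ⊛ fromℕ (count u)) ws) ≡ total c (filter P? ws)
sum-indicator c P? count []       one none = refl
sum-indicator c P? count (w ∷ ws) one none with P? w
... | yes p rewrite one (here refl) p = cong₂ _⊕_ (ℚₚ.*-identityʳ (c w)) (sum-indicator c P? count ws (one ∘ there) (none ∘ there))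
... | no ¬p rewrite none (here refl) ¬p =
  trans (cong₂ _⊕_ (ℚₚ.*-zeroʳ (c w)) (sum-indicator c P? count ws (one ∘ there) (none ∘ there))) (ℚₚ.+-identityˡ _)

module _ (σ : Side) (terms : Word → List (Word × Word)) (lo hi : Word → ℕ)
         (terms≡ : ∀ {u} → u ≢ [] → terms u ≡ cuts u (range (lo u) (hi u)))
         (inner : ∀ n {u i} → u ∈ packedWords (suc n) → lo u ≤ i → i < hi u → 1 ≤ i × i < maxW u × OnSide σ i u)
         (outer : ∀ n {u i} → u ∈ packedWords (suc n) → 1 ≤ i → i < maxW u → OnSide σ i u → lo u ≤ i × i < hi u) where

  -- Duality of half-coproduct and half-shuffle. `inner` and `outer` identify the interval of cut
  -- points with the side `σ`, so one argument covers both halves.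
  applyΔ-admissible : ∀ n c {a b} → Admissible (suc n) a b → applyΔ terms (suc n) c a b ≡ total c (shuffle σ a b)
  applyΔ-admissible n c {a} {b} ad = trans
    (sum-indicator c (inShuffle? σ a b) (λ u → countPair a b (terms u)) (packedWords (suc n)) one none)
    (cong (λ n → total c (filter (inShuffle? σ a b) (packedWords n))) (sym length≡))
    where
    open Admissible ad
    one : ∀ {u} → u ∈ packedWords (suc n) → InShuffle σ a b u → countPair a b (terms u) ≡ 1
    one {u} u∈ (cut , side) rewrite terms≡ (packedWords-≢[] n u∈) =
      let lo≤ , <hi = outer n u∈ (1≤packed-max packedˡ nonemptyˡ) (cut-<max packedʳ nonemptyʳ cut) side
      in count-one {a} {b} {u} (range-unique (lo u) (hi u)) (∈-range⁺ lo≤ <hi) (cut⇒cutsInto (suc n) u∈ cut) λ j∈ m →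
        let lo≤j , j<hi = ∈-range⁻ (lo u) (hi u) j∈
            1≤j , j< , _ = inner n u∈ lo≤j j<hi
        in proj₂ (proj₂ (cutsInto⇒cut (suc n) u∈ 1≤j j< m))
    none : ∀ {u} → u ∈ packedWords (suc n) → ¬ InShuffle σ a b u → countPair a b (terms u) ≡ 0
    none {u} u∈ ¬s rewrite terms≡ (packedWords-≢[] n u∈) = count-none a b u (range (lo u) (hi u)) λ j∈ m →
      let lo≤j , j<hi = ∈-range⁻ (lo u) (hi u) j∈
          1≤j , j< , side = inner n u∈ lo≤j j<hi
          _ , cut , j≡ = cutsInto⇒cut (suc n) u∈ 1≤j j< m
      in ¬s (cut , subst (λ k → OnSide σ k u) j≡ side)

  applyΔ-inadmissible : ∀ n c {a b} → ¬ Admissible (suc n) a b → applyΔ terms (suc n) c a b ≡ 0ℚ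
  applyΔ-inadmissible n c {a} {b} ¬ad = trans
    -- The indicator of the empty predicate: no word has a term `a ⊗ b`, so the sum runs over an
    -- empty list.
    (sum-indicator c (λ _ → no id) (λ u → countPair a b (terms u)) (packedWords (suc n)) (λ _ ()) none)
    (cong (total c) (filter-none (λ _ → no id) (All.tabulate {xs = packedWords (suc n)} (λ _ ()))))
    where
    none : ∀ {u} → u ∈ packedWords (suc n) → ¬ ⊥ → countPair a b (terms u) ≡ 0
    none {u} u∈ _ rewrite terms≡ (packedWords-≢[] n u∈) = count-none a b u (range (lo u) (hi u)) λ j∈ m →
      let lo≤j , j<hi = ∈-range⁻ (lo u) (hi u) j∈
          1≤j , j< , _ = inner n u∈ lo≤j j<hi
      in ¬ad (proj₁ (cutsInto⇒cut (suc n) u∈ 1≤j j< m))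

last-bounds : ∀ n {u} → u ∈ packedWords (suc n) → 1 ≤ lastLetter u × lastLetter u ≤ maxW u
last-bounds n {u} u∈ = positive pu l∈ , bounded pu l∈
  where
  pu = proj₂ (∈-packedWords⁻ (suc n) u∈)
  l∈ = lastLetter∈ u (packedWords-≢[] n u∈)

termsPrec≡ : ∀ {u} → u ≢ [] → termsPrec u ≡ cuts u (range (lastLetter u) (maxW u))
termsPrec≡ {[]}    ne = ⊥-elim (ne refl)
termsPrec≡ {_ ∷ _} ne = refl

termsSucc≡ : ∀ {u} → u ≢ [] → termsSucc u ≡ cuts u (range 1 (lastLetter u))
termsSucc≡ {[]}    ne = ⊥-elim (ne refl)
termsSucc≡ {_ ∷ _} ne = refl

prec-inner : ∀ n {u i} → u ∈ packedWords (suc n) → lastLetter u ≤ i → i < maxW u → 1 ≤ i × i < maxW u × OnSide left i u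
prec-inner n u∈ l≤i i<m = ≤-trans (proj₁ (last-bounds n u∈)) l≤i , i<m , l≤i

prec-outer : ∀ n {u i} → u ∈ packedWords (suc n) → 1 ≤ i → i < maxW u → OnSide left i u → lastLetter u ≤ i × i < maxW u
prec-outer n u∈ 1≤i i<m l≤i = l≤i , i<m

succ-inner : ∀ n {u i} → u ∈ packedWords (suc n) → 1 ≤ i → i < lastLetter u → 1 ≤ i × i < maxW u × OnSide right i u
succ-inner n u∈ 1≤i i<l = 1≤i , <-≤-trans i<l (proj₂ (last-bounds n u∈)) , i<l

succ-outer : ∀ n {u i} → u ∈ packedWords (suc n) → 1 ≤ i → i < maxW u → OnSide right i u → 1 ≤ i × i < lastLetter u
succ-outer n u∈ 1≤i i<m i<l = 1≤i , i<l

Δprec-admissible : ∀ n c {a b} → Admissible (suc n) a b → Δprec (suc n) c a b ≡ total c (shuffle left a b)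
Δprec-admissible = applyΔ-admissible left termsPrec lastLetter maxW termsPrec≡ prec-inner prec-outer

Δsucc-admissible : ∀ n c {a b} → Admissible (suc n) a b → Δsucc (suc n) c a b ≡ total c (shuffle right a b)
Δsucc-admissible = applyΔ-admissible right termsSucc (λ _ → 1) lastLetter termsSucc≡ succ-inner succ-outer

Δprec-inadmissible : ∀ n c {a b} → ¬ Admissible (suc n) a b → Δprec (suc n) c a b ≡ 0ℚ
Δprec-inadmissible = applyΔ-inadmissible left termsPrec lastLetter maxW termsPrec≡ prec-inner prec-outer

Δsucc-inadmissible : ∀ n c {a b} → ¬ Admissible (suc n) a b → Δsucc (suc n) c a b ≡ 0ℚ
Δsucc-inadmissible = applyΔ-inadmissible right termsSucc (λ _ → 1) lastLetter termsSucc≡ succ-inner succ-outer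

total-both : ∀ c {a b} → IsPacked a → IsPacked b → total c (shuffle both a b) ≡ total c (shuffle left a b) ⊕ total c (shuffle right a b)
total-both c {a} {b} pa pb = trans
  (total-set c (shuffle-unique both a b) (Uniqueₚ.++⁺ (shuffle-unique left a b) (shuffle-unique right a b) disjoint) to from)
  (total-++ c (shuffle left a b) (shuffle right a b))
  where
  open InShuffle⁺
  disjoint : ∀ {u} → ¬ (u ∈ shuffle left a b × u ∈ shuffle right a b)
  disjoint (l∈ , r∈) = <⇒≱ (on-side (∈-shuffle-elim right a b r∈)) (on-side (∈-shuffle-elim left a b l∈))
  to : ∀ {u} → u ∈ shuffle both a b → u ∈ shuffle left a b ++ shuffle right a b
  to {u} u∈ with lastLetter u ≤? maxW a
  ... | yes le = ∈-++⁺ˡ (∈-shuffle⁺ {left} pa pb (cut (∈-shuffle-elim both a b u∈) , le))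
  ... | no gt  = ∈-++⁺ʳ (shuffle left a b) (∈-shuffle⁺ {right} pa pb (cut (∈-shuffle-elim both a b u∈) , ≰⇒> gt))
  from : ∀ {u} → u ∈ shuffle left a b ++ shuffle right a b → u ∈ shuffle both a b
  from u∈ with ∈-++⁻ (shuffle left a b) u∈
  ... | inj₁ l∈ = ∈-shuffle⁺ {both} pa pb (cut (∈-shuffle-elim left a b l∈) , tt)
  ... | inj₂ r∈ = ∈-shuffle⁺ {both} pa pb (cut (∈-shuffle-elim right a b r∈) , tt)

Annihilates : Side → ℕ → Vect → Set
Annihilates σ n c = ∀ {a b} → Admissible n a b → total c (shuffle σ a b) ≡ 0ℚ

prim⇒ : ∀ n c → Prim (suc n) c → Annihilates both (suc n) c
prim⇒ n c (_ , eq) {a} {b} ad = trans (total-both c packedˡ packedʳ)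
  (trans (cong₂ _⊕_ (sym (Δprec-admissible n c ad)) (sym (Δsucc-admissible n c ad))) (eq a b))
  where open Admissible ad

⇒prim : ∀ n c → InWQSym (suc n) c → Annihilates both (suc n) c → Prim (suc n) c
⇒prim n c c∈ ann = c∈ , eq
  where
  eq : ∀ a b → Δprec (suc n) c a b ⊕ Δsucc (suc n) c a b ≡ 0ℚ
  eq a b with admissible? (suc n) a b
  ... | yes ad = trans (cong₂ _⊕_ (Δprec-admissible n c ad) (Δsucc-admissible n c ad))
                   (trans (sym (total-both c (Admissible.packedˡ ad) (Admissible.packedʳ ad))) (ann ad))
  ... | no ¬ad = trans (cong₂ _⊕_ (Δprec-inadmissible n c ¬ad) (Δsucc-inadmissible n c ¬ad)) (ℚₚ.+-identityˡ 0ℚ)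

tprim⇒ : ∀ n c → TPrim (suc n) c → Annihilates left (suc n) c × Annihilates right (suc n) c
tprim⇒ n c (_ , eq≺ , eq≻) = (λ ad → trans (sym (Δprec-admissible n c ad)) (eq≺ _ _))
                           , (λ ad → trans (sym (Δsucc-admissible n c ad)) (eq≻ _ _))

⇒tprim : ∀ n c → InWQSym (suc n) c → Annihilates left (suc n) c → Annihilates right (suc n) c → TPrim (suc n) c
⇒tprim n c c∈ annˡ annʳ = c∈ , eq≺ , eq≻
  where
  eq≺ : ∀ a b → Δprec (suc n) c a b ≡ 0ℚ
  eq≺ a b with admissible? (suc n) a b
  ... | yes ad = trans (Δprec-admissible n c ad) (annˡ ad)
  ... | no ¬ad = Δprec-inadmissible n c ¬ad
  eq≻ : ∀ a b → Δsucc (suc n) c a b ≡ 0ℚ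
  eq≻ a b with admissible? (suc n) a b
  ... | yes ad = trans (Δsucc-admissible n c ad) (annʳ ad)
  ... | no ¬ad = Δsucc-inadmissible n c ¬ad

-- the defining equations, and the triangular subsystem that implies them

module _ {n : ℕ} {c : Vect} where

  -- A word that is the leading term of a₁ ⧢ a₂ is that product minus larger words,
  -- so the law (a₁ ⧢ a₂) ⧢ b = a₁ ⧢ (a₂ ⧢ b) reduces its products to those of a₁.
  module _ (σ : Side) {a b : Word} (ad : Admissible n a b) where
    open Admissible ad

    ProductVanishes : Word → Set
    ProductVanishes v = v ≢ [] → total c (shuffle σ v b) ≡ 0ℚ

    leading-vanishes : ∀ {σ₂ σ₃ σ₄ a₁ a₂ v} → Law σ σ₂ σ₃ σ₄ → IsPacked a₁ → IsPacked a₂ → a₁ ≢ [] → a₂ ≢ [] →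
                       length a₁ + length a₂ ≡ length a → Least v (shuffle σ₂ a₁ a₂) →
                       (∀ {w} → w ∈ packedWords (length a) → v <ₗ w → ProductVanishes w) →
                       (∀ {d} → Admissible n a₁ d → total c (shuffle σ₃ a₁ d) ≡ 0ℚ) →
                       total c (shuffle σ v b) ≡ 0ℚ
    leading-vanishes {σ₂} {σ₃} {σ₄} {a₁} {a₂} {v} law pa₁ pa₂ a₁≢[] a₂≢[] len least later base =
      total-least (λ v → total c (shuffle σ v b)) (shuffle-sorted σ₂ a₁ a₂) least
        (λ {w} w∈ v<w → let e = ∈-shuffle-elim σ₂ a₁ a₂ w∈ in
          later (subst (λ n → w ∈ packedWords n) (trans (InShuffle⁺.length≡ e) len) (∈-packedWords⁺ (InShuffle⁺.is-packed e)))
            v<w (∈-shuffle-≢[] σ₂ a₁ a₂ a₁≢[] w∈))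
        (trans (shuffle-law law c pa₁ pa₂ packedʳ) (total-zero (shuffle σ₄ a₂ b) λ d∈ → base (admissible d∈)))
      where
      admissible : ∀ {d} → d ∈ shuffle σ₄ a₂ b → Admissible n a₁ d
      admissible d∈ = let e = ∈-shuffle-elim σ₄ a₂ b d∈ in record
        { packedˡ = pa₁ ; packedʳ = InShuffle⁺.is-packed e ; nonemptyˡ = a₁≢[] ; nonemptyʳ = ∈-shuffle-≢[] σ₄ a₂ b a₂≢[] d∈
        ; length≡ = trans (cong (length a₁ +_) (InShuffle⁺.length≡ e))
            (trans (sym (+-assoc (length a₁) _ _)) (trans (cong (_+ length b) len) length≡)) }

    admissibleˡ : ∀ {v} → v ∈ packedWords (length a) → v ≢ [] → Admissible n v b
    admissibleˡ v∈ v≢[] = let len , pv = ∈-packedWords⁻ (length a) v∈ in record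
      { packedˡ = pv ; packedʳ = packedʳ ; nonemptyˡ = v≢[] ; nonemptyʳ = nonemptyʳ
      ; length≡ = trans (cong (_+ length b) len) length≡ }

  -- The shape `Law σ both σ σ` covers `assoc` and `≻≻`: the law returns products in the same half
  -- `σ` with irreducible left factor, where `base` applies.
  annihilates-⊘ : ∀ {σ} → Law σ both σ σ →
                  (∀ {a d} → Irreducible a → Admissible n a d → total c (shuffle σ a d) ≡ 0ℚ) → Annihilates σ n c
  annihilates-⊘ {σ} law base {a} {b} ad =
    sorted-induction (ProductVanishes σ ad) (packedWords-sorted (length a)) step (∈-packedWords⁺ packedˡ) nonemptyˡ
    where
    open Admissible ad
    step : ∀ {v} → v ∈ packedWords (length a) → (∀ {w} → w ∈ packedWords (length a) → v <ₗ w → ProductVanishes σ ad w) →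
           ProductVanishes σ ad v
    step v∈ later v≢[] with ∈-packedWords⁻ (length a) v∈
    ... | len , pv with first-factor pv v≢[]
    ... | a₁ , a₂ , ia₁ , pa₂ , refl with a₂ ≟[]
    ... | yes refl rewrite ++-identityʳ a₁ = base ia₁ (admissibleˡ σ ad v∈ v≢[])
    ... | no a₂≢[] = leading-vanishes σ ad law pa₁ pa₂ (Irreducible.nonempty ia₁) a₂≢[]
      (trans (sym (cut-length (cut-⊘ a₁ pa₂))) len) (⊘-Least both (λ ()) pa₁ pa₂ a₂≢[]) later (base ia₁)
      where pa₁ = Irreducible.packed ia₁

  -- A reducible left factor is handled by `≻≺`, whose outer product on the other side is a right
  -- one, killed by `annʳ`. An irreducible one that is not blue-irreducible is handled by `≺≺`,
  -- which leaves a blue-irreducible left factor.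
  annihilates-insert : Annihilates right n c →
                       (∀ {s x f} → BlueIrreducible s x → Admissible n (s ∷ʳ x) f → total c (shuffle left (s ∷ʳ x) f) ≡ 0ℚ) →
                       Annihilates left n c
  annihilates-insert annʳ base {a} {b} ad =
    sorted-induction (ProductVanishes left ad) (packedWords-sorted (length a)) step (∈-packedWords⁺ packedˡ) nonemptyˡ
    where
    open Admissible ad
    step : ∀ {v} → v ∈ packedWords (length a) → (∀ {w} → w ∈ packedWords (length a) → v <ₗ w → ProductVanishes left ad w) →
           ProductVanishes left ad v
    step v∈ later v≢[] with ∈-packedWords⁻ (length a) v∈
    ... | len , pv with first-factor pv v≢[]
    ... | a₁ , a₂ , ia₁ , pa₂ , refl with a₂ ≟[]
    ... | no a₂≢[] = leading-vanishes left ad ≻≺ pa₁ pa₂ (Irreducible.nonempty ia₁) a₂≢[]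
      (trans (sym (cut-length (cut-⊘ a₁ pa₂))) len) (⊘-Least right (λ ()) pa₁ pa₂ a₂≢[]) later annʳ
      where pa₁ = Irreducible.packed ia₁
    ... | yes refl rewrite ++-identityʳ a₁ with blue-factor ia₁
    ... | s , x , f , bs , pf , refl with f ≟[]
    ... | yes refl = base bs (admissibleˡ left ad v∈ v≢[])
    ... | no f≢[] = leading-vanishes left ad ≺≺ ps pf (∷ʳ≢[] {s}) f≢[]
      (trans (sym (cut-length (cut-insert s x pf))) len) (insert-Least ps pf) later (base bs)
      where ps = BlueIrreducible.packed bs

-- `Prim` and `TPrim` as solution spaces of triangular systems

data Mode : Set where
  prim tprim : Mode

-- The product whose leading words are the `a ⊘ d`. For `tprim` this is the right half; the left
-- half contributes through `insertion`.
side : Mode → Side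
side prim  = both
side tprim = right

side≢left : ∀ μ → side μ ≢ left
side≢left prim  ()
side≢left tprim ()

Free : Mode → Word → Set
Free prim  = Irreducible
Free tprim = Blue

irreducible? : ∀ w → Dec (Irreducible w)
irreducible? w = map′
  (λ (p , n , r) → record { packed = p ; nonempty = n ; ¬reducible = r })
  (λ i → let open Irreducible i in packed , nonempty , ¬reducible)
  (packed? w ×-dec ¬? (w ≟[]) ×-dec ¬? (reducible? w))

blueIrreducible? : ∀ s x → Dec (BlueIrreducible s x)
blueIrreducible? s x = map′
  (λ (p , r , b) → record { packed = p ; ¬reducible = r ; ¬blueReducible = b })
  (λ i → let open BlueIrreducible i in packed , ¬reducible , ¬blueReducible)
  (packed? (s ∷ʳ x) ×-dec ¬? (reducible? (s ∷ʳ x)) ×-dec ¬? (blueReducible? s x))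

blue? : ∀ w → Dec (Blue w)
blue? w with initLast w
... | [] = no λ { (s , x , eq , _) → ∷ʳ≢[] {s} (sym eq) }
... | s ∷ʳ′ x = map′ (λ b → s , x , refl , b) from (blueIrreducible? s x)
  where
  from : Blue (s ∷ʳ x) → BlueIrreducible s x
  from (s′ , x′ , eq , b) with ∷ʳ-injective s s′ eq
  ... | refl , refl = b

free? : ∀ μ w → Dec (Free μ w)
free? prim  = irreducible?
free? tprim = blue?

-- Equation μ u L: the equation Σ_{w ∈ L} c w = 0 is imposed, and u is the least word of L.
data Equation (μ : Mode) : Word → List Word → Set where
  product   : ∀ {a d} → Irreducible a → IsPacked d → d ≢ [] → Equation μ (a ⊘ d) (shuffle (side μ) a d)
  insertion : ∀ {s x f} → μ ≡ tprim → BlueIrreducible s x → IsPacked f → f ≢ [] →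
              Equation μ (insertBeforeLast s x f) (shuffle left (s ∷ʳ x) f)

⊘-¬irreducible : ∀ {a d} → Irreducible a → IsPacked d → d ≢ [] → ¬ Irreducible (a ⊘ d)
⊘-¬irreducible {a} ia pd d≢[] i = Irreducible.¬reducible i
  (a , _ , refl , Irreducible.nonempty ia , (λ eq → d≢[] (shift-injective (maxW a) eq)) , ≪-shift a pd)

-- Leading words of `product` are reducible and those of `insertion` irreducible; within each kind
-- the factorisation is unique.
equation-unique : ∀ {μ u v L L′} → Equation μ u L → Equation μ v L′ → u ≡ v → L ≡ L′
equation-unique {μ} (product ia pd _) (product ia′ pd′ _) eq with ⊘-injective ia ia′ pd pd′ eq
... | refl , refl = refl
equation-unique (product ia pd d≢[]) (insertion _ bs pf _) eq =
  ⊥-elim (⊘-¬irreducible ia pd d≢[] (subst Irreducible (sym eq) (insert-irreducible bs pf)))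
equation-unique (insertion _ bs pf _) (product ia pd d≢[]) eq =
  ⊥-elim (⊘-¬irreducible ia pd d≢[] (subst Irreducible eq (insert-irreducible bs pf)))
equation-unique (insertion _ bs pf _) (insertion _ bs′ pf′ _) eq with insert-injective bs bs′ pf pf′ eq
... | refl , refl , refl = refl

equation-exists : ∀ μ {u} → IsPacked u → u ≢ [] → ¬ Free μ u → ∃ (Equation μ u)
equation-exists μ pu u≢[] ¬f with first-factor pu u≢[]
... | a , d , ia , pd , refl with d ≟[]
... | no d≢[] = _ , product ia pd d≢[]
equation-exists prim pu u≢[] ¬f | a , _ , ia , pd , refl | yes refl = ⊥-elim (¬f (subst Irreducible (sym (++-identityʳ a)) ia))
equation-exists tprim pu u≢[] ¬f | a , _ , ia , pd , refl | yes refl rewrite ++-identityʳ a with blue-factor ia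
... | s , x , f , bs , pf , refl with f ≟[]
... | no f≢[]  = _ , insertion refl bs pf f≢[]
... | yes refl = ⊥-elim (¬f (s , x , refl , bs))

free⇒irreducible : ∀ μ {u} → Free μ u → Irreducible u
free⇒irreducible prim  i = i
free⇒irreducible tprim b = blue-irreducible b

equation-¬free : ∀ {μ u L} → Equation μ u L → ¬ Free μ u
equation-¬free {μ} (product ia pd d≢[]) fr = ⊘-¬irreducible ia pd d≢[] (free⇒irreducible μ fr)
equation-¬free (insertion refl bs pf f≢[]) (s , x , eq , bs′) =
  f≢[] (proj₂ (proj₂ (insert-injective bs bs′ pf packed-[] eq)))

equation-admissible : ∀ {μ u L} → Equation μ u L → ∃ λ σ → ∃₂ λ a b →
  L ≡ shuffle σ a b × Admissible (length u) a b × (σ ≡ side μ ⊎ μ ≡ tprim × σ ≡ left)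
equation-admissible {μ} (product {a} {d} ia pd d≢[]) = side μ , a , d , refl
  , record { packedˡ = Irreducible.packed ia ; packedʳ = pd ; nonemptyˡ = Irreducible.nonempty ia ; nonemptyʳ = d≢[]
           ; length≡ = sym (cut-length (cut-⊘ a pd)) } , inj₁ refl
equation-admissible {μ} (insertion {s} {x} {f} refl bs pf f≢[]) = left , s ∷ʳ x , f , refl
  , record { packedˡ = BlueIrreducible.packed bs ; packedʳ = pf ; nonemptyˡ = ∷ʳ≢[] {s} ; nonemptyʳ = f≢[]
           ; length≡ = sym (cut-length (cut-insert s x pf)) } , inj₂ (refl , refl)

equation-least : ∀ {μ u L} → Equation μ u L → AllPairs _<ₗ_ L × Least u L
equation-least {μ} (product {a} {d} ia pd d≢[]) =
  shuffle-sorted (side μ) a d , ⊘-Least (side μ) (side≢left μ) (Irreducible.packed ia) pd d≢[]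
equation-least (insertion {s} {x} {f} _ bs pf f≢[]) =
  shuffle-sorted left (s ∷ʳ x) f , insert-Least (BlueIrreducible.packed bs) pf

equation-words : ∀ {μ u L} → Equation μ u L → ∀ {v} → v ∈ L → v ∈ packedWords (length u)
equation-words {u = u} eq {v} v∈ with equation-admissible eq
... | σ , a , b , refl , ad , _ = subst (λ n → v ∈ packedWords n) (Admissible.length≡ ad) (proj₁ (∈-shuffle⁻ σ a b v∈))

Determined : Mode → Word → Set
Determined μ u = IsPacked u × u ≢ [] × ¬ Free μ u

determined? : ∀ μ u → Dec (Determined μ u)
determined? μ u = packed? u ×-dec ¬? (u ≟[]) ×-dec ¬? (free? μ u)

-- `drop 1` removes the leading word, which `rest-spec` shows to be `u`. Words that are not
-- `Determined` carry no equation, hence the empty list.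
rest : Mode → Word → List Word
rest μ u with determined? μ u
... | yes (pu , u≢[] , ¬f) = drop 1 (proj₁ (equation-exists μ pu u≢[] ¬f))
... | no _ = []

rest-spec : ∀ {μ u} → Determined μ u → ∃ λ L → Equation μ u L × L ≡ u ∷ rest μ u × All (u <ₗ_) (rest μ u)
rest-spec {μ} {u} det with determined? μ u
... | no ¬det = ⊥-elim (¬det det)
... | yes (pu , u≢[] , ¬f) with equation-exists μ pu u≢[] ¬f
... | L , eq with sorted-head (proj₁ (equation-least eq)) (proj₂ (equation-least eq))
... | vs , refl , u<vs = L , eq , refl , u<vs

∉packedWords : ∀ {n c} → InWQSym n c → ∀ w → w ∉ packedWords n → c w ≡ 0ℚ
∉packedWords {n} {c} c∈ w w∉ = c∈ w (not-T (λ t → w∉ (pw t)))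
  where
  not-T : ∀ {b} → ¬ T b → T (not b)
  not-T {true}  ¬t = ¬t tt
  not-T {false} _  = tt
  pw : T (isPW n w) → w ∈ packedWords n
  pw t with Equivalence.to (T-∧ {length w ≡ᵇ n}) t
  ... | tl , tp = subst (λ n → w ∈ packedWords n) (≡ᵇ⇒≡ (length w) n tl) (∈-packedWords⁺ (isPacked⇒IsPacked w tp))

supported⇒InWQSym : ∀ {n c} → (∀ w → w ∉ packedWords n → c w ≡ 0ℚ) → InWQSym n c
supported⇒InWQSym {n} supp w t = supp w λ w∈ →
  let len , pw = ∈-packedWords⁻ n w∈
  in not-not (Equivalence.from T-∧ (≡⇒≡ᵇ (length w) n len , IsPacked⇒isPacked w pw)) t
  where
  not-not : ∀ {b} → T b → ¬ T (not b)
  not-not {true} _ ()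

module _ (μ : Mode) (n : ℕ) where
  open TriangularSystem (Free μ) (free? μ) (rest μ)

  determined : ∀ {u} → u ∈ packedWords (suc n) → ¬ Free μ u → Determined μ u
  determined u∈ ¬f = proj₂ (∈-packedWords⁻ (suc n) u∈) , packedWords-≢[] n u∈ , ¬f

  triangular : Triangular (packedWords (suc n))
  triangular = sorted⇒triangular _ (packedWords-sorted (suc n)) λ {u} u∈ ¬f {v} v∈ → later (determined u∈ ¬f) (proj₁ (∈-packedWords⁻ (suc n) u∈)) v∈
    where
    later : ∀ {u} → Determined μ u → length u ≡ suc n → ∀ {v} → v ∈ rest μ u → v ∈ packedWords (suc n) × u <ₗ v
    later det len {v} v∈ with rest-spec det
    ... | L , eq , L≡ , u< = subst (λ n → v ∈ packedWords n) len (equation-words eq (subst (v ∈_) (sym L≡) (there v∈)))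
                           , All.lookup u< v∈

  -- The system contains one chosen equation per leading word; by `equation-unique` any equation
  -- with that leading word is the chosen one.
  solution⇒ : ∀ {c} → Solution (packedWords (suc n)) c → ∀ {u L} → Equation μ u L → length u ≡ suc n → total c L ≡ 0ℚ
  solution⇒ {c} (_ , eqs) {u} eq len =
    let _ , eq′ , L′≡ , _ = rest-spec (determined u∈ (equation-¬free eq))
    in trans (cong (total c) (trans (equation-unique eq eq′ refl) L′≡)) (eqs u∈ (equation-¬free eq))
    where
    u∈ : u ∈ packedWords (suc n)
    u∈ = subst (λ n → u ∈ packedWords n) len (equation-words eq (proj₁ (proj₂ (equation-least eq))))

  ⇒solution : ∀ {c} → InWQSym (suc n) c → (∀ {u L} → Equation μ u L → length u ≡ suc n → total c L ≡ 0ℚ) →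
              Solution (packedWords (suc n)) c
  ⇒solution {c} c∈ h = ∉packedWords c∈ , λ {u} u∈ ¬f →
    let L , eq , L≡ , _ = rest-spec (determined u∈ ¬f)
    in trans (cong (total c) (sym L≡)) (h eq (proj₁ (∈-packedWords⁻ (suc n) u∈)))

  solution-annihilates : ∀ {c} → Solution (packedWords (suc n)) c → Law (side μ) both (side μ) (side μ) → Annihilates (side μ) (suc n) c
  solution-annihilates sol law = annihilates-⊘ law λ {a} ia ad → let open Admissible ad in
    solution⇒ sol (product ia packedʳ nonemptyʳ) (trans (cut-length (cut-⊘ a packedʳ)) length≡)

-- Dimensions and the final count

prim-dim : ∀ n → HasDim (Prim (suc n)) (length (filter irreducible? (packedWords (suc n))))
prim-dim n = HasDim-⇔ to from (solution-dim (triangular prim n))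
  where
  open TriangularSystem (Free prim) (free? prim) (rest prim)
  to : ∀ c → Solution (packedWords (suc n)) c → Prim (suc n) c
  to c sol = ⇒prim n c (supported⇒InWQSym (proj₁ sol)) (solution-annihilates prim n sol assoc)
  from : ∀ c → Prim (suc n) c → Solution (packedWords (suc n)) c
  from c p = ⇒solution prim n (proj₁ p) λ eq len → zero-total eq len
    where
    zero-total : ∀ {u L} → Equation prim u L → length u ≡ suc n → total c L ≡ 0ℚ
    zero-total eq len with equation-admissible eq
    ... | σ , a , b , refl , ad , inj₁ refl = prim⇒ n c p (subst (λ n → Admissible n a b) len ad)

tprim-dim : ∀ n → HasDim (TPrim (suc n)) (length (filter blue? (packedWords (suc n))))
tprim-dim n = HasDim-⇔ to from (solution-dim (triangular tprim n))
  where
  open TriangularSystem (Free tprim) (free? tprim) (rest tprim)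
  to : ∀ c → Solution (packedWords (suc n)) c → TPrim (suc n) c
  to c sol = ⇒tprim n c (supported⇒InWQSym (proj₁ sol)) annˡ annʳ
    where
    annʳ : Annihilates right (suc n) c
    annʳ = solution-annihilates tprim n sol ≻≻
    annˡ : Annihilates left (suc n) c
    annˡ = annihilates-insert annʳ λ {s} {x} bs ad → let open Admissible ad in
      solution⇒ tprim n sol (insertion refl bs packedʳ nonemptyʳ) (trans (cut-length (cut-insert s x packedʳ)) length≡)
  from : ∀ c → TPrim (suc n) c → Solution (packedWords (suc n)) c
  from c p = ⇒solution tprim n (proj₁ p) zero-total
    where
    zero-total : ∀ {u L} → Equation tprim u L → length u ≡ suc n → total c L ≡ 0ℚ
    zero-total eq len with equation-admissible eq
    ... | σ , a , b , refl , ad , inj₁ refl = proj₂ (tprim⇒ n c p) (subst (λ n → Admissible n a b) len ad)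
    ... | σ , a , b , refl , ad , inj₂ (_ , refl) = proj₁ (tprim⇒ n c p) (subst (λ n → Admissible n a b) len ad)

-- When every word is free the triangular system has no equations, and its solutions are all the
-- vectors supported on `packedWords n`.
wqsym-dim : ∀ n → HasDim (InWQSym n) (length (packedWords n))
wqsym-dim n = subst (HasDim (InWQSym n)) (cong length (filter-all (λ _ → yes tt) (All.tabulate {xs = packedWords n} (λ _ → tt))))
  (HasDim-⇔ (λ c sol → supported⇒InWQSym (proj₁ sol)) (λ c c∈ → ∉packedWords c∈ , λ {_} _ ¬f → ⊥-elim (¬f tt))
    (solution-dim (sorted⇒triangular _ (packedWords-sorted n) (λ {_} _ ¬f → ⊥-elim (¬f tt)))))
  where open TriangularSystem (λ _ → ⊤) (λ _ → yes tt) (λ _ → [])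

zero-dim : HasDim IsZero 0
zero-dim = [] , (λ ()) , (λ _ _ ()) , λ c z → [] , z

filter-packedWords⁺ : ∀ {P : Word → Set} (P? : ∀ w → Dec (P w)) {n m w} → Packed m w → P w → length w ≡ n → w ∈ filter P? (packedWords n)
filter-packedWords⁺ P? pw p refl = ∈-filter⁺ P? (∈-packedWords⁺ pw) p

filter-packedWords⁻ : ∀ {P : Word → Set} (P? : ∀ w → Dec (P w)) n {w} → w ∈ filter P? (packedWords n) → length w ≡ n × P w
filter-packedWords⁻ P? n w∈ = let w∈W , p = ∈-filter⁻ P? {xs = packedWords n} w∈ in proj₁ (∈-packedWords⁻ n w∈W) , p

irreducible-length≢0 : ∀ {w} → Irreducible w → length w ≢ 0
irreducible-length≢0 {[]}    i _ = Irreducible.nonempty i refl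
irreducible-length≢0 {_ ∷ _} i ()

mainTheorem2 : ∀ (n : ℕ) →
    (∃[ k ] (HasDim (InWQSym n) k × (BPForestOfSize n ↔ Fin k)))
    × (∃[ k ] (HasDim (Prim n) k × (BPTreeOfSize n ↔ Fin k)))
    × (∃[ k ] (HasDim (TPrim n) k × (BPTreeLeftEmptyOfSize n ↔ Fin k)))
mainTheorem2 n = (_ , wqsym-dim n , forests↔ (packedWords-unique n) (λ { refl → ∈-packedWords⁺ }) (∈-packedWords⁻ n))
               , trees n , leftEmptyTrees n
  where
  trees : ∀ n → ∃[ k ] (HasDim (Prim n) k × (BPTreeOfSize n ↔ Fin k))
  -- In degree 0 the space is zero by definition, and the matching list of words is empty because
  -- irreducible words are nonempty.
  trees zero    = _ , zero-dim , trees↔ [] (λ len i → ⊥-elim (irreducible-length≢0 i len)) (λ ())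
  trees (suc n) = _ , prim-dim n , trees↔ (Uniqueₚ.filter⁺ irreducible? (packedWords-unique (suc n)))
    (λ len i → filter-packedWords⁺ irreducible? (Irreducible.packed i) i len) (filter-packedWords⁻ irreducible? (suc n))
  leftEmptyTrees : ∀ n → ∃[ k ] (HasDim (TPrim n) k × (BPTreeLeftEmptyOfSize n ↔ Fin k))
  leftEmptyTrees zero    = _ , zero-dim , leftEmptyTrees↔ [] (λ len b → ⊥-elim (irreducible-length≢0 (blue-irreducible b) len)) (λ ())
  leftEmptyTrees (suc n) = _ , tprim-dim n , leftEmptyTrees↔ (Uniqueₚ.filter⁺ blue? (packedWords-unique (suc n)))
    (λ len b → filter-packedWords⁺ blue? (Irreducible.packed (blue-irreducible b)) b len) (filter-packedWords⁻ blue? (suc n))
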